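{- Let $G$ be an unweighted undirected $n$-vertex graph, let $0<\epsilon<1$ and let $r\ge 2$ be an integer. There is a deterministic algorithm in the Congested Clique model that builds a $(1+\epsilon,\beta)$-emulator $H$ of $G$ with $O(r\cdot n^{1+\frac{1}{2^r}})$ edges in $O\!\left(\frac{\log^2\beta}{\epsilon}+r(\log\log n)^3\right)$ rounds, where $\beta=O\!\left(\frac{r}{\epsilon}\right)^{r-1}$. In particular, for $r=\log\log n$, the emulator has $O(n\log\log n)$ edges, the algorithm takes $O\!\left(\frac{\log^2\beta}{\epsilon}+(\log\log n)^4\right)$ rounds, and $\beta=O\!\left(\frac{\log\log n}{\epsilon}\right)^{\log\log n}$.
   Context: Congested Clique model: the $n$ vertices communicate in synchronous rounds; each pair of vertices may exchange $O(\log n)$ bits per round; initially each vertex knows only its incident edges, and at the end each vertex knows its incident emulator edges and their weights. For an unweighted graph $G=(V,E)$, a weighted graph $H=(V,E',w)$ on the same vertex set (whose edges need not belong to $G$) is a $(1+\epsilon,\beta)$-emulator of $G$ if $d_G(u,v)\le d_H(u,v)\le(1+\epsilon)d_G(u,v)+\beta$ for all $u,v\in V$. -}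

module Defs where

open import Data.Nat as ℕ using (ℕ; zero; suc; _⊔_)
open import Data.Nat.Logarithm using (⌈log₂_⌉)
open import Data.Integer using (+_)
open import Data.Fin using (Fin)
open import Data.Vec using (Vec)
open import Data.List using (List; length; sum; map)
open import Data.List.Membership.Propositional using (_∈_)
open import Data.Bool using (Bool; true; false)
open import Data.Product using (_×_; _,_; Σ; ∃)
open import Data.Rational as ℚ using (ℚ; _/_)
open import Relation.Binary.PropositionalEquality using (_≡_)
open import Data.Vec.Functional using () renaming (foldr to vfoldr)

⟦_⟧ : ℕ → ℚ
⟦ n ⟧ = + n / 1

_^ℚ_ : ℚ → ℕ → ℚ
q ^ℚ zero = ℚ.1ℚ
q ^ℚ suc k = q ℚ.* (q ^ℚ k)

lg : ℕ → ℕ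
lg x = 1 ⊔ ⌈log₂ x ⌉

record Graph (n : ℕ) : Set where
  field
    adj    : Fin n → Fin n → Bool
    sym    : ∀ u v → adj u v ≡ adj v u
    irrefl : ∀ v → adj v v ≡ false

data Walk {n : ℕ} (G : Graph n) : Fin n → Fin n → ℕ → Set where
  here : ∀ {u} → Walk G u u 0
  step : ∀ {u v w ℓ} → Graph.adj G u v ≡ true → Walk G v w ℓ → Walk G u w (suc ℓ)

-- Weighted graphs given by the local outputs: vertex u knows the list
-- of its incident edges (v , weight).

WGraph : ℕ → Set
WGraph n = Fin n → List (Fin n × ℕ)

Symmetric : ∀ {n} → WGraph n → Set
Symmetric {n} H = ∀ (u v : Fin n) (w : ℕ) → (v , w) ∈ H u → (u , w) ∈ H v

data WWalk {n : ℕ} (H : WGraph n) : Fin n → Fin n → ℕ → Set where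
  here : ∀ {u} → WWalk H u u 0
  step : ∀ {u v x w c} → (v , w) ∈ H u → WWalk H v x c → WWalk H u x (w ℕ.+ c)

-- total number of (directed) entries in the output lists: 2|E'| for a
-- duplicate-free symmetric output
entries : ∀ {n} → WGraph n → ℕ
entries {n} H = vfoldr (λ l acc → length l ℕ.+ acc) 0 H

-- (1+ε, β)-emulator, with distances unfolded:
--   d_G(u,v) ≤ d_H(u,v):  every H-walk of weight c is matched by a G-walk of length ≤ c
--   d_H(u,v) ≤ (1+ε) d_G(u,v) + β:  every G-walk of length ℓ is matched by an
--     H-walk of weight ≤ (1+ε)ℓ + β
IsEmulator : ∀ {n} → Graph n → WGraph n → ℚ → ℕ → Set
IsEmulator {n} G H ε β =
  Symmetric H ×
  (∀ (u v : Fin n) (c : ℕ) → WWalk H u v c → Σ ℕ λ ℓ → Walk G u v ℓ × ℓ ℕ.≤ c) ×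
  (∀ (u v : Fin n) (ℓ : ℕ) → Walk G u v ℓ →
     Σ ℕ λ c → WWalk H u v c × ⟦ c ⟧ ℚ.≤ (ℚ.1ℚ ℚ.+ ε) ℚ.* ⟦ ℓ ⟧ ℚ.+ ⟦ β ⟧)

-- Deterministic Congested Clique algorithms on n vertices with
-- messages of exactly b bits per ordered pair per round.
-- Local computation is unrestricted (as in the model).

record CCAlgorithm (n b : ℕ) : Set₁ where
  field
    State  : Set
    init   : Fin n → (Fin n → Bool) → State
    send   : State → Fin n → Vec Bool b
    recv   : State → (Fin n → Vec Bool b) → State
    output : State → List (Fin n × ℕ)

module _ {n b : ℕ} (A : CCAlgorithm n b) (G : Graph n) where
  open CCAlgorithm A

  run : ℕ → Fin n → State
  run zero    v = init v (Graph.adj G v)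
  run (suc t) v = recv (run t v) (λ u → send (run t u) v)

  result : ℕ → WGraph n
  result T v = output (run T v)

Builds : ∀ {n b} → CCAlgorithm n b → (T : ℕ) → (ε : ℚ) → (β : ℕ) → (m : ℕ) → Set
Builds {n} A T ε β m =
  ∀ (G : Graph n) → IsEmulator G (result A G T) ε β × entries (result A G T) ℕ.≤ m

{-# OPTIONS --safe #-}
-- The emulator has levels S₀ ⊇ S₁ ⊇ … with S₀ = V and scales λᵢ = ρ ^ i, where ρ is of
-- order r / ε.  A vertex of level i computes the k nearest vertices of level i within
-- distance 4λᵢ, where k is about √n.  If the list is short and misses the sample for level
-- i + 1, the vertex is joined to the whole list; if the list meets the sample, the vertex is
-- joined to one sampled vertex; a vertex with a full list that misses the sample is added to
-- level i + 1.  The samples come from a pairwise independent hash family over the field with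
-- two elements, whose seed is chosen deterministically so that Chebyshev's inequality bounds
-- the number of missed lists.  A shortest path is cut into segments of length λᵢ, and the
-- part between the first and the last segment whose ends passed to level i + 1 is bridged
-- there; this gives the stretch by induction on the level.
--
-- Distances come from min-plus products of matrices whose rows have at most k finite
-- entries, and such a product takes O(1) rounds.  Exploration at a large scale would need
-- many products, so approximate distances are built by doubling the scale: every vertex is
-- near a hitting set of the full lists at that scale, and jumps between listed vertices and
-- the hitting set replace long walks by walks with few hops.  The hitting set must have
-- fewer than k elements: it comes from two sampling steps and a greedy independent set,
-- because disjoint full balls pack.  The vertices host 16 ^ a ≥ n virtual vertices, so that
-- √n is an integer.
module Submission where

open import Defs
open import Data.Nat using (ℕ; _+_; _*_; _^_; _∸_; _≤_; zero; suc; _<_; z≤n; s≤s; _⊓_; NonZero; _≤?_; _<?_; _≟_; _%_; _/_)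
open import Data.Product using (_×_; Σ-syntax; _,_; proj₁; proj₂; ∃)
open import Data.Rational using (ℚ; 0ℚ; 1ℚ) renaming (_<_ to _<ℚ_; _≤_ to _≤ℚ_; _+_ to _+ℚ_; _*_ to _*ℚ_)
import Data.Nat as ℕ
open import Data.Nat.Properties hiding (_≟_; _≤?_; _<?_)
open import Data.Nat.DivMod hiding (result)
open import Data.Nat.Tactic.RingSolver using (solve-∀)
open import Data.Nat.Logarithm using (⌈log₂_⌉; ⌈log₂⌉-mono-≤)
import Data.Fin
open import Data.Fin using (Fin; zero; suc; toℕ; fromℕ<; combine; remQuot; inject≤)
import Data.Fin.Properties as Fin
open import Data.Bool using (Bool; true; false; _∧_; _∨_; not; _xor_; if_then_else_)
import Data.Bool as Bool
open import Data.List using (List; []; _∷_; length; map; filter; allFin; _++_)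
open import Data.List.Membership.Propositional using (_∈_)
import Data.List.Membership.Propositional.Properties as Mem
import Data.List.Properties
open import Data.List.Relation.Unary.Any using (here; there)
open import Data.Vec using (Vec; []; _∷_; lookup; tabulate; replicate)
import Data.Vec as Vec
import Data.Vec.Properties as Vec
open import Data.Sum using (_⊎_; inj₁; inj₂; [_,_]′)
open import Data.Empty using (⊥; ⊥-elim)
open import Function using (_∘_; id)
open import Relation.Nullary using (¬_; Dec; yes; no; does)
open import Relation.Nullary.Decidable using (dec-true; dec-false)
open import Relation.Binary.PropositionalEquality using (_≡_; _≢_; refl; sym; trans; cong; cong₂; subst; subst₂; module ≡-Reasoning)
import Data.Rational as ℚ
import Data.Rational.Properties as ℚ
import Data.Rational.Unnormalised as ℚᵘ
import Data.Rational.Unnormalised.Properties as ℚᵘ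
import Data.Integer as ℤ
import Data.Integer.Properties as ℤ
import Data.Nat.Coprimality as Coprime
import Data.Nat.Logarithm as Log
import Data.Nat.Induction
import Data.Vec.Functional

-- Lists truncated to k entries cannot promise distances outright. What survives truncation is a
-- disjunction, `Good f u D`: u is listed within D, or k vertices are. Filtered min-plus products
-- preserve it, so every distance computation states its outcome in this form. The second
-- alternative is then either useful, since full lists are easy to hit and their balls pack, or
-- excluded, because fewer than k vertices could be listed at all. The latter is why the hitting set
-- of each scale and the last level must have fewer than k vertices. Chebyshev's inequality forces
-- `τ * τ ≤ k` for a sample of rate 1/τ, so one sampling thins only by about the square root of k;
-- hence the combination of two samplings with a packing argument. Stretch is kept in integers: 1/ε
-- is replaced by an integer e, and a stretch factor is a numerator over a fixed denominator,
-- `2 ^ a′` for the approximate distances and `4 * (e * r)` for the levels. Each doubling and each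
-- level adds a fixed number of units to its numerator, so neither error compounds.

-- Sums, counting and minima over finite index sets

opaque
  ∑ : ∀ {n} → (Fin n → ℕ) → ℕ
  ∑ {zero}  f = 0
  ∑ {suc n} f = f zero + ∑ (f ∘ suc)

opaque
  unfolding ∑
  ∑-cong : ∀ {n} {f g : Fin n → ℕ} → (∀ i → f i ≡ g i) → ∑ f ≡ ∑ g
  ∑-cong {zero}  p = refl
  ∑-cong {suc n} p = cong₂ _+_ (p zero) (∑-cong (p ∘ suc))

opaque
  unfolding ∑
  ∑-mono : ∀ {n} {f g : Fin n → ℕ} → (∀ i → f i ≤ g i) → ∑ f ≤ ∑ g
  ∑-mono {zero}  p = z≤n
  ∑-mono {suc n} p = +-mono-≤ (p zero) (∑-mono (p ∘ suc))

opaque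
  unfolding ∑
  ∑-+ : ∀ {n} (f g : Fin n → ℕ) → ∑ (λ i → f i + g i) ≡ ∑ f + ∑ g
  ∑-+ {zero}  f g = refl
  ∑-+ {suc n} f g = trans (cong (f zero + g zero +_) (∑-+ (f ∘ suc) (g ∘ suc)))
                          (lem (f zero) (g zero) (∑ (f ∘ suc)) (∑ (g ∘ suc)))
    where
    lem : ∀ a b c d → a + b + (c + d) ≡ a + c + (b + d)
    lem = solve-∀

opaque
  unfolding ∑
  ∑-*ˡ : ∀ {n} c (f : Fin n → ℕ) → ∑ (λ i → c * f i) ≡ c * ∑ f
  ∑-*ˡ {zero}  c f = sym (*-zeroʳ c)
  ∑-*ˡ {suc n} c f = trans (cong (c * f zero +_) (∑-*ˡ c (f ∘ suc))) (sym (*-distribˡ-+ c _ _))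

opaque
  unfolding ∑
  ∑-const : ∀ n c → ∑ {n} (λ _ → c) ≡ n * c
  ∑-const zero    c = refl
  ∑-const (suc n) c = cong (c +_) (∑-const n c)

∑-0 : ∀ n → ∑ {n} (λ _ → 0) ≡ 0
∑-0 n = trans (∑-const n 0) (*-zeroʳ n)

opaque
  unfolding ∑
  ∑-swap : ∀ {m n} (f : Fin m → Fin n → ℕ) → ∑ (λ i → ∑ (f i)) ≡ ∑ (λ j → ∑ (λ i → f i j))
  ∑-swap {zero}  {n} f = sym (∑-0 n)
  ∑-swap {suc m} {n} f = trans (cong (∑ (f zero) +_) (∑-swap (f ∘ suc))) (sym (∑-+ (f zero) _))

opaque
  unfolding ∑
  term≤∑ : ∀ {n} (f : Fin n → ℕ) i → f i ≤ ∑ f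
  term≤∑ f zero    = m≤m+n _ _
  term≤∑ f (suc i) = ≤-trans (term≤∑ (f ∘ suc) i) (m≤n+m _ (f zero))

opaque
  unfolding ∑
  ∑-only : ∀ {n} (f : Fin n → ℕ) i → (∀ j → j ≢ i → f j ≡ 0) → ∑ f ≡ f i
  ∑-only {suc n} f zero    p = trans (cong (f zero +_) (trans (∑-cong (λ j → p (suc j) λ ())) (∑-0 n))) (+-identityʳ _)
  ∑-only {suc n} f (suc i) p = trans (cong (_+ ∑ (f ∘ suc)) (p zero λ ()))
                                     (∑-only (f ∘ suc) i λ j j≢i → p (suc j) λ { refl → j≢i refl })

∑≤ : ∀ {n} (f : Fin n → ℕ) c → (∀ i → f i ≤ c) → ∑ f ≤ n * c
∑≤ {n} f c p = ≤-trans (∑-mono p) (≤-reflexive (∑-const n c))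

𝟙 : Bool → ℕ
𝟙 true  = 1
𝟙 false = 0

𝟙≤1 : ∀ b → 𝟙 b ≤ 1
𝟙≤1 true  = ≤-refl
𝟙≤1 false = z≤n

𝟙-mono : ∀ a b → (a ≡ true → b ≡ true) → 𝟙 a ≤ 𝟙 b
𝟙-mono false b p = z≤n
𝟙-mono true  b p rewrite p refl = ≤-refl

count : ∀ {n} → (Fin n → Bool) → ℕ
count P = ∑ (𝟙 ∘ P)

count-mono : ∀ {n} {P Q : Fin n → Bool} → (∀ i → P i ≡ true → Q i ≡ true) → count P ≤ count Q
count-mono p = ∑-mono λ i → 𝟙-mono _ _ (p i)

count≤n : ∀ {n} (P : Fin n → Bool) → count P ≤ n
count≤n {n} P = ≤-trans (∑≤ _ 1 (𝟙≤1 ∘ P)) (≤-reflexive (*-identityʳ n))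

count-none : ∀ {n} (P : Fin n → Bool) → (∀ i → P i ≡ false) → count P ≡ 0
count-none {n} P p = trans (∑-cong (λ i → cong 𝟙 (p i))) (∑-0 n)

∧-true : ∀ {a b} → a ∧ b ≡ true → a ≡ true × b ≡ true
∧-true {true} {true} _ = refl , refl

true∧ : ∀ {a b} → a ≡ true → b ≡ true → a ∧ b ≡ true
true∧ refl refl = refl

not-true : ∀ {a} → not a ≡ true → a ≡ false
not-true {false} _ = refl

bool? : (b : Bool) → (b ≡ true) ⊎ (b ≡ false)
bool? true  = inj₁ refl
bool? false = inj₂ refl

true≢false : ∀ {b} → b ≡ true → b ≡ false → ⊥
true≢false refl ()

holds : ∀ {A : Set} (d : Dec A) → does d ≡ true → A
holds (yes a) _ = a

fails : ∀ {A : Set} (d : Dec A) → does d ≡ false → ¬ A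
fails (no ¬a) _ = ¬a

opaque
  unfolding ∑
  count≤1 : ∀ {n} (P : Fin n → Bool) → (∀ i j → P i ≡ true → P j ≡ true → i ≡ j) → count P ≤ 1
  count≤1 {zero}  P u = z≤n
  count≤1 {suc n} P u with bool? (P zero)
  ... | inj₂ e rewrite e = count≤1 (P ∘ suc) λ i j a b → Fin.suc-injective (u _ _ a b)
  ... | inj₁ e rewrite e = s≤s (≤-reflexive (count-none (P ∘ suc) λ i → none i (bool? (P (suc i)))))
    where
    none : ∀ i → (P (suc i) ≡ true) ⊎ (P (suc i) ≡ false) → P (suc i) ≡ false
    none i (inj₂ e′) = e′
    none i (inj₁ e′) with u zero (suc i) e e′
    ... | ()

count-witness : ∀ {n} (P : Fin n → Bool) → (∃ λ i → P i ≡ true) ⊎ (∀ i → P i ≡ false)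
count-witness {zero}  P = inj₂ λ ()
count-witness {suc n} P with bool? (P zero) | count-witness (P ∘ suc)
... | inj₁ e | _            = inj₁ (zero , e)
... | inj₂ _ | inj₁ (i , e) = inj₁ (suc i , e)
... | inj₂ e | inj₂ none    = inj₂ λ { zero → e ; (suc i) → none i }

count-positive : ∀ {n} (P : Fin n → Bool) i → P i ≡ true → 1 ≤ count P
count-positive P i e = ≤-trans (≤-reflexive (cong 𝟙 (sym e))) (term≤∑ (𝟙 ∘ P) i)

opaque
  unfolding ∑
  ∑-inject : ∀ {m n} (m≤n : m ≤ n) (f : Fin n → ℕ) → ∑ (λ i → f (inject≤ i m≤n)) ≤ ∑ f
  ∑-inject {zero}  m≤n f = z≤n
  ∑-inject {suc m} {suc n} (s≤s m≤n) f = +-monoʳ-≤ (f zero) (∑-inject m≤n (f ∘ suc))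

earlier : ∀ {n} → (Fin (suc n) → ℕ) → Fin n → Fin (suc n)
earlier f j = if does (f zero ≤? f (suc j)) then zero else suc j

earlier≤ : ∀ {n} (f : Fin (suc n) → ℕ) j → f (earlier f j) ≤ f zero × f (earlier f j) ≤ f (suc j)
earlier≤ f j with bool? (does (f zero ≤? f (suc j)))
... | inj₁ e rewrite e = ≤-refl , holds (f zero ≤? f (suc j)) e
... | inj₂ e rewrite e = <⇒≤ (≰⇒> (fails (f zero ≤? f (suc j)) e)) , ≤-refl

argmin : ∀ {n} → Fin n → (Fin n → ℕ) → Fin n
argmin {suc zero}    _ f = zero
argmin {suc (suc n)} _ f = earlier f (argmin zero (f ∘ suc))

argmin≤ : ∀ {n} (i₀ : Fin n) (f : Fin n → ℕ) j → f (argmin i₀ f) ≤ f j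
argmin≤ {suc zero}    i₀ f zero    = ≤-refl
argmin≤ {suc (suc n)} i₀ f zero    = proj₁ (earlier≤ f (argmin zero (f ∘ suc)))
argmin≤ {suc (suc n)} i₀ f (suc j) =
  ≤-trans (proj₂ (earlier≤ f (argmin zero (f ∘ suc)))) (argmin≤ zero (f ∘ suc) j)

-- The averaging step of the derandomisation: it replaces a random index by a minimiser.
argmin-average : ∀ {n} i₀ (f : Fin n → ℕ) → n * f (argmin i₀ f) ≤ ∑ f
argmin-average {n} i₀ f = ≤-trans (≤-reflexive (sym (∑-const n _))) (∑-mono (argmin≤ i₀ f))

minF : ∀ {n} → ℕ → (Fin n → ℕ) → ℕ
minF {zero}  top f = top
minF {suc n} top f = f zero ⊓ minF top (f ∘ suc)

minF≤ : ∀ {n} top (f : Fin n → ℕ) i → minF top f ≤ f i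
minF≤ top f zero    = m⊓n≤m _ _
minF≤ top f (suc i) = ≤-trans (m⊓n≤n (f zero) _) (minF≤ top (f ∘ suc) i)

minF≤top : ∀ {n} top (f : Fin n → ℕ) → minF top f ≤ top
minF≤top {zero}  top f = ≤-refl
minF≤top {suc n} top f = ≤-trans (m⊓n≤n (f zero) _) (minF≤top top (f ∘ suc))

minF-attained : ∀ {n} top (f : Fin n → ℕ) → minF top f < top → ∃ λ i → f i ≡ minF top f
minF-attained {zero}  top f lt = ⊥-elim (<-irrefl refl lt)
minF-attained {suc n} top f lt with ⊓-sel (f zero) (minF top (f ∘ suc))
... | inj₁ e = zero , sym e
... | inj₂ e with minF-attained top (f ∘ suc) (subst (_< top) e lt)
...   | i , e′ = suc i , trans e′ (sym e)

≤minF : ∀ {n} top (f : Fin n → ℕ) b → b ≤ top → (∀ i → b ≤ f i) → b ≤ minF top f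
≤minF {zero}  top f b p q = p
≤minF {suc n} top f b p q = ⊓-glb (q zero) (≤minF top (f ∘ suc) b p (q ∘ suc))

greatest : ℕ → (ℕ → Bool) → ℕ
greatest zero    P = 0
greatest (suc m) P = if P (suc m) then suc m else greatest m P

nth : List ℕ → ℕ → ℕ → ℕ
nth []       d e       = d
nth (x ∷ xs) d zero    = x
nth (x ∷ xs) d (suc e) = nth xs d e

nth-∈ : ∀ xs d e → (nth xs d e ∈ xs) ⊎ (nth xs d e ≡ d)
nth-∈ []       d e       = inj₂ refl
nth-∈ (x ∷ xs) d zero    = inj₁ (here refl)
nth-∈ (x ∷ xs) d (suc e) with nth-∈ xs d e
... | inj₁ p = inj₁ (there p)
... | inj₂ p = inj₂ p

∈-nth : ∀ {xs x} d → x ∈ xs → ∃ λ e → e < length xs × nth xs d e ≡ x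
∈-nth d (here refl) = 0 , s≤s z≤n , refl
∈-nth d (there p) with ∈-nth d p
... | e , lt , eq = suc e , s≤s lt , eq

greatest-true : ∀ (m : ℕ) (P : ℕ → Bool) → P 0 ≡ true → P (greatest m P) ≡ true
greatest-true zero    P p = p
greatest-true (suc m) P p with bool? (P (suc m))
... | inj₁ e rewrite e = e
... | inj₂ e rewrite e = greatest-true m P p

-- The search stops at its ceiling or just below a failure; the failure is what yields a lower bound
-- on the number of entries kept by a cut.
greatest-max : ∀ (m : ℕ) (P : ℕ → Bool) → greatest m P ≡ m ⊎ P (suc (greatest m P)) ≡ false
greatest-max zero    P = inj₁ refl
greatest-max (suc m) P with bool? (P (suc m))
... | inj₁ e rewrite e = inj₁ refl
... | inj₂ e rewrite e with greatest-max m P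
...   | inj₁ e′ = inj₂ (trans (cong (P ∘ suc) e′) e)
...   | inj₂ e′ = inj₂ e′

minF-cong : ∀ {n} top {f g : Fin n → ℕ} → (∀ i → f i ≡ g i) → minF top f ≡ minF top g
minF-cong {zero}  top p = refl
minF-cong {suc n} top p = cong₂ _⊓_ (p zero) (minF-cong top (p ∘ suc))

if-true : ∀ {A : Set} {b} {x y : A} → b ≡ true → (if b then x else y) ≡ x
if-true refl = refl

if-false : ∀ {A : Set} {b} {x y : A} → b ≡ false → (if b then x else y) ≡ y
if-false refl = refl

if-≤ : ∀ b {x y z : ℕ} → z ≤ x → z ≤ y → z ≤ (if b then x else y)
if-≤ true  p q = p
if-≤ false p q = q

opaque
  unfolding ∑
  length-filter : ∀ {A : Set} {P : A → Set} (P? : ∀ x → Dec (P x)) {n} (g : Fin n → A) →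
    length (filter P? (Data.List.tabulate g)) ≡ count (λ i → does (P? (g i)))
  length-filter P? {zero}  g = refl
  length-filter P? {suc n} g with does (P? (g zero))
  ... | true  = cong suc (length-filter P? (g ∘ suc))
  ... | false = length-filter P? (g ∘ suc)

-- Truncated distance tables and their encoding

-- A table assigns a distance to every vertex; the value INF stands for "absent".
-- Only the k entries with the smallest keys survive a cut, where the key of an
-- entry packs its distance and its vertex into one number.

module Tables (N k INF : ℕ) .{{_ : NonZero N}} where

  Table : Set
  Table = Fin N → ℕ

  key : Table → Fin N → ℕ
  key f u = f u * N + toℕ u

  key% : ∀ f u → key f u % N ≡ toℕ u
  key% f u = trans (cong (_% N) (+-comm (f u * N) (toℕ u)))
                   (trans ([m+kn]%n≡m%n (toℕ u) (f u) N) (m<n⇒m%n≡m (Fin.toℕ<n u)))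

  key/ : ∀ f u → key f u / N ≡ f u
  key/ f u = trans (+-distrib-/-∣ˡ {m = f u * N} (toℕ u) (divides (f u) refl))
               (trans (cong₂ _+_ (m*n/n≡m (f u) N) (m<n⇒m/n≡0 (Fin.toℕ<n u))) (+-identityʳ _))
    where open import Data.Nat.Divisibility using (divides)

  key-injective : ∀ f {u v} → key f u ≡ key f v → u ≡ v
  key-injective f {u} {v} e = Fin.toℕ-injective (trans (sym (key% f u)) (trans (cong (_% N) e) (key% f v)))

  key< : ∀ f u → key f u < suc (f u) * N
  key< f u = ≤-trans (+-monoʳ-< (f u * N) (Fin.toℕ<n u)) (≤-reflexive (+-comm (f u * N) N))

  key-order : ∀ f u v → key f u < key f v → f u ≤ f v
  key-order f u v lt = ℕ.s≤s⁻¹ (*-cancelʳ-< N (f u) (suc (f v))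
    (≤-<-trans (m≤m+n (f u * N) (toℕ u)) (<-trans lt (key< f v))))

  below : Table → ℕ → ℕ
  below f θ = count (λ u → does (key f u <? θ))

  -- Keys are pairwise distinct, so raising the threshold by one admits at most one entry. A maximal
  -- threshold below its ceiling therefore keeps exactly k entries.
  below-suc : ∀ f θ → below f (suc θ) ≤ suc (below f θ)
  below-suc f θ = begin
    below f (suc θ)
      ≤⟨ ∑-mono split ⟩
    ∑ (λ u → 𝟙 (does (key f u <? θ)) + 𝟙 (does (key f u ≟ θ)))
      ≡⟨ ∑-+ (λ u → 𝟙 (does (key f u <? θ))) (λ u → 𝟙 (does (key f u ≟ θ))) ⟩
    below f θ + count (λ u → does (key f u ≟ θ))
      ≤⟨ +-monoʳ-≤ (below f θ) (count≤1 _ λ u v a b →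
           key-injective f (trans (holds (key f u ≟ θ) a) (sym (holds (key f v ≟ θ) b)))) ⟩
    below f θ + 1
      ≡⟨ +-comm (below f θ) 1 ⟩
    suc (below f θ) ∎
    where
    open ≤-Reasoning
    split : ∀ u → 𝟙 (does (key f u <? suc θ)) ≤ 𝟙 (does (key f u <? θ)) + 𝟙 (does (key f u ≟ θ))
    split u with bool? (does (key f u <? suc θ))
    ... | inj₂ e rewrite e = z≤n
    ... | inj₁ e with m≤n⇒m<n∨m≡n (ℕ.s≤s⁻¹ (holds (key f u <? suc θ) e))
    ...   | inj₁ lt rewrite e | dec-true (key f u <? θ) lt = s≤s z≤n
    ...   | inj₂ eq rewrite e | dec-true (key f u ≟ θ) eq = m≤n+m 1 _

  threshold : Table → ℕ
  threshold f = greatest (INF * N) (λ θ → does (below f θ ≤? k))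

  kept : Table → Fin N → Bool
  kept f u = does (key f u <? threshold f)

  cut : Table → Table
  cut f u = if kept f u then f u else INF

  below-threshold : ∀ f → below f (threshold f) ≤ k
  below-threshold f = holds (below f (threshold f) ≤? k) (greatest-true (INF * N) (λ θ → does (below f θ ≤? k)) zero-ok)
    where
    zero-ok : does (below f 0 ≤? k) ≡ true
    zero-ok = dec-true (below f 0 ≤? k)
      (≤-trans (≤-reflexive (count-none (λ u → does (key f u <? 0)) (λ u → dec-false (key f u <? 0) λ ()))) z≤n)

  size : Table → ℕ
  size f = count (λ u → does (f u <? INF))

  size-cut : ∀ f → size (cut f) ≤ k
  size-cut f = ≤-trans (count-mono kept-if) (below-threshold f)
    where
    kept-if : ∀ u → does (cut f u <? INF) ≡ true → kept f u ≡ true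
    kept-if u e with bool? (kept f u)
    ... | inj₁ p = p
    ... | inj₂ p rewrite p = ⊥-elim (<-irrefl refl (holds (INF <? INF) e))

  cut≤ : ∀ f → (∀ u → f u ≤ INF) → ∀ u → cut f u ≤ INF
  cut≤ f b u with kept f u
  ... | true  = b u
  ... | false = ≤-refl

  cut-sound : ∀ f u → cut f u < INF → cut f u ≡ f u
  cut-sound f u lt with bool? (kept f u)
  ... | inj₁ p rewrite p = refl
  ... | inj₂ p rewrite p = ⊥-elim (<-irrefl refl lt)

  cut-kept : ∀ f u → kept f u ≡ true → cut f u ≡ f u
  cut-kept f u p rewrite p = refl

  within : Table → ℕ → Fin N → Bool
  within f D v = does (f v ≤? D)

  -- Unlike `f u ≤ D` alone, the disjunction is stable under `cut`: an entry within D is lost only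
  -- when k entries with smaller keys take its place.
  Good : Table → Fin N → ℕ → Set
  Good f u D = f u ≤ D ⊎ k ≤ count (within f D)

  Good-mono : ∀ {f g u D E} → (∀ v → f v ≤ D → g v ≤ E) → Good f u D → Good g u E
  Good-mono {f} {g} {u} {D} {E} p (inj₁ q) = inj₁ (p u q)
  Good-mono {f} {g} {u} {D} {E} p (inj₂ q) = inj₂ (≤-trans q
    (count-mono λ v e → dec-true (g v ≤? E) (p v (holds (f v ≤? D) e))))

  -- `D < INF` puts the key of u below the ceiling `INF * N`, so the threshold was stopped by a
  -- failure. Then at least k entries are kept, and their keys are smaller than that of the dropped
  -- u.
  full-cut : ∀ f u D → D < INF → f u ≤ D → kept f u ≡ false → k ≤ count (within (cut f) D)
  full-cut f u D D<INF fu≤D e with greatest-max (INF * N) (λ θ → does (below f θ ≤? k))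
  ... | inj₁ θ≡ = ⊥-elim (fails (key f u <? threshold f) e (<-≤-trans (key< f u)
                    (≤-trans (*-monoˡ-≤ N (≤-<-trans fu≤D D<INF)) (≤-reflexive (sym θ≡)))))
  ... | inj₂ over = ≤-trans
    (ℕ.s≤s⁻¹ (<-≤-trans (≰⇒> (fails (below f (suc (threshold f)) ≤? k) over)) (below-suc f (threshold f))))
    (count-mono λ v p → dec-true (cut f v ≤? D) (≤-trans (≤-reflexive (cut-kept f v p))
      (≤-trans (key-order f v u (<-≤-trans (holds (key f v <? threshold f) p)
        (≮⇒≥ (fails (key f u <? threshold f) e)))) fu≤D)))

  -- If k entries lie within D and one of them is dropped, `full-cut` applied to the dropped one
  -- supplies k kept entries.
  Good-cut : ∀ {f u D} → D < INF → Good f u D → Good (cut f) u D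
  Good-cut {f} {u} {D} lt (inj₁ p) with bool? (kept f u)
  ... | inj₁ e = inj₁ (≤-trans (≤-reflexive (cut-kept f u e)) p)
  ... | inj₂ e = inj₂ (full-cut f u D lt p e)
  Good-cut {f} {u} {D} lt (inj₂ q) with count-witness (λ v → within f D v ∧ not (kept f v))
  ... | inj₁ (v , e) = inj₂ (full-cut f v D lt (holds (f v ≤? D) (proj₁ (∧-true e))) (not-true (proj₂ (∧-true e))))
  ... | inj₂ none = inj₂ (≤-trans q (count-mono λ v e → dec-true (cut f v ≤? D)
          (≤-trans (≤-reflexive (cut-kept f v (all-kept v e))) (holds (f v ≤? D) e))))
    where
    all-kept : ∀ v → within f D v ≡ true → kept f v ≡ true
    all-kept v e with bool? (kept f v)
    ... | inj₁ p = p
    ... | inj₂ p = ⊥-elim (true≢false (true∧ e (cong not p)) (none v))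

  keys : Table → List ℕ
  keys f = map (key f) (filter (λ u → f u <? INF) (allFin N))

  length-keys : ∀ f → length (keys f) ≡ size f
  length-keys f = trans (Data.List.Properties.length-map (key f) (filter (λ u → f u <? INF) (allFin N))) (length-filter (λ u → f u <? INF) id)


  -- The default `INF * N` is the key of an absent entry at vertex 0, so padding decodes to nothing.
  slot : Table → ℕ → ℕ
  slot f e = nth (keys f) (INF * N) e

  ∈-keys : ∀ f {c} → c ∈ keys f → ∃ λ u → f u < INF × c ≡ key f u
  ∈-keys f p with Mem.∈-map⁻ (key f) p
  ... | u , u∈ , e = u , proj₂ (Mem.∈-filter⁻ (λ u → f u <? INF) {xs = allFin N} u∈) , e

  slot≤ : ∀ f e → slot f e ≤ INF * N
  slot≤ f e with nth-∈ (keys f) (INF * N) e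
  ... | inj₂ eq = ≤-reflexive eq
  ... | inj₁ p with ∈-keys f p
  ...   | u , lt , eq = ≤-trans (≤-reflexive eq) (<⇒≤ (<-≤-trans (key< f u) (*-monoˡ-≤ N lt)))

  entry : ℕ → Table
  entry c u = if does (c % N ≟ toℕ u) then c / N else INF

  decode : ∀ {m} → (Fin m → ℕ) → Table
  decode s u = minF INF (λ e → entry (s e) u)

  decode-cong : ∀ {m} {s t : Fin m → ℕ} → (∀ e → s e ≡ t e) → ∀ u → decode s u ≡ decode t u
  decode-cong p u = minF-cong INF (λ e → cong (λ c → entry c u) (p e))

  entry-key : ∀ f u → entry (key f u) u ≡ f u
  entry-key f u = trans (if-true (dec-true (key f u % N ≟ toℕ u) (key% f u))) (key/ f u)

  entry-slot : ∀ f u e → f u ≤ INF → f u ≤ entry (slot f e) u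
  entry-slot f u e b with nth-∈ (keys f) (INF * N) e
  ... | inj₂ eq rewrite eq = if-≤ (does ((INF * N) % N ≟ toℕ u)) (≤-trans b (≤-reflexive (sym (m*n/n≡m INF N)))) b
  entry-slot f u e b | inj₁ p with ∈-keys f p
  ...   | v , lt , eq rewrite eq with bool? (does (key f v % N ≟ toℕ u))
  ...     | inj₂ e′ rewrite e′ = b
  ...     | inj₁ e′ with Fin.toℕ-injective (trans (sym (key% f v)) (holds (key f v % N ≟ toℕ u) e′))
  ...       | refl = ≤-reflexive (sym (entry-key f u))

  decode-slots : ∀ {m} f → (∀ u → f u ≤ INF) → size f ≤ m → ∀ u → decode {m} (λ e → slot f (toℕ e)) u ≡ f u
  decode-slots {m} f b sz u = ≤-antisym upper
    (≤minF INF (λ (e : Fin m) → entry (slot f (toℕ e)) u) (f u) (b u) (λ e → entry-slot f u (toℕ e) (b u)))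
    where
    upper : decode {m} (λ e → slot f (toℕ e)) u ≤ f u
    upper with f u <? INF
    ... | no  ge = ≤-trans (minF≤top INF (λ (e : Fin m) → entry (slot f (toℕ e)) u)) (≮⇒≥ ge)
    ... | yes lt with ∈-nth (INF * N) (Mem.∈-map⁺ (key f)
                        (Mem.∈-filter⁺ (λ u → f u <? INF) (Mem.∈-allFin u) lt))
    ...   | e , e< , eq = ≤-trans (minF≤ INF (λ (e : Fin m) → entry (slot f (toℕ e)) u) (fromℕ< e<m))
              (≤-reflexive (trans (cong (λ i → entry (slot f i) u) (Fin.toℕ-fromℕ< e<m))
                (trans (cong (λ c → entry c u) eq) (entry-key f u))))
      where
      e<m : e < m
      e<m = <-≤-trans e< (≤-trans (≤-reflexive (length-keys f)) sz)

-- Binary encoding of messages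

toBits : (L : ℕ) → ℕ → Vec Bool L
toBits zero    x = []
toBits (suc L) x = does (x % 2 ≟ 1) ∷ toBits L (x / 2)

fromBits : ∀ {L} → Vec Bool L → ℕ
fromBits []       = 0
fromBits (b ∷ bs) = 𝟙 b + fromBits bs * 2

𝟙-odd : ∀ x → 𝟙 (does (x % 2 ≟ 1)) ≡ x % 2
𝟙-odd x = bit (x % 2) (m%n<n x 2)
  where
  bit : ∀ y → y < 2 → 𝟙 (does (y ≟ 1)) ≡ y
  bit 0 _ = refl
  bit 1 _ = refl
  bit (suc (suc y)) (s≤s (s≤s ()))

fromBits-toBits : ∀ L x → x < 2 ^ L → fromBits (toBits L x) ≡ x
fromBits-toBits zero    x x<1 = sym (n<1⇒n≡0 x<1)
fromBits-toBits (suc L) x x<  = trans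
  (cong₂ (λ a b → a + b * 2) (𝟙-odd x) (fromBits-toBits L (x / 2) (m<n*o⇒m/o<n (<-≤-trans x< (≤-reflexive (*-comm 2 (2 ^ L)))))))
  (sym (m≡m%n+[m/n]*n x 2))

module Packing (W : ℕ) .{{_ : NonZero W}} where

  pack : ∀ {m} → Vec ℕ m → ℕ
  pack []       = 0
  pack (x ∷ xs) = x % W + pack xs * W

  unpack : ∀ m → ℕ → Vec ℕ m
  unpack zero    c = []
  unpack (suc m) c = c % W ∷ unpack m (c / W)

  pack< : ∀ {m} (v : Vec ℕ m) → pack v < W ^ m
  pack< []               = s≤s z≤n
  pack< {suc m} (x ∷ xs) = begin-strict
    x % W + pack xs * W   <⟨ +-monoˡ-< (pack xs * W) (m%n<n x W) ⟩
    suc (pack xs) * W     ≤⟨ *-monoˡ-≤ W (pack< xs) ⟩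
    W ^ m * W             ≡⟨ *-comm (W ^ m) W ⟩
    W ^ suc m             ∎
    where open ≤-Reasoning

  unpack-pack : ∀ {m} (v : Vec ℕ m) → unpack m (pack v) ≡ Vec.map (_% W) v
  unpack-pack []       = refl
  unpack-pack (x ∷ xs) = cong₂ _∷_
    (trans ([m+kn]%n≡m%n (x % W) (pack xs) W) (m%n%n≡m%n x W))
    (trans (cong (unpack _) quotient) (unpack-pack xs))
    where
    open import Data.Nat.Divisibility using (divides)
    quotient : (x % W + pack xs * W) / W ≡ pack xs
    quotient = trans (+-distrib-/-∣ʳ (x % W) {n = pack xs * W} (divides (pack xs) refl))
      (cong₂ _+_ (m<n⇒m/n≡0 (m%n<n x W)) (m*n/n≡m (pack xs) W))

  enc : ∀ {m} b → Vec ℕ m → Vec Bool b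
  enc b v = toBits b (pack v)

  dec : ∀ {b} m → Vec Bool b → Vec ℕ m
  dec m bs = unpack m (fromBits bs)

  dec-enc : ∀ {m} b (v : Vec ℕ m) → W ^ m ≤ 2 ^ b → dec m (enc b v) ≡ Vec.map (_% W) v
  dec-enc {m} b v le = trans (cong (unpack m) (fromBits-toBits b (pack v) (<-≤-trans (pack< v) le))) (unpack-pack v)

-- Distributed programs and their reduction to state machines

-- A program for N nodes that exchange messages of mw words, each word a number
-- below W.  Received messages are reduced modulo W, and they are stored in a
-- vector so that programs respect pointwise equality of distributed inputs.

module Programs (N mw W : ℕ) .{{_ : NonZero W}} where

  Msg : Set
  Msg = Vec ℕ mw

  clip : Msg → Msg
  clip m = tabulate (λ j → lookup m j % W)

  deliver : (Fin N → Msg) → Fin N → Msg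
  deliver f = lookup (tabulate (λ u → clip (f u)))

  deliver-cong : ∀ {f g} → (∀ u → f u ≡ g u) → deliver f ≡ deliver g
  deliver-cong p = cong lookup (Vec.tabulate-cong (λ u → cong clip (p u)))

  -- `lift g c p` runs `p` on the part `g` of a larger local state and merges the output back with
  -- `c`, so that subroutines need not mention the state around them.
  data Prog : Set → Set → Set₁ where
    ret   : ∀ {X Y} → (Fin N → X → Y) → Prog X Y
    xch   : ∀ {X Y} → (Fin N → X → Fin N → Msg) → (Fin N → X → (Fin N → Msg) → Y) → Prog X Y
    _>>>_ : ∀ {X Y Z} → Prog X Y → Prog Y Z → Prog X Z
    lift  : ∀ {S S′ X Y} → (Fin N → S → X) → (Fin N → S → Y → S′) → Prog X Y → Prog S S′

  infixr 5 _>>>_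

  exec : ∀ {X Y} → Prog X Y → (Fin N → X) → Fin N → Y
  exec (ret f)      x v = f v (x v)
  exec (xch s r)    x v = r v (x v) (deliver (λ u → s u (x u) v))
  exec (p >>> q)    x   = exec q (exec p x)
  exec (lift g c p) x v = c v (x v) (exec p (λ u → g u (x u)) v)

  rounds : ∀ {X Y} → Prog X Y → ℕ
  rounds (ret f)      = 0
  rounds (xch s r)    = 1
  rounds (p >>> q)    = rounds p + rounds q
  rounds (lift g c p) = rounds p

  exec-cong : ∀ {X Y} (p : Prog X Y) {x y : Fin N → X} → (∀ v → x v ≡ y v) → ∀ v → exec p x v ≡ exec p y v
  exec-cong (ret f)      e v = cong (f v) (e v)
  exec-cong (xch s r)    e v = cong₂ (r v) (e v) (deliver-cong (λ u → cong (λ z → s u z v) (e u)))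
  exec-cong (p >>> q)    e v = exec-cong q (exec-cong p e) v
  exec-cong (lift g c p) e v = cong₂ (c v) (e v) (exec-cong p (λ u → cong (g u) (e u)) v)

  -- A normal form: a sequence of rounds ended by one local step. From it a single state type for
  -- the whole run can be read off.
  data Flat : Set → Set → Set₁ where
    fin : ∀ {X Y} → (Fin N → X → Y) → Flat X Y
    rnd : ∀ {X Y Z} → (Fin N → X → Fin N → Msg) → (Fin N → X → (Fin N → Msg) → Y) → Flat Y Z → Flat X Z

  run♭ : ∀ {X Y} → Flat X Y → (Fin N → X) → Fin N → Y
  run♭ (fin f)     x v = f v (x v)
  run♭ (rnd s r p) x   = run♭ p (λ v → r v (x v) (deliver (λ u → s u (x u) v)))

  rounds♭ : ∀ {X Y} → Flat X Y → ℕ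
  rounds♭ (fin f)     = 0
  rounds♭ (rnd s r p) = suc (rounds♭ p)

  before : ∀ {X Y Z} → (Fin N → X → Y) → Flat Y Z → Flat X Z
  before f (fin g)     = fin (λ v x → g v (f v x))
  before f (rnd s r p) = rnd (λ v x → s v (f v x)) (λ v x → r v (f v x)) p

  _⨟_ : ∀ {X Y Z} → Flat X Y → Flat Y Z → Flat X Z
  fin f     ⨟ q = before f q
  rnd s r p ⨟ q = rnd s r (p ⨟ q)

  lift♭ : ∀ {S S′ X Y} → (Fin N → S → X) → (Fin N → S → Y → S′) → Flat X Y → Flat S S′
  lift♭ g c (fin f)     = fin (λ v s → c v s (f v (g v s)))
  lift♭ g c (rnd s r p) = rnd (λ v st → s v (g v st)) (λ v st m → st , r v (g v st) m)
                              (lift♭ (λ _ → proj₂) (λ v st y → c v (proj₁ st) y) p)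

  flatten : ∀ {X Y} → Prog X Y → Flat X Y
  flatten (ret f)      = fin f
  flatten (xch s r)    = rnd s r (fin (λ _ y → y))
  flatten (p >>> q)    = flatten p ⨟ flatten q
  flatten (lift g c p) = lift♭ g c (flatten p)

  run♭-cong : ∀ {X Y} (p : Flat X Y) {x y : Fin N → X} → (∀ v → x v ≡ y v) → ∀ v → run♭ p x v ≡ run♭ p y v
  run♭-cong (fin f)     e v = cong (f v) (e v)
  run♭-cong (rnd s r p) e v = run♭-cong p
    (λ w → cong₂ (r w) (e w) (deliver-cong (λ u → cong (λ z → s u z w) (e u)))) v

  run♭-⨟ : ∀ {X Y Z} (p : Flat X Y) (q : Flat Y Z) x v → run♭ (p ⨟ q) x v ≡ run♭ q (run♭ p x) v
  run♭-⨟ (fin f)     (fin g)     x v = refl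
  run♭-⨟ (fin f)     (rnd s r q) x v = refl
  run♭-⨟ (rnd s r p) q           x v = run♭-⨟ p q _ v

  run♭-lift : ∀ {S S′ X Y} (g : Fin N → S → X) (c : Fin N → S → Y → S′) p x v →
    run♭ (lift♭ g c p) x v ≡ c v (x v) (run♭ p (λ u → g u (x u)) v)
  run♭-lift g c (fin f)     x v = refl
  run♭-lift g c (rnd s r p) x v = run♭-lift (λ _ → proj₂) (λ v st y → c v (proj₁ st) y) p _ v

  run♭-flatten : ∀ {X Y} (p : Prog X Y) x v → run♭ (flatten p) x v ≡ exec p x v
  run♭-flatten (ret f)      x v = refl
  run♭-flatten (xch s r)    x v = refl
  run♭-flatten (p >>> q)    x v = trans (run♭-⨟ (flatten p) (flatten q) x v)
    (trans (run♭-cong (flatten q) (run♭-flatten p x) v) (run♭-flatten q (exec p x) v))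
  run♭-flatten (lift g c p) x v = trans (run♭-lift g c (flatten p) x v)
    (cong (c v (x v)) (run♭-flatten p (λ u → g u (x u)) v))

  rounds♭-before : ∀ {X Y Z} (f : Fin N → X → Y) (q : Flat Y Z) → rounds♭ (before f q) ≡ rounds♭ q
  rounds♭-before f (fin g)     = refl
  rounds♭-before f (rnd s r p) = refl

  rounds♭-⨟ : ∀ {X Y Z} (p : Flat X Y) (q : Flat Y Z) → rounds♭ (p ⨟ q) ≡ rounds♭ p + rounds♭ q
  rounds♭-⨟ (fin f)     q = rounds♭-before f q
  rounds♭-⨟ (rnd s r p) q = cong suc (rounds♭-⨟ p q)

  rounds♭-lift : ∀ {S S′ X Y} (g : Fin N → S → X) (c : Fin N → S → Y → S′) p → rounds♭ (lift♭ g c p) ≡ rounds♭ p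
  rounds♭-lift g c (fin f)     = refl
  rounds♭-lift g c (rnd s r p) = cong suc (rounds♭-lift _ _ p)

  rounds♭-flatten : ∀ {X Y} (p : Prog X Y) → rounds♭ (flatten p) ≡ rounds p
  rounds♭-flatten (ret f)      = refl
  rounds♭-flatten (xch s r)    = refl
  rounds♭-flatten (p >>> q)    = trans (rounds♭-⨟ (flatten p) (flatten q)) (cong₂ _+_ (rounds♭-flatten p) (rounds♭-flatten q))
  rounds♭-flatten (lift g c p) = trans (rounds♭-lift g c (flatten p)) (rounds♭-flatten p)

  -- A nested sum whose injections record how many rounds have passed, because an algorithm has one
  -- state type although the data change type from round to round.
  State : ∀ {X Y} → Flat X Y → Set
  State (fin {X} f)     = X
  State (rnd {X} s r p) = X ⊎ State p

  start : ∀ {X Y} (p : Flat X Y) → X → State p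
  start (fin f)     x = x
  start (rnd s r p) x = inj₁ x

  sendS : ∀ {X Y} (p : Flat X Y) → Fin N → State p → Fin N → Msg
  sendS (fin f)     u st        v = replicate mw 0
  sendS (rnd s r p) u (inj₁ x)  v = s u x v
  sendS (rnd s r p) u (inj₂ st) v = sendS p u st v

  recvS : ∀ {X Y} (p : Flat X Y) → Fin N → State p → (Fin N → Msg) → State p
  recvS (fin f)     v st        m = st
  recvS (rnd s r p) v (inj₁ x)  m = inj₂ (start p (r v x m))
  recvS (rnd s r p) v (inj₂ st) m = inj₂ (recvS p v st m)

  outS : ∀ {X Y} (p : Flat X Y) → Y → Fin N → State p → Y
  outS (fin f)     d v st        = f v st
  outS (rnd s r p) d v (inj₁ x)  = d
  outS (rnd s r p) d v (inj₂ st) = outS p d v st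

  round : ∀ {X Y} (p : Flat X Y) → (Fin N → State p) → Fin N → State p
  round p st v = recvS p v (st v) (deliver (λ u → sendS p u (st u) v))

  runS : ∀ {X Y} (p : Flat X Y) → ℕ → (Fin N → State p) → Fin N → State p
  runS p zero    st = st
  runS p (suc t) st = round p (runS p t st)

  -- `runS` adds rounds at the end, whereas induction on a program removes them at the front.
  runS-round : ∀ {X Y} (p : Flat X Y) t st → runS p t (round p st) ≡ runS p (suc t) st
  runS-round p zero    st = refl
  runS-round p (suc t) st = cong (round p) (runS-round p t st)

  round-cong : ∀ {X Y} (p : Flat X Y) {st st′} → (∀ v → st v ≡ st′ v) → ∀ v → round p st v ≡ round p st′ v
  round-cong p e v = cong₂ (recvS p v) (e v) (deliver-cong (λ u → cong (λ z → sendS p u z v) (e u)))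

  runS-inj₂ : ∀ {X Y Z} (s : Fin N → X → Fin N → Msg) (r : Fin N → X → (Fin N → Msg) → Y) (p : Flat Y Z) t st v →
    runS (rnd s r p) t (λ v → inj₂ (st v)) v ≡ inj₂ (runS p t st v)
  runS-inj₂ s r p zero    st v = refl
  runS-inj₂ s r p (suc t) st v = round-cong (rnd s r p) (runS-inj₂ s r p t st) v

  runS-out : ∀ {X Y} (p : Flat X Y) d x v →
    outS p d v (runS p (rounds♭ p) (λ u → start p (x u)) v) ≡ run♭ p x v
  runS-out (fin f)     d x v = refl
  runS-out (rnd s r p) d x v = trans
    (cong (λ f → outS (rnd s r p) d v (f v)) (sym (runS-round (rnd s r p) (rounds♭ p) (λ u → inj₁ (x u)))))
    (trans (cong (outS (rnd s r p) d v) (runS-inj₂ s r p (rounds♭ p) _ v)) (runS-out p d _ v))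

-- Simulation of the virtual nodes

-- Node u of the clique hosts the virtual nodes x with x mod n = u, at most suc c of them.

module Hosting (n c N mw W b : ℕ) .{{_ : NonZero W}}
  (n≤N : n ≤ N) (N≤cn : N ≤ suc c * n) (fits : W ^ (suc c * suc c * mw) ≤ 2 ^ b) where

  open Programs N mw W
  open Packing W

  place : Fin N → Fin (suc c) × Fin n
  place x = remQuot n (inject≤ x N≤cn)

  slotOf : Fin N → Fin (suc c)
  slotOf x = proj₁ (place x)

  hostOf : Fin N → Fin n
  hostOf x = proj₂ (place x)

  emb : Fin n → Fin N
  emb u = inject≤ u n≤N

  clamp : Fin n → (y : ℕ) → Dec (y < N) → Fin N
  clamp u y (yes lt) = fromℕ< lt
  clamp u y (no _)   = emb u

  -- A slot beyond N is filled with the first node of the host, a duplicate; no virtual node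
  -- occupies that slot, so what is sent from it is never read.
  at : Fin n → Fin (suc c) → Fin N
  at u a = clamp u (toℕ (combine a u)) (toℕ (combine a u) <? N)

  at-place : ∀ x → at (hostOf x) (slotOf x) ≡ x
  at-place x = go (toℕ (combine (slotOf x) (hostOf x)) <? N)
    where
    same : toℕ (combine (slotOf x) (hostOf x)) ≡ toℕ x
    same = trans (cong toℕ (Fin.combine-remQuot {suc c} n (inject≤ x N≤cn))) (Fin.toℕ-inject≤ x N≤cn)
    go : (d : Dec (toℕ (combine (slotOf x) (hostOf x)) < N)) → clamp (hostOf x) _ d ≡ x
    go (yes lt) = Fin.toℕ-injective (trans (Fin.toℕ-fromℕ< lt) same)
    go (no ¬lt) = ⊥-elim (¬lt (≤-<-trans (≤-reflexive same) (Fin.toℕ<n x)))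

  hostOf-emb : ∀ u → hostOf (emb u) ≡ u
  hostOf-emb u = cong proj₂ (trans (cong (remQuot {suc c} n) (Fin.toℕ-injective same)) (Fin.remQuot-combine {suc c} zero u))
    where
    same : toℕ (inject≤ (emb u) N≤cn) ≡ toℕ (combine {suc c} zero u)
    same = trans (Fin.toℕ-inject≤ (emb u) N≤cn) (trans (Fin.toℕ-inject≤ u n≤N)
      (sym (trans (Fin.toℕ-combine {suc c} {n} zero u) (cong (_+ toℕ u) (*-zeroʳ n)))))

  words : ℕ
  words = suc c * suc c * mw

  pick : (Fin (suc c) → Fin (suc c) → Msg) → Fin (suc c) × Fin (suc c) → Msg
  pick f (a , a′) = f a a′

  word : (Fin (suc c) → Fin (suc c) → Msg) → Fin (suc c * suc c) × Fin mw → ℕ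
  word f (aa , j) = lookup (pick f (remQuot {suc c} (suc c) aa)) j

  bundle : (Fin (suc c) → Fin (suc c) → Msg) → Vec ℕ words
  bundle f = tabulate λ i → word f (remQuot {suc c * suc c} mw i)

  part : Vec ℕ words → Fin (suc c) → Fin (suc c) → Msg
  part v a a′ = tabulate λ j → lookup v (combine (combine a a′) j)

  part-bundle : ∀ f a a′ → part (Vec.map (_% W) (bundle f)) a a′ ≡ clip (f a a′)
  part-bundle f a a′ = Vec.tabulate-cong λ j → trans (Vec.lookup-map (combine (combine a a′) j) (_% W) (bundle f))
    (cong (_% W) (trans (Vec.lookup∘tabulate _ (combine (combine a a′) j)) (unbundle j)))
    where
    unbundle : ∀ j → word f (remQuot {suc c * suc c} mw (combine (combine a a′) j)) ≡ lookup (f a a′) j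
    unbundle j = trans (cong (word f) (Fin.remQuot-combine {suc c * suc c} {mw} (combine a a′) j))
      (cong (λ z → lookup (pick f z) j) (Fin.remQuot-combine {suc c} {suc c} a a′))

  module Algorithm {I Y : Set} (p : Flat I Y) (dflt : Y)
    (inp : Fin N → (Fin n → Bool) → I) (out : Fin n → Y → List (Fin n × ℕ)) where

    alg : CCAlgorithm n b
    alg = record
      { State  = Fin n × (Fin N → State p)
      ; init   = λ v row → v , λ x → start p (inp x row)
      ; send   = λ st v → enc b (bundle λ a a′ → sendS p (at (proj₁ st) a) (proj₂ st (at (proj₁ st) a)) (at v a′))
      ; recv   = λ st f → proj₁ st , λ y → recvS p y (proj₂ st y)
                   (lookup (tabulate λ x → part (dec words (f (hostOf x))) (slotOf x) (slotOf y)))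
      ; output = λ st → out (proj₁ st) (outS p dflt (emb (proj₁ st)) (proj₂ st (emb (proj₁ st))))
      }

    module _ (G : Graph n) where

      virtual : ℕ → Fin N → State p
      virtual t = runS p t (λ x → start p (inp x (Graph.adj G (hostOf x))))

      run-id : ∀ t v → proj₁ (run alg G t v) ≡ v
      run-id zero    v = refl
      run-id (suc t) v = run-id t v

      -- A host stores states for all of `Fin N`, but only those of its own virtual nodes follow the
      -- simulated run; the others are updated with messages meant for different nodes, so the claim
      -- is made at `hostOf y` only.
      run-virtual : ∀ t y → proj₂ (run alg G t (hostOf y)) y ≡ virtual t y
      run-virtual zero    y = refl
      run-virtual (suc t) y = cong₂ (recvS p y) (run-virtual t y) (cong lookup (Vec.tabulate-cong message))
        where
        sent : ∀ (u v : Fin n) → Fin (suc c) → Fin (suc c) → Msg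
        sent u v a a′ = sendS p (at (proj₁ (run alg G t u)) a)
          (proj₂ (run alg G t u) (at (proj₁ (run alg G t u)) a)) (at v a′)
        sent-at : ∀ x → sent (hostOf x) (hostOf y) (slotOf x) (slotOf y) ≡ sendS p x (virtual t x) y
        sent-at x rewrite run-id t (hostOf x) | at-place x | at-place y | run-virtual t x = refl
        message : ∀ x → part (dec words (enc b (bundle (sent (hostOf x) (hostOf y))))) (slotOf x) (slotOf y)
                      ≡ clip (sendS p x (virtual t x) y)
        message x = trans (cong (λ v → part v (slotOf x) (slotOf y)) (dec-enc b (bundle (sent (hostOf x) (hostOf y))) fits))
          (trans (part-bundle (sent (hostOf x) (hostOf y)) (slotOf x) (slotOf y)) (cong clip (sent-at x)))

      result-alg : ∀ u → result alg G (rounds♭ p) u ≡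
        out u (run♭ p (λ x → inp x (Graph.adj G (hostOf x))) (emb u))
      result-alg u = trans
        (cong (λ i → out i (outS p dflt (emb i) (proj₂ (run alg G (rounds♭ p) u) (emb i)))) (run-id (rounds♭ p) u))
       
        (cong (out u) (trans (cong (outS p dflt (emb u)) arr) (runS-out p dflt _ (emb u))))
        where
        arr : proj₂ (run alg G (rounds♭ p) u) (emb u) ≡ virtual (rounds♭ p) (emb u)
        arr = trans (cong (λ h → proj₂ (run alg G (rounds♭ p) h) (emb u)) (sym (hostOf-emb u))) (run-virtual (rounds♭ p) (emb u))

-- Summation over bit vectors

opaque
  unfolding ∑
  ∑-append : ∀ m {n} (f : Fin (m + n) → ℕ) → ∑ f ≡ ∑ (λ i → f (i Data.Fin.↑ˡ n)) + ∑ (λ j → f (m Data.Fin.↑ʳ j))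
  ∑-append zero    f = refl
  ∑-append (suc m) f = trans (cong (f zero +_) (∑-append m (f ∘ suc))) (sym (+-assoc (f zero) _ _))

opaque
  unfolding ∑
  ∑-combine : ∀ m n (f : Fin (m * n) → ℕ) → ∑ f ≡ ∑ (λ i → ∑ (λ j → f (combine {m} {n} i j)))
  ∑-combine zero    n f = refl
  ∑-combine (suc m) n f = trans (∑-append n f) (cong (∑ (λ j → f (j Data.Fin.↑ˡ (m * n))) +_) (∑-combine m n (λ i → f (n Data.Fin.↑ʳ i))))

bsum : ∀ m → (Vec Bool m → ℕ) → ℕ
bsum zero    f = f []
bsum (suc m) f = bsum m (λ v → f (false ∷ v) + f (true ∷ v))

bsum-cong : ∀ m {f g} → (∀ v → f v ≡ g v) → bsum m f ≡ bsum m g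
bsum-cong zero    e = e []
bsum-cong (suc m) e = bsum-cong m λ v → cong₂ _+_ (e (false ∷ v)) (e (true ∷ v))

bsum-+ : ∀ m f g → bsum m (λ v → f v + g v) ≡ bsum m f + bsum m g
bsum-+ zero    f g = refl
bsum-+ (suc m) f g = trans (bsum-cong m λ v → rearrange (f (false ∷ v)) (g (false ∷ v)) (f (true ∷ v)) (g (true ∷ v)))
  (bsum-+ m (λ v → f (false ∷ v) + f (true ∷ v)) (λ v → g (false ∷ v) + g (true ∷ v)))
  where
  rearrange : ∀ a b c d → a + b + (c + d) ≡ a + c + (b + d)
  rearrange = solve-∀

bsum-1 : ∀ m → bsum m (λ _ → 1) ≡ 2 ^ m
bsum-1 zero    = refl
bsum-1 (suc m) = trans (bsum-+ m (λ _ → 1) (λ _ → 1)) (trans (cong₂ _+_ (bsum-1 m) (bsum-1 m)) (cong (2 ^ m +_) (sym (+-identityʳ _))))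

bsum-double : ∀ m f → bsum m (λ v → f v + f v) ≡ 2 * bsum m f
bsum-double m f = trans (bsum-+ m f f) (cong (bsum m f +_) (sym (+-identityʳ _)))

bsum-swap : ∀ m n (f : Vec Bool m → Vec Bool n → ℕ) → bsum m (λ a → bsum n (f a)) ≡ bsum n (λ b → bsum m (λ a → f a b))
bsum-swap zero    n f = refl
bsum-swap (suc m) n f = trans (bsum-cong m λ v → sym (bsum-+ n (f (false ∷ v)) (f (true ∷ v))))
  (bsum-swap m n (λ v b → f (false ∷ v) b + f (true ∷ v) b))

bsum-++ : ∀ t m (f : Vec Bool (t + m) → ℕ) → bsum (t + m) f ≡ bsum t (λ b → bsum m (λ a → f (b Vec.++ a)))
bsum-++ zero    m f = refl
bsum-++ (suc t) m f = trans (bsum-++ t m _) (bsum-cong t λ b → bsum-+ m (λ a → f (false ∷ b Vec.++ a)) (λ a → f (true ∷ b Vec.++ a)))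

nsum : ℕ → (ℕ → ℕ) → ℕ
nsum zero    f = 0
nsum (suc n) f = f 0 + nsum n (f ∘ suc)

opaque
  unfolding ∑
  ∑-nsum : ∀ n f → ∑ {n} (f ∘ toℕ) ≡ nsum n f
  ∑-nsum zero    f = refl
  ∑-nsum (suc n) f = cong (f 0 +_) (∑-nsum n (f ∘ suc))

nsum-cong : ∀ n {f g} → (∀ i → f i ≡ g i) → nsum n f ≡ nsum n g
nsum-cong zero    e = refl
nsum-cong (suc n) e = cong₂ _+_ (e 0) (nsum-cong n (e ∘ suc))

nsum-even-odd : ∀ n f → nsum (n * 2) f ≡ nsum n (λ i → f (i * 2) + f (suc (i * 2)))
nsum-even-odd zero    f = refl
nsum-even-odd (suc n) f = trans (sym (+-assoc (f 0) (f 1) _)) (cong (f 0 + f 1 +_) (nsum-even-odd n (λ i → f (suc (suc i)))))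

toBits-even : ∀ L i → toBits (suc L) (i * 2) ≡ false ∷ toBits L i
toBits-even L i = cong₂ (λ r d → does (r ≟ 1) ∷ toBits L d) (m*n%n≡0 i 2) (m*n/n≡m i 2)

toBits-odd : ∀ L i → toBits (suc L) (suc (i * 2)) ≡ true ∷ toBits L i
toBits-odd L i = cong₂ (λ r d → does (r ≟ 1) ∷ toBits L d) ([m+kn]%n≡m%n 1 i 2)
  (trans (+-distrib-/-∣ʳ 1 {n = i * 2} (divides i refl)) (m*n/n≡m i 2))
  where open import Data.Nat.Divisibility using (divides)

nsum-toBits : ∀ L (f : Vec Bool L → ℕ) → nsum (2 ^ L) (f ∘ toBits L) ≡ bsum L f
nsum-toBits zero    f = +-identityʳ _
nsum-toBits (suc L) f = trans (cong (λ n → nsum n (f ∘ toBits (suc L))) (*-comm 2 (2 ^ L)))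
  (trans (nsum-even-odd (2 ^ L) (f ∘ toBits (suc L)))
  (trans (nsum-cong (2 ^ L) λ i → cong₂ _+_ (cong f (toBits-even L i)) (cong f (toBits-odd L i)))
         (nsum-toBits L (λ v → f (false ∷ v) + f (true ∷ v)))))

bits : ∀ {N} L → Fin N → Vec Bool L
bits L x = toBits L (toℕ x)

∑-bits : ∀ {N} L → N ≡ 2 ^ L → (f : Vec Bool L → ℕ) → ∑ {N} (f ∘ bits L) ≡ bsum L f
∑-bits L refl f = trans (∑-nsum (2 ^ L) (f ∘ toBits L)) (nsum-toBits L f)

bits-injective : ∀ {N} L → N ≡ 2 ^ L → {x y : Fin N} → bits L x ≡ bits L y → x ≡ y
bits-injective L refl {x} {y} e = Fin.toℕ-injective (trans (sym (fromBits-toBits L (toℕ x) (Fin.toℕ<n x)))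
  (trans (cong fromBits e) (fromBits-toBits L (toℕ y) (Fin.toℕ<n y))))

-- The pairwise independent family

-- Pairwise independent hashing over the field with two elements: bit j of the hash
-- value of x is the inner product of x with the seed shifted by j positions.

hd : ∀ {m} → Vec Bool m → Bool
hd []      = false
hd (x ∷ _) = x

tl : ∀ {m} → Vec Bool m → Vec Bool (ℕ.pred m)
tl []       = []
tl (_ ∷ xs) = xs

dot : ∀ {m ℓ} → Vec Bool m → Vec Bool ℓ → Bool
dot a []       = false
dot a (x ∷ xs) = (hd a ∧ x) xor dot (tl a) xs

hash : ∀ t {m ℓ} → Vec Bool m → Vec Bool ℓ → Vec Bool t
hash zero    a x = []
hash (suc t) a x = dot a x ∷ hash t (tl a) x

match : ∀ {t m} → Vec Bool t → Vec Bool m → Bool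
match []       b = true
match (h ∷ hs) b = does (h Bool.≟ hd b) ∧ match hs (tl b)

hashFrom : ∀ (o t : ℕ) {m ℓ} → Vec Bool m → Vec Bool ℓ → Vec Bool t
hashFrom zero    t a x = hash t a x
hashFrom (suc o) t a x = hashFrom o t (tl a) x

-- The seed is `b ++ a` with t bits in `b`, and x is a member when its hash under `a` equals the
-- offset `b`. Without the offset the zero vector would have hash 0 under every seed.
member : ∀ (t : ℕ) {m ℓ} → Vec Bool m → Vec Bool ℓ → Bool
member t z x = match (hashFrom t t z x) z

hashFrom-++ : ∀ {o} t {m ℓ} (b : Vec Bool o) (a : Vec Bool m) (x : Vec Bool ℓ) → hashFrom o t (b Vec.++ a) x ≡ hash t a x
hashFrom-++ t []      a x = refl
hashFrom-++ t (_ ∷ b) a x = hashFrom-++ t b a x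

match-one : ∀ {t m} (h : Vec Bool t) (a : Vec Bool m) → bsum t (λ b → 𝟙 (match h (b Vec.++ a))) ≡ 1
match-one []          a = refl
match-one (true ∷ h)  a = match-one h a
match-one {suc t} (false ∷ h) a = trans (bsum-cong t λ b → +-identityʳ _) (match-one h a)

-- One offset can equal both hash values only if they coincide, which reduces the probability of a
-- pair to that of a collision.
match-both : ∀ {t m} (h h′ : Vec Bool t) (a : Vec Bool m) →
  bsum t (λ b → 𝟙 (match h (b Vec.++ a) ∧ match h′ (b Vec.++ a))) ≡ 𝟙 (match h h′)
match-both []          []           a = refl
match-both (true ∷ h)  (true ∷ h′)  a = match-both h h′ a
match-both {suc t} (false ∷ h) (false ∷ h′) a = trans (bsum-cong t λ b → +-identityʳ _) (match-both h h′ a)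
match-both {suc t} (true ∷ h)  (false ∷ h′) a = trans (bsum-cong t λ b → cong 𝟙 (∧-zeroʳ (match h (b Vec.++ a)))) (bsum-0 t)
  where
  open import Data.Bool.Properties using (∧-zeroʳ)
  bsum-0 : ∀ t → bsum t (λ _ → 0) ≡ 0
  bsum-0 zero    = refl
  bsum-0 (suc t) = bsum-0 t
match-both {suc t} (false ∷ h) (true ∷ h′)  a = trans (bsum-cong t λ b → trans (+-identityʳ _) (cong 𝟙 (∧-zeroʳ (match h (b Vec.++ a))))) (bsum-0 t)
  where
  open import Data.Bool.Properties using (∧-zeroʳ)
  bsum-0 : ∀ t → bsum t (λ _ → 0) ≡ 0
  bsum-0 zero    = refl
  bsum-0 (suc t) = bsum-0 t

-- A common first bit contributes the same summand to both inner products and cancels.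
collide-head : ∀ t {m ℓ} (a : Vec Bool m) c (x y : Vec Bool ℓ) →
  match (hash t a (c ∷ x)) (hash t a (c ∷ y)) ≡ match (hash t (tl a) x) (hash t (tl a) y)
collide-head zero    a c x y = refl
collide-head (suc t) a c x y = cong₂ _∧_ (cancel (hd a ∧ c) (dot (tl a) x) (dot (tl a) y)) (collide-head t (tl a) c x y)
  where
  cancel : ∀ s p q → does ((s xor p) Bool.≟ (s xor q)) ≡ does (p Bool.≟ q)
  cancel false p     q     = refl
  cancel true  true  true  = refl
  cancel true  true  false = refl
  cancel true  false true  = refl
  cancel true  false false = refl

-- If x and y differ in the first position, then the first seed bit decides whether
-- the first hash bits agree, while the other hash bits do not depend on it.

collide : ∀ t m {ℓ} (x y : Vec Bool ℓ) → x ≢ y → t + ℓ ≤ m →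
  2 ^ t * bsum m (λ a → 𝟙 (match (hash t a x) (hash t a y))) ≡ 2 ^ m
collide t m       []      []      x≢y le = ⊥-elim (x≢y refl)
collide t zero    {suc ℓ} (_ ∷ x) (_ ∷ y) x≢y le = ⊥-elim (n≮0 (≤-trans (m≤n+m (suc ℓ) t) le))
collide t (suc m) {suc ℓ} (c ∷ x) (d ∷ y) x≢y le with c Bool.≟ d
... | yes refl = begin
  2 ^ t * bsum m (λ a → 𝟙 (match (hash t (false ∷ a) (c ∷ x)) (hash t (false ∷ a) (c ∷ y))) + 𝟙 (match (hash t (true ∷ a) (c ∷ x)) (hash t (true ∷ a) (c ∷ y))))
    ≡⟨ cong (2 ^ t *_) (bsum-cong m λ a → cong₂ (λ p q → 𝟙 p + 𝟙 q) (collide-head t (false ∷ a) c x y) (collide-head t (true ∷ a) c x y)) ⟩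
  2 ^ t * bsum m (λ a → 𝟙 (match (hash t a x) (hash t a y)) + 𝟙 (match (hash t a x) (hash t a y)))
    ≡⟨ cong (2 ^ t *_) (bsum-double m _) ⟩
  2 ^ t * (2 * bsum m (λ a → 𝟙 (match (hash t a x) (hash t a y))))
    ≡⟨ rotate (2 ^ t) _ ⟩
  2 * (2 ^ t * bsum m (λ a → 𝟙 (match (hash t a x) (hash t a y))))
    ≡⟨ cong (2 *_) (collide t m x y (λ e → x≢y (cong (c ∷_) e)) (ℕ.s≤s⁻¹ (≤-trans (≤-reflexive (sym (+-suc t ℓ))) le))) ⟩
  2 ^ suc m ∎
  where
  open ≡-Reasoning
  rotate : ∀ a b → a * (2 * b) ≡ 2 * (a * b)
  rotate = solve-∀
collide zero (suc m) (c ∷ x) (d ∷ y) x≢y le | no c≢d = trans (*-identityˡ _) (bsum-1 (suc m))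
collide (suc t) (suc m) (c ∷ x) (d ∷ y) x≢y le | no c≢d = begin
  2 ^ suc t * bsum m (λ a → 𝟙 (match (hash (suc t) (false ∷ a) (c ∷ x)) (hash (suc t) (false ∷ a) (d ∷ y)))
                          + 𝟙 (match (hash (suc t) (true ∷ a) (c ∷ x)) (hash (suc t) (true ∷ a) (d ∷ y))))
    ≡⟨ cong (2 ^ suc t *_) (bsum-cong m λ a → one c d c≢d (dot a x) (dot a y) (match (hash t a (c ∷ x)) (hash t a (d ∷ y)))) ⟩
  2 * 2 ^ t * bsum m (λ a → 𝟙 (match (hash t a (c ∷ x)) (hash t a (d ∷ y))))
    ≡⟨ *-assoc 2 (2 ^ t) _ ⟩
  2 * (2 ^ t * bsum m (λ a → 𝟙 (match (hash t a (c ∷ x)) (hash t a (d ∷ y)))))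
    ≡⟨ cong (2 *_) (collide t m (c ∷ x) (d ∷ y) x≢y (ℕ.s≤s⁻¹ le)) ⟩
  2 ^ suc m ∎
  where
  open ≡-Reasoning
  one : ∀ c d → c ≢ d → ∀ p q r →
    𝟙 (does (((false ∧ c) xor p) Bool.≟ ((false ∧ d) xor q)) ∧ r) + 𝟙 (does (((true ∧ c) xor p) Bool.≟ ((true ∧ d) xor q)) ∧ r) ≡ 𝟙 r
  one true  true  ne p q r = ⊥-elim (ne refl)
  one false false ne p q r = ⊥-elim (ne refl)
  one true  false ne true  true  true  = refl
  one true  false ne true  true  false = refl
  one true  false ne true  false true  = refl
  one true  false ne true  false false = refl
  one true  false ne false true  true  = refl
  one true  false ne false true  false = refl
  one true  false ne false false true  = refl
  one true  false ne false false false = refl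
  one false true  ne true  true  true  = refl
  one false true  ne true  true  false = refl
  one false true  ne true  false true  = refl
  one false true  ne true  false false = refl
  one false true  ne false true  true  = refl
  one false true  ne false true  false = refl
  one false true  ne false false true  = refl
  one false true  ne false false false = refl

member-++ : ∀ t m {ℓ} (x y : Vec Bool ℓ) →
  bsum (t + m) (λ z → 𝟙 (member t z x ∧ member t z y)) ≡ bsum m (λ a → 𝟙 (match (hash t a x) (hash t a y)))
member-++ t m x y = trans (bsum-++ t m _) (trans (bsum-swap t m _) (bsum-cong m λ a →
  trans (bsum-cong t λ b → cong₂ (λ h h′ → 𝟙 (match h (b Vec.++ a) ∧ match h′ (b Vec.++ a))) (hashFrom-++ t b a x) (hashFrom-++ t b a y))
        (match-both (hash t a x) (hash t a y) a)))

member-single : ∀ t m {ℓ} (x : Vec Bool ℓ) → 2 ^ t * bsum (t + m) (λ z → 𝟙 (member t z x)) ≡ 2 ^ (t + m)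
member-single t m x = trans (cong (2 ^ t *_) (trans (bsum-++ t m _) (trans (bsum-swap t m _) (trans (bsum-cong m λ a →
  trans (bsum-cong t λ b → cong (λ h → 𝟙 (match h (b Vec.++ a))) (hashFrom-++ t b a x)) (match-one (hash t a x) a)) (bsum-1 m)))))
  (sym (^-distribˡ-+-* 2 t m))

member-pair : ∀ t m {ℓ} (x y : Vec Bool ℓ) → x ≢ y → t + ℓ ≤ m →
  2 ^ t * 2 ^ t * bsum (t + m) (λ z → 𝟙 (member t z x ∧ member t z y)) ≡ 2 ^ (t + m)
member-pair t m x y x≢y le = trans (*-assoc (2 ^ t) (2 ^ t) _) (trans (cong (λ s → 2 ^ t * (2 ^ t * s)) (member-++ t m x y))
  (trans (cong (2 ^ t *_) (collide t m x y x≢y le)) (sym (^-distribˡ-+-* 2 t m))))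

module Family (N L : ℕ) (N≡2^L : N ≡ 2 ^ L) (t : ℕ) (2t≤L : t + t ≤ L) where

  τ : ℕ
  τ = 2 ^ t

  -- A seed is a pair of vertices, that is 2L bits: t for the offset and 2L - t for the hash. Two
  -- vertices are the unit in which seeds are later searched.
  picks : Fin N × Fin N → Fin N → Bool
  picks (s₁ , s₂) x = member t (bits L s₁ Vec.++ bits L s₂) (bits L x)

  seeds : ∀ (f : ∀ {m} → Vec Bool m → ℕ) →
    ∑ {N} (λ s₁ → ∑ {N} (λ s₂ → f (bits L s₁ Vec.++ bits L s₂))) ≡ bsum (t + (L + (L ∸ t))) f
  seeds f = begin
    ∑ {N} (λ s₁ → ∑ {N} (λ s₂ → f (bits L s₁ Vec.++ bits L s₂)))   ≡⟨ ∑-cong {N} (λ s₁ → ∑-bits {N} L N≡2^L (λ w → f (bits L s₁ Vec.++ w))) ⟩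
    ∑ {N} (λ s₁ → bsum L (λ w → f (bits L s₁ Vec.++ w)))           ≡⟨ ∑-bits {N} L N≡2^L (λ v → bsum L (λ w → f (v Vec.++ w))) ⟩
    bsum L (λ v → bsum L (λ w → f (v Vec.++ w)))                   ≡⟨ sym (bsum-++ L L f) ⟩
    bsum (L + L) f                                                 ≡⟨ cong (λ m → bsum m f) lengths ⟩
    bsum (t + (L + (L ∸ t))) f                                   ∎
    where
    open ≡-Reasoning
    lengths : L + L ≡ t + (L + (L ∸ t))
    lengths = trans (cong (L +_) (sym (m+[n∸m]≡n (≤-trans (m≤m+n t t) 2t≤L)))) (swap′ L t (L ∸ t))
      where
      swap′ : ∀ a b c → a + (b + c) ≡ b + (a + c)
      swap′ = solve-∀

  total : 2 ^ (t + (L + (L ∸ t))) ≡ N * N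
  total = trans (sym (bsum-1 (t + (L + (L ∸ t))))) (trans (sym (seeds (λ _ → 1)))
    (trans (∑-cong {N} {g = λ _ → N} (λ _ → trans (∑-const N 1) (*-identityʳ N))) (∑-const N N)))

  picks-single : ∀ x → τ * ∑ {N} (λ s₁ → ∑ {N} (λ s₂ → 𝟙 (picks (s₁ , s₂) x))) ≡ N * N
  picks-single x = trans (cong (τ *_) (seeds (λ z → 𝟙 (member t z (bits L x)))))
    (trans (member-single t (L + (L ∸ t)) (bits L x)) total)

  picks-pair : ∀ x y → x ≢ y → τ * τ * ∑ {N} (λ s₁ → ∑ {N} (λ s₂ → 𝟙 (picks (s₁ , s₂) x ∧ picks (s₁ , s₂) y))) ≡ N * N
  picks-pair x y x≢y = trans (cong (τ * τ *_) (seeds (λ z → 𝟙 (member t z (bits L x) ∧ member t z (bits L y)))))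
    (trans (member-pair t (L + (L ∸ t)) (bits L x) (bits L y) (λ e → x≢y (bits-injective L N≡2^L e)) enough) total)
    where
    -- The hash uses t + L of the 2L - t bits left by the offset, whence the hypothesis `t + t ≤ L`.
    enough : t + L ≤ L + (L ∸ t)
    enough = ≤-trans (≤-reflexive (+-comm t L)) (+-monoʳ-≤ L (≤-trans (≤-reflexive (sym (m+n∸n≡m t t))) (∸-monoˡ-≤ t 2t≤L)))

-- Second moments of a sample and the cost of a seed

𝟙-∧ : ∀ a b → 𝟙 (a ∧ b) ≡ 𝟙 a * 𝟙 b
𝟙-∧ true  b = sym (+-identityʳ _)
𝟙-∧ false b = refl

∑-*ʳ : ∀ {n} (f : Fin n → ℕ) c → ∑ (λ i → f i * c) ≡ ∑ f * c
∑-*ʳ f c = trans (∑-cong (λ i → *-comm (f i) c)) (trans (∑-*ˡ c f) (*-comm c (∑ f)))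

∑-product : ∀ {m n} (f : Fin m → ℕ) (g : Fin n → ℕ) → ∑ f * ∑ g ≡ ∑ (λ i → ∑ (λ j → f i * g j))
∑-product f g = trans (sym (∑-*ʳ f (∑ g))) (∑-cong λ i → sym (∑-*ˡ (f i) g))

2ab≤a²+b² : ∀ a b → 2 * (a * b) ≤ a * a + b * b
2ab≤a²+b² a b = [ ordered a b , (λ b≤a → subst₂ _≤_ (cong (2 *_) (*-comm b a)) (+-comm (b * b) (a * a)) (ordered b a b≤a)) ]′ (≤-total a b)
  where
  ordered : ∀ a b → a ≤ b → 2 * (a * b) ≤ a * a + b * b
  ordered a b a≤b = subst (λ b → 2 * (a * b) ≤ a * a + b * b) (m+[n∸m]≡n a≤b)
    (≤-trans (m≤m+n _ ((b ∸ a) * (b ∸ a))) (≤-reflexive (square a (b ∸ a))))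
    where
    square : ∀ a c → 2 * (a * (a + c)) + c * c ≡ a * a + (a + c) * (a + c)
    square = solve-∀

module Seeds (N : ℕ) where

  Seed : Set
  Seed = Fin N × Fin N

  ∑∑ : (Seed → ℕ) → ℕ
  ∑∑ f = ∑ λ s₁ → ∑ λ s₂ → f (s₁ , s₂)

  ∑∑-cong : ∀ {f g} → (∀ s → f s ≡ g s) → ∑∑ f ≡ ∑∑ g
  ∑∑-cong e = ∑-cong λ s₁ → ∑-cong λ s₂ → e (s₁ , s₂)

  ∑∑-mono : ∀ {f g} → (∀ s → f s ≤ g s) → ∑∑ f ≤ ∑∑ g
  ∑∑-mono e = ∑-mono λ s₁ → ∑-mono λ s₂ → e (s₁ , s₂)

  ∑∑-+ : ∀ f g → ∑∑ (λ s → f s + g s) ≡ ∑∑ f + ∑∑ g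
  ∑∑-+ f g = trans (∑-cong λ s₁ → ∑-+ (λ s₂ → f (s₁ , s₂)) (λ s₂ → g (s₁ , s₂))) (∑-+ _ _)

  ∑∑-*ˡ : ∀ c f → ∑∑ (λ s → c * f s) ≡ c * ∑∑ f
  ∑∑-*ˡ c f = trans (∑-cong λ s₁ → ∑-*ˡ c (λ s₂ → f (s₁ , s₂))) (∑-*ˡ c _)

  ∑∑-const : ∀ c → ∑∑ (λ _ → c) ≡ N * N * c
  ∑∑-const c = trans (∑-cong λ _ → ∑-const N c) (trans (∑-const N (N * c)) (sym (*-assoc N N c)))

  ∑∑-swap : ∀ {m} (f : Seed → Fin m → ℕ) → ∑∑ (λ s → ∑ (f s)) ≡ ∑ (λ i → ∑∑ (λ s → f s i))
  ∑∑-swap f = trans (∑-cong λ s₁ → ∑-swap (λ s₂ → f (s₁ , s₂))) (∑-swap (λ s₁ i → ∑ λ s₂ → f (s₁ , s₂) i))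

module Hitting (N L : ℕ) (N≡2^L : N ≡ 2 ^ L) (t : ℕ) (2t≤L : t + t ≤ L) where

  open Family N L N≡2^L t 2t≤L
  open Seeds N

  hits : (Fin N → Bool) → Seed → ℕ
  hits U s = count (λ x → U x ∧ picks s x)

  missed : (Fin N → Bool) → Seed → Bool
  missed U s = does (hits U s ≟ 0)

  hits-total : ∀ U → τ * ∑∑ (hits U) ≡ count U * (N * N)
  hits-total U = begin
    τ * ∑∑ (hits U)                                             ≡⟨ cong (τ *_) (∑∑-swap _) ⟩
    τ * ∑ (λ x → ∑∑ (λ s → 𝟙 (U x ∧ picks s x)))                ≡⟨ sym (∑-*ˡ τ _) ⟩
    ∑ (λ x → τ * ∑∑ (λ s → 𝟙 (U x ∧ picks s x)))                ≡⟨ ∑-cong one ⟩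
    ∑ (λ x → 𝟙 (U x) * (N * N))                                 ≡⟨ ∑-*ʳ (𝟙 ∘ U) (N * N) ⟩
    count U * (N * N)                                           ∎
    where
    open ≡-Reasoning
    one : ∀ x → τ * ∑∑ (λ s → 𝟙 (U x ∧ picks s x)) ≡ 𝟙 (U x) * (N * N)
    one x = trans (cong (τ *_) (trans (∑∑-cong λ s → 𝟙-∧ (U x) (picks s x)) (∑∑-*ˡ (𝟙 (U x)) (λ s → 𝟙 (picks s x)))))
      (trans (rotate τ (𝟙 (U x)) _) (cong (𝟙 (U x) *_) (picks-single x)))
      where
      rotate : ∀ a b c → a * (b * c) ≡ b * (a * c)
      rotate = solve-∀

  -- On the diagonal the probability is 1/τ instead of 1/τ²; the second summand pays for that.
  pair≤ : ∀ x y → τ * τ * ∑∑ (λ s → 𝟙 (picks s x ∧ picks s y)) ≤ N * N + 𝟙 (does (x Fin.≟ y)) * (τ * (N * N))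
  pair≤ x y with x Fin.≟ y
  ... | no  x≢y = ≤-trans (≤-reflexive (picks-pair x y x≢y)) (m≤m+n _ _)
  ... | yes refl = ≤-trans (≤-reflexive (begin
    τ * τ * ∑∑ (λ s → 𝟙 (picks s x ∧ picks s x)) ≡⟨ cong (τ * τ *_) (∑∑-cong λ s → cong 𝟙 (∧-idem (picks s x))) ⟩
    τ * τ * ∑∑ (λ s → 𝟙 (picks s x))             ≡⟨ *-assoc τ τ _ ⟩
    τ * (τ * ∑∑ (λ s → 𝟙 (picks s x)))           ≡⟨ cong (τ *_) (picks-single x) ⟩
    τ * (N * N)                                  ≡⟨ sym (+-identityʳ _) ⟩
    τ * (N * N) + 0                              ∎)) (m≤n+m _ (N * N))
    where
    open ≡-Reasoning
    open import Data.Bool.Properties using (∧-idem)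

  -- The second moment of the number of hits: |U|²/τ² from pairs and |U|/τ from the diagonal.
  hits-square : ∀ U → τ * τ * ∑∑ (λ s → hits U s * hits U s) ≤ count U * count U * (N * N) + count U * (τ * (N * N))
  hits-square U = begin
    τ * τ * ∑∑ (λ s → hits U s * hits U s)
      ≡⟨ cong (τ * τ *_) (trans (∑∑-cong λ s → trans (∑-product (λ x → 𝟙 (U x ∧ picks s x)) (λ y → 𝟙 (U y ∧ picks s y)))
           (∑-cong λ x → ∑-cong λ y → regroup (U x) (U y) (picks s x) (picks s y)))
           (trans (∑∑-swap _) (∑-cong λ x → trans (∑∑-swap _) (∑-cong λ y → ∑∑-*ˡ (𝟙 (U x) * 𝟙 (U y)) (λ s → 𝟙 (picks s x ∧ picks s y)))))) ⟩
    τ * τ * ∑ (λ x → ∑ (λ y → 𝟙 (U x) * 𝟙 (U y) * ∑∑ (λ s → 𝟙 (picks s x ∧ picks s y))))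
      ≡⟨ trans (sym (∑-*ˡ (τ * τ) _)) (∑-cong λ x → sym (∑-*ˡ (τ * τ) _)) ⟩
    ∑ (λ x → ∑ (λ y → τ * τ * (𝟙 (U x) * 𝟙 (U y) * ∑∑ (λ s → 𝟙 (picks s x ∧ picks s y)))))
      ≤⟨ ∑-mono (λ x → ∑-mono λ y → ≤-trans (≤-reflexive (rotate (τ * τ) (𝟙 (U x) * 𝟙 (U y)) _)) (*-monoʳ-≤ (𝟙 (U x) * 𝟙 (U y)) (pair≤ x y))) ⟩
    ∑ (λ x → ∑ (λ y → 𝟙 (U x) * 𝟙 (U y) * (N * N + 𝟙 (does (x Fin.≟ y)) * (τ * (N * N)))))
      ≤⟨ ∑-mono row ⟩
    ∑ (λ x → 𝟙 (U x) * (count U * (N * N) + τ * (N * N)))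
      ≡⟨ ∑-*ʳ (𝟙 ∘ U) _ ⟩
    count U * (count U * (N * N) + τ * (N * N))
      ≡⟨ trans (*-distribˡ-+ (count U) _ _) (cong (_+ count U * (τ * (N * N))) (sym (*-assoc (count U) (count U) (N * N)))) ⟩
    count U * count U * (N * N) + count U * (τ * (N * N)) ∎
    where
    open ≤-Reasoning
    rotate : ∀ a b c → a * (b * c) ≡ b * (a * c)
    rotate = solve-∀
    regroup : ∀ a b p q → 𝟙 (a ∧ p) * 𝟙 (b ∧ q) ≡ 𝟙 a * 𝟙 b * 𝟙 (p ∧ q)
    regroup a b p q rewrite 𝟙-∧ a p | 𝟙-∧ b q | 𝟙-∧ p q = four (𝟙 a) (𝟙 p) (𝟙 b) (𝟙 q)
      where
      four : ∀ a p b q → a * p * (b * q) ≡ a * b * (p * q)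
      four = solve-∀
    row : ∀ x → ∑ (λ y → 𝟙 (U x) * 𝟙 (U y) * (N * N + 𝟙 (does (x Fin.≟ y)) * (τ * (N * N)))) ≤ 𝟙 (U x) * (count U * (N * N) + τ * (N * N))
    row x = ≤-trans (≤-reflexive (trans (∑-cong λ y → *-assoc (𝟙 (U x)) (𝟙 (U y)) _) (∑-*ˡ (𝟙 (U x)) _)))
      (*-monoʳ-≤ (𝟙 (U x)) (≤-trans (∑-mono λ y → ≤-trans (≤-reflexive (*-distribˡ-+ (𝟙 (U y)) (N * N) _)) (+-monoʳ-≤ (𝟙 (U y) * (N * N)) (drop (U y) (𝟙 (does (x Fin.≟ y)) * (τ * (N * N))))))
        (≤-reflexive (trans (∑-+ (λ y → 𝟙 (U y) * (N * N)) (λ y → 𝟙 (does (x Fin.≟ y)) * (τ * (N * N))))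
          (cong₂ _+_ (∑-*ʳ (𝟙 ∘ U) (N * N)) (trans (∑-only _ x (off x)) (on x)))))))
      where
      drop : ∀ b z → 𝟙 b * z ≤ z
      drop true  z = ≤-reflexive (+-identityʳ z)
      drop false z = z≤n
      off : ∀ x y → y ≢ x → 𝟙 (does (x Fin.≟ y)) * (τ * (N * N)) ≡ 0
      off x y y≢x = cong (λ b → 𝟙 b * (τ * (N * N))) (dec-false (x Fin.≟ y) (y≢x ∘ sym))
      on : ∀ x → 𝟙 (does (x Fin.≟ x)) * (τ * (N * N)) ≡ τ * (N * N)
      on x = trans (cong (λ b → 𝟙 b * (τ * (N * N))) (dec-true (x Fin.≟ x) refl)) (+-identityʳ _)

  -- Chebyshev's inequality: the number of hits has mean |U| / τ, and a seed that
  -- misses U contributes (|U| / τ)² to the variance.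

  missed-bound : ∀ U → count U * ∑∑ (𝟙 ∘ missed U) ≤ τ * (N * N)
  missed-bound U with count U in eq
  ... | zero  = z≤n
  ... | suc c = *-cancelˡ-≤ (suc c) (+-cancelʳ-≤ (2 * (suc c * suc c * (N * N))) _ _ (begin
    suc c * (suc c * ∑∑ (𝟙 ∘ missed U)) + 2 * (suc c * suc c * (N * N))
      ≡⟨ cong₂ _+_ (trans (sym (*-assoc (suc c) (suc c) _)) (sym (∑∑-*ˡ (suc c * suc c) (𝟙 ∘ missed U)))) linear ⟩
    ∑∑ (λ s → suc c * suc c * 𝟙 (missed U s)) + ∑∑ (λ s → 2 * (suc c * (τ * hits U s)))
      ≡⟨ sym (∑∑-+ _ _) ⟩
    ∑∑ (λ s → suc c * suc c * 𝟙 (missed U s) + 2 * (suc c * (τ * hits U s)))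
      ≤⟨ ∑∑-mono pointwise ⟩
    ∑∑ (λ s → suc c * suc c + τ * hits U s * (τ * hits U s))
      ≡⟨ ∑∑-+ _ _ ⟩
    ∑∑ (λ _ → suc c * suc c) + ∑∑ (λ s → τ * hits U s * (τ * hits U s))
      ≡⟨ cong₂ _+_ (∑∑-const (suc c * suc c)) (trans (∑∑-cong λ s → four τ (hits U s)) (∑∑-*ˡ (τ * τ) _)) ⟩
    N * N * (suc c * suc c) + τ * τ * ∑∑ (λ s → hits U s * hits U s)
      ≤⟨ +-monoʳ-≤ (N * N * (suc c * suc c)) (subst (λ u → τ * τ * ∑∑ (λ s → hits U s * hits U s) ≤ u * u * (N * N) + u * (τ * (N * N))) eq (hits-square U)) ⟩
    N * N * (suc c * suc c) + (suc c * suc c * (N * N) + suc c * (τ * (N * N)))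
      ≡⟨ collect (suc c) (N * N) τ ⟩
    suc c * (τ * (N * N)) + 2 * (suc c * suc c * (N * N)) ∎))
    where
    open ≤-Reasoning
    collect : ∀ u m t → m * (u * u) + (u * u * m + u * (t * m)) ≡ u * (t * m) + 2 * (u * u * m)
    collect = solve-∀
    four : ∀ t h → t * h * (t * h) ≡ t * t * (h * h)
    four = solve-∀
    regroup : ∀ u m → 2 * (u * u * m) ≡ 2 * (u * (u * m))
    regroup = solve-∀
    linear : 2 * (suc c * suc c * (N * N)) ≡ ∑∑ (λ s → 2 * (suc c * (τ * hits U s)))
    linear = trans (regroup (suc c) (N * N)) (sym (trans (∑∑-*ˡ 2 _) (cong (2 *_) (trans (∑∑-*ˡ (suc c) _)
      (cong (suc c *_) (trans (∑∑-*ˡ τ (hits U)) (trans (hits-total U) (cong (_* (N * N)) eq))))))))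
    -- With u = |U| this is `(u - τ h)² ≥ u²` for `h = 0` and `≥ 0` otherwise, with the cross term
    -- moved to the left to avoid subtraction.
    pointwise : ∀ s → suc c * suc c * 𝟙 (missed U s) + 2 * (suc c * (τ * hits U s)) ≤ suc c * suc c + τ * hits U s * (τ * hits U s)
    pointwise s = bound (suc c) (hits U s)
      where
      bound : ∀ u h → u * u * 𝟙 (does (h ≟ 0)) + 2 * (u * (τ * h)) ≤ u * u + τ * h * (τ * h)
      bound u zero    rewrite *-zeroʳ τ | *-zeroʳ u = ≤-reflexive (cong (_+ 0) (*-identityʳ (u * u)))
      bound u (suc h) rewrite *-zeroʳ (u * u) = 2ab≤a²+b² u (τ * suc h)

  -- The weights balance the two aims. A vertex is sampled with probability 1/τ and U is missed with
  -- probability at most τ/|U|, so each summand has mean at most τ. The flag confines the charge to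
  -- the current level.
  cost : Bool → (Fin N → Bool) → Fin N → Seed → ℕ
  cost b U v s = 𝟙 b * (τ * τ * 𝟙 (picks s v) + count U * 𝟙 (missed U s))

  cost-total : ∀ b U v → ∑∑ (cost b U v) ≤ 𝟙 b * (2 * τ * (N * N))
  cost-total b U v = ≤-trans (≤-reflexive (∑∑-*ˡ (𝟙 b) _)) (*-monoʳ-≤ (𝟙 b) (begin
    ∑∑ (λ s → τ * τ * 𝟙 (picks s v) + count U * 𝟙 (missed U s))
      ≡⟨ ∑∑-+ (λ s → τ * τ * 𝟙 (picks s v)) (λ s → count U * 𝟙 (missed U s)) ⟩
    ∑∑ (λ s → τ * τ * 𝟙 (picks s v)) + ∑∑ (λ s → count U * 𝟙 (missed U s))
      ≡⟨ cong₂ _+_ (trans (∑∑-*ˡ (τ * τ) _) (trans (*-assoc τ τ _) (cong (τ *_) (picks-single v)))) (∑∑-*ˡ (count U) _) ⟩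
    τ * (N * N) + count U * ∑∑ (𝟙 ∘ missed U)
      ≤⟨ +-monoʳ-≤ (τ * (N * N)) (missed-bound U) ⟩
    τ * (N * N) + τ * (N * N)
      ≡⟨ twice τ (N * N) ⟩
    2 * τ * (N * N) ∎))
    where
    open ≤-Reasoning
    twice : ∀ a b → a * b + a * b ≡ 2 * a * b
    twice = solve-∀

  module Chosen (S : Fin N → Bool) (U : Fin N → Fin N → Bool) (s : Seed) .{{_ : NonZero N}}
    (best : N * N * ∑ (λ v → cost (S v) (U v) v s) ≤ ∑∑ (λ s → ∑ (λ v → cost (S v) (U v) v s))) where

    potential : ∑ (λ v → cost (S v) (U v) v s) ≤ count S * (2 * τ)
    potential = *-cancelˡ-≤ (N * N) {{m*n≢0 N N}} (begin
      N * N * ∑ (λ v → cost (S v) (U v) v s)             ≤⟨ best ⟩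
      ∑∑ (λ s → ∑ (λ v → cost (S v) (U v) v s))          ≡⟨ ∑∑-swap _ ⟩
      ∑ (λ v → ∑∑ (cost (S v) (U v) v))                  ≤⟨ ∑-mono (λ v → cost-total (S v) (U v) v) ⟩
      ∑ (λ v → 𝟙 (S v) * (2 * τ * (N * N)))              ≡⟨ ∑-*ʳ (𝟙 ∘ S) _ ⟩
      count S * (2 * τ * (N * N))                        ≡⟨ regroup (count S) (2 * τ) (N * N) ⟩
      N * N * (count S * (2 * τ))                        ∎)
      where
      open ≤-Reasoning
      regroup : ∀ a b c → a * (b * c) ≡ c * (a * b)
      regroup = solve-∀

    few : τ * count (λ v → S v ∧ picks s v) ≤ count S * 2
    few = *-cancelˡ-≤ τ {{m^n≢0 2 t}} (begin
      τ * (τ * count (λ v → S v ∧ picks s v))            ≡⟨ sym (*-assoc τ τ _) ⟩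
      τ * τ * count (λ v → S v ∧ picks s v)              ≡⟨ sym (∑-*ˡ (τ * τ) _) ⟩
      ∑ (λ v → τ * τ * 𝟙 (S v ∧ picks s v))              ≤⟨ ∑-mono (λ v → ≤-trans (≤-reflexive (trans (cong (τ * τ *_) (𝟙-∧ (S v) (picks s v))) (rotate (τ * τ) (𝟙 (S v)) _)))
                                                             (*-monoʳ-≤ (𝟙 (S v)) (m≤m+n _ _))) ⟩
      ∑ (λ v → cost (S v) (U v) v s)                     ≤⟨ potential ⟩
      count S * (2 * τ)                                  ≡⟨ rotate′ (count S) 2 τ ⟩
      τ * (count S * 2)                                  ∎)
      where
      open ≤-Reasoning
      rotate : ∀ a b c → a * (b * c) ≡ b * (a * c)
      rotate = solve-∀
      rotate′ : ∀ a b c → a * (b * c) ≡ c * (a * b)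
      rotate′ = solve-∀

    light : ∑ (λ v → 𝟙 (S v ∧ missed (U v) s) * count (U v)) ≤ count S * (2 * τ)
    light = ≤-trans (∑-mono λ v → ≤-trans (≤-reflexive (trans (cong (_* count (U v)) (𝟙-∧ (S v) (missed (U v) s))) (regroup (𝟙 (S v)) _ (count (U v)))))
                                          (*-monoʳ-≤ (𝟙 (S v)) (m≤n+m _ (τ * τ * 𝟙 (picks s v))))) potential
      where
      regroup : ∀ a b c → a * b * c ≡ a * (c * b)
      regroup = solve-∀

    -- A missed full list costs at least `k ≥ τ²`, as much as a sampled vertex, so the potential
    -- `2τ|S|` bounds either kind by 2|S|/τ.
    joined : ∀ k → τ * τ ≤ k → (full : Fin N → Bool) → (∀ v → full v ≡ true → k ≤ count (U v)) →
      τ * count (λ v → S v ∧ (picks s v ∨ (missed (U v) s ∧ full v))) ≤ count S * 4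
    joined k ττ≤k full full-k = begin
      τ * count (λ v → S v ∧ (picks s v ∨ (missed (U v) s ∧ full v)))
        ≤⟨ *-monoʳ-≤ τ (≤-trans (∑-mono λ v → either (S v) (picks s v) (missed (U v) s ∧ full v))
             (≤-reflexive (∑-+ (λ v → 𝟙 (S v ∧ picks s v)) (λ v → 𝟙 (S v ∧ (missed (U v) s ∧ full v)))))) ⟩
      τ * (count (λ v → S v ∧ picks s v) + count (λ v → S v ∧ (missed (U v) s ∧ full v)))
        ≡⟨ *-distribˡ-+ τ _ _ ⟩
      τ * count (λ v → S v ∧ picks s v) + τ * count (λ v → S v ∧ (missed (U v) s ∧ full v))
        ≤⟨ +-mono-≤ few heavy ⟩
      count S * 2 + count S * 2
        ≡⟨ sym (*-distribˡ-+ (count S) 2 2) ⟩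
      count S * 4 ∎
      where
      open ≤-Reasoning
      either : ∀ a b c → 𝟙 (a ∧ (b ∨ c)) ≤ 𝟙 (a ∧ b) + 𝟙 (a ∧ c)
      either false b     c = z≤n
      either true  true  c = s≤s z≤n
      either true  false c = ≤-refl
      weigh : ∀ v → k * 𝟙 (S v ∧ (missed (U v) s ∧ full v)) ≤ 𝟙 (S v ∧ missed (U v) s) * count (U v)
      weigh v with bool? (full v)
      ... | inj₂ e rewrite e = ≤-trans (≤-reflexive (trans (cong (λ b → k * 𝟙 b) (nothing (S v) (missed (U v) s))) (*-zeroʳ k))) z≤n
        where
        nothing : ∀ a b → a ∧ (b ∧ false) ≡ false
        nothing false b     = refl
        nothing true  true  = refl
        nothing true  false = refl
      ... | inj₁ e rewrite e = ≤-trans (≤-reflexive (trans (cong (λ b → k * 𝟙 b) (everything (S v) (missed (U v) s))) (*-comm k _)))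
                                       (*-monoʳ-≤ (𝟙 (S v ∧ missed (U v) s)) (full-k v e))
        where
        everything : ∀ a b → a ∧ (b ∧ true) ≡ a ∧ b
        everything false b     = refl
        everything true  true  = refl
        everything true  false = refl
      heavy : τ * count (λ v → S v ∧ (missed (U v) s ∧ full v)) ≤ count S * 2
      heavy = *-cancelˡ-≤ τ {{m^n≢0 2 t}} (begin
        τ * (τ * count (λ v → S v ∧ (missed (U v) s ∧ full v)))  ≡⟨ sym (*-assoc τ τ _) ⟩
        τ * τ * count (λ v → S v ∧ (missed (U v) s ∧ full v))    ≤⟨ *-monoˡ-≤ _ ττ≤k ⟩
        k * count (λ v → S v ∧ (missed (U v) s ∧ full v))        ≡⟨ sym (∑-*ˡ k _) ⟩
        ∑ (λ v → k * 𝟙 (S v ∧ (missed (U v) s ∧ full v)))        ≤⟨ ∑-mono weigh ⟩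
        ∑ (λ v → 𝟙 (S v ∧ missed (U v) s) * count (U v))         ≤⟨ light ⟩
        count S * (2 * τ)                                        ≡⟨ rotate (count S) 2 τ ⟩
        τ * (count S * 2)                                        ∎)
        where
        rotate : ∀ a b c → a * (b * c) ≡ c * (a * b)
        rotate = solve-∀

  cost≤ : ∀ b U v s → cost b U v s ≤ τ * τ + N
  cost≤ b U v s = ≤-trans (≤-trans (*-monoˡ-≤ (τ * τ * 𝟙 (picks s v) + count U * 𝟙 (missed U s)) (𝟙≤1 b)) (≤-reflexive (*-identityˡ _)))
    (+-mono-≤ (≤-trans (*-monoʳ-≤ (τ * τ) (𝟙≤1 (picks s v))) (≤-reflexive (*-identityʳ _)))
              (≤-trans (*-mono-≤ (count≤n U) (𝟙≤1 (missed U s))) (≤-reflexive (*-identityʳ N))))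

  pivot : (Fin N → Bool) → Fin N → Seed → Fin N
  pivot U v s = argmin v λ u → 𝟙 (not (U u ∧ picks s u))

  pivot-hits : ∀ U v s → missed U s ≡ false → U (pivot U v s) ≡ true × picks s (pivot U v s) ≡ true
  pivot-hits U v s e = pick (count-witness (λ u → U u ∧ picks s u))
    where
    bit : ∀ b → 𝟙 (not b) ≤ 0 → b ≡ true
    bit true _ = refl
    pick : (∃ λ u → U u ∧ picks s u ≡ true) ⊎ (∀ u → U u ∧ picks s u ≡ false) →
      U (pivot U v s) ≡ true × picks s (pivot U v s) ≡ true
    pick (inj₂ none) = ⊥-elim (fails (hits U s ≟ 0) e (count-none (λ x → U x ∧ picks s x) none))
    pick (inj₁ (u , hit)) = ∧-true (bit _ (≤-trans (argmin≤ v (λ u → 𝟙 (not (U u ∧ picks s u))) u) (≤-reflexive (cong (λ b → 𝟙 (not b)) hit))))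

-- Walks and hop-bounded paths

module Walks {n : ℕ} (G : Graph n) where

  open Graph G

  _◅◅_ : ∀ {x y z i j} → Walk G x y i → Walk G y z j → Walk G x z (i + j)
  here     ◅◅ w = w
  step e v ◅◅ w = step e (v ◅◅ w)

  reverse : ∀ {x y i} → Walk G x y i → Walk G y x i
  reverse here = here
  reverse {i = suc i} (step {u} {v} e w) =
    subst (Walk G _ _) (+-comm i 1) (reverse w ◅◅ step (trans (Graph.sym G v u) e) here)

  split : ∀ {x y ℓ} i → i ≤ ℓ → Walk G x y ℓ → ∃ λ z → Walk G x z i × Walk G z y (ℓ ∸ i)
  split zero    _       w          = _ , here , w
  split (suc i) (s≤s p) (step e w) with split i p w
  ... | z , a , b = z , step e a , b

  -- A walk of more than n steps repeats a vertex, and the closed part is cut out. This keeps every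
  -- distance in use below the value `INF` of absent entries.
  shorten : ∀ {x y} ℓ → Walk G x y ℓ → Σ[ m ∈ ℕ ] (m ≤ ℓ × m ≤ n × Walk G x y m)
  shorten ℓ w = go ℓ ℓ ≤-refl w
    where
    go : ∀ bound ℓ → ℓ ≤ bound → ∀ {x y} → Walk G x y ℓ → Σ[ m ∈ ℕ ] (m ≤ ℓ × m ≤ n × Walk G x y m)
    go bound ℓ ℓ≤ w with ℓ ≤? n
    ... | yes p = ℓ , ≤-refl , p , w
    go zero    zero z≤n w | no ¬p = ⊥-elim (¬p z≤n)
    go (suc bound) ℓ ℓ≤ w | no ¬p
      with Fin.pigeonhole (≰⇒> ¬p) (λ i → proj₁ (split (toℕ i) (<⇒≤ (Fin.toℕ<n i)) w))
    ... | i , j , i<j , e = shorter (go bound _ (ℕ.s≤s⁻¹ (<-≤-trans lt ℓ≤))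
            (subst (λ v → Walk G _ v _) e (proj₁ (proj₂ (split (toℕ i) (<⇒≤ (Fin.toℕ<n i)) w))) ◅◅
             proj₂ (proj₂ (split (toℕ j) (<⇒≤ (Fin.toℕ<n j)) w))))
      where
      lt : toℕ i + (ℓ ∸ toℕ j) < ℓ
      lt = <-≤-trans (+-monoˡ-< (ℓ ∸ toℕ j) i<j) (≤-reflexive (m+[n∸m]≡n (<⇒≤ (Fin.toℕ<n j))))
      shorter : Σ[ m ∈ ℕ ] (m ≤ toℕ i + (ℓ ∸ toℕ j) × m ≤ n × Walk G _ _ m) → Σ[ m ∈ ℕ ] (m ≤ ℓ × m ≤ n × Walk G _ _ m)
      shorter (m , p , q , v) = m , ≤-trans p (<⇒≤ lt) , q , v


data Hops {n : ℕ} (A : Fin n → Fin n → ℕ) : ℕ → Fin n → Fin n → ℕ → Set where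
  stop : ∀ {h x} → Hops A h x x 0
  hop  : ∀ {h x z d} y → Hops A h y z d → Hops A (suc h) x z (A x y + d)

hops-mono : ∀ {n} {A B : Fin n → Fin n → ℕ} → (∀ x y → B x y ≤ A x y) → ∀ {h i x y d} → h ≤ i →
  Hops A h x y d → Σ[ e ∈ ℕ ] (e ≤ d × Hops B i x y e)
hops-mono p h≤i       stop             = 0 , z≤n , stop
hops-mono p (s≤s h≤i) (hop {x = x} y c) with hops-mono p h≤i c
... | e , e≤ , c′ = _ , +-mono-≤ (p x y) e≤ , hop y c′

hops-++ : ∀ {n} {A : Fin n → Fin n → ℕ} {h i x y z d e} → Hops A h x y d → Hops A i y z e → Hops A (h + i) x z (d + e)
hops-++ {h = zero}  stop c′ = c′
hops-++ {h = suc h} stop c′ = hops-weaken (hops-++ {h = h} stop c′)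
  where
  hops-weaken : ∀ {n} {A : Fin n → Fin n → ℕ} {h x y d} → Hops A h x y d → Hops A (suc h) x y d
  hops-weaken stop      = stop
  hops-weaken (hop y c) = hop y (hops-weaken c)
hops-++ {A = A} {e = e} (hop {x = x} {d = d} y c) c′ =
  subst (Hops A _ x _) (sym (+-assoc (A x y) d e)) (hop y (hops-++ c c′))

-- Each vertex supplies itself as the index that shows nonemptiness, and still all vertices must
-- agree on the seed.
argmin-cong : ∀ {n} (i j : Fin n) {f g : Fin n → ℕ} → (∀ x → f x ≡ g x) → argmin i f ≡ argmin j g
argmin-cong {suc zero}    i j e = refl
argmin-cong {suc (suc n)} i j {f} {g} e = trans (cong (earlier f) (argmin-cong zero zero (e ∘ suc))) (earlier-cong (argmin zero (g ∘ suc)))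
  where
  earlier-cong : ∀ k → earlier f k ≡ earlier g k
  earlier-cong k = cong₂ (λ a b → if does (a ≤? b) then zero else suc k) (e zero) (e (suc k))

nth-overflow : ∀ (xs : List ℕ) d e → length xs ≤ e → nth xs d e ≡ d
nth-overflow []       d e       le       = refl
nth-overflow (x ∷ xs) d (suc e) (s≤s le) = nth-overflow xs d e le

-- Prefix sums and greedy independent sets

module Prefix {N : ℕ} (len : Fin N → ℕ) where

  -- The offset of the items of v in the concatenation of all lists.
  pos : Fin N → ℕ
  pos v = ∑ λ u → if does (toℕ u <? toℕ v) then len u else 0

  shifted : ∀ v (f : Fin N → ℕ) → (∀ u → toℕ u < toℕ v → len u ≤ f u) → len v ≤ f v → pos v + len v ≤ ∑ f
  shifted v f lt eq = begin
    pos v + len v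
      ≡⟨ cong (pos v +_) (sym (trans (∑-only (λ u → if does (u Fin.≟ v) then len u else 0) v λ u u≢v → if-false (dec-false (u Fin.≟ v) u≢v))
                                     (if-true (dec-true (v Fin.≟ v) refl)))) ⟩
    pos v + ∑ (λ u → if does (u Fin.≟ v) then len u else 0)
      ≡⟨ sym (∑-+ _ _) ⟩
    ∑ (λ u → (if does (toℕ u <? toℕ v) then len u else 0) + (if does (u Fin.≟ v) then len u else 0))
      ≤⟨ ∑-mono term ⟩
    ∑ f ∎
    where
    open ≤-Reasoning
    term : ∀ u → (if does (toℕ u <? toℕ v) then len u else 0) + (if does (u Fin.≟ v) then len u else 0) ≤ f u
    term u with u Fin.≟ v
    ... | yes refl rewrite dec-false (toℕ u <? toℕ u) (<-irrefl refl) = eq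
    ... | no  _ with bool? (does (toℕ u <? toℕ v))
    ...   | inj₁ e rewrite e = ≤-trans (≤-reflexive (+-identityʳ _)) (lt u (holds (toℕ u <? toℕ v) e))
    ...   | inj₂ e rewrite e = z≤n

  pos-total : ∀ v → pos v + len v ≤ ∑ len
  pos-total v = shifted v len (λ _ _ → ≤-refl) ≤-refl

  pos-next : ∀ {v w} → toℕ v < toℕ w → pos v + len v ≤ pos w
  pos-next {v} {w} v<w = shifted v _ (λ u u<v → ≤-reflexive (sym (if-true (dec-true (toℕ u <? toℕ w) (<-trans u<v v<w)))))
    (≤-reflexive (sym (if-true (dec-true (toℕ v <? toℕ w) v<w))))


elem : ∀ {n} → Fin n → List (Fin n) → Bool
elem v []       = false
elem v (u ∷ us) = does (v Fin.≟ u) ∨ elem v us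

conflicts : ∀ {n} → (Fin n → Fin n → Bool) → Fin n → List (Fin n) → Bool
conflicts c v []       = false
conflicts c v (u ∷ us) = c v u ∨ conflicts c v us

greedy : ∀ {n} → (Fin n → Bool) → (Fin n → Fin n → Bool) → List (Fin n) → List (Fin n)
greedy r c []       = []
greedy r c (v ∷ vs) = if r v ∧ not (conflicts c v (greedy r c vs)) then v ∷ greedy r c vs else greedy r c vs

∨-true : ∀ {a b} → a ∨ b ≡ true → a ≡ true ⊎ b ≡ true
∨-true {true}  _ = inj₁ refl
∨-true {false} e = inj₂ e

true∨ : ∀ {a} b → a ≡ true → a ∨ b ≡ true
true∨ b refl = refl

∨true : ∀ a {b} → b ≡ true → a ∨ b ≡ true
∨true true  e = refl
∨true false e = e

elem-count : ∀ {n} (l : List (Fin n)) → count (λ v → elem v l) ≤ length l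
elem-count {n} []       = ≤-reflexive (count-none {n} (λ _ → false) λ _ → refl)
elem-count {n} (u ∷ us) = ≤-trans (∑-mono split) (≤-trans (≤-reflexive (∑-+ (λ v → 𝟙 (does (v Fin.≟ u))) (λ v → 𝟙 (elem v us))))
  (+-mono-≤ (count≤1 _ λ i j a b → trans (holds (i Fin.≟ u) a) (sym (holds (j Fin.≟ u) b))) (elem-count us)))
  where
  split : ∀ v → 𝟙 (does (v Fin.≟ u) ∨ elem v us) ≤ 𝟙 (does (v Fin.≟ u)) + 𝟙 (elem v us)
  split v with does (v Fin.≟ u)
  ... | true  = s≤s z≤n
  ... | false = ≤-refl

conflicts-true : ∀ {n} (c : Fin n → Fin n → Bool) v l → conflicts c v l ≡ true → ∃ λ u → elem u l ≡ true × c v u ≡ true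
conflicts-true c v (u ∷ us) e with ∨-true {c v u} e
... | inj₁ p = u , true∨ (elem u us) (dec-true (u Fin.≟ u) refl) , p
... | inj₂ p with conflicts-true c v us p
...   | w , m , q = w , ∨true (does (w Fin.≟ u)) m , q

greedy-∈ : ∀ {n} (r : Fin n → Bool) c vs u → elem u (greedy r c vs) ≡ true → r u ≡ true
greedy-∈ r c (v ∷ vs) u e with bool? (r v ∧ not (conflicts c v (greedy r c vs)))
... | inj₂ f rewrite f = greedy-∈ r c vs u e
... | inj₁ f rewrite f with ∨-true {does (u Fin.≟ v)} e
...   | inj₁ p rewrite holds (u Fin.≟ v) p = proj₁ (∧-true f)
...   | inj₂ p = greedy-∈ r c vs u p

greedy-dominates : ∀ {n} (r : Fin n → Bool) c vs u → u ∈ vs → r u ≡ true →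
  elem u (greedy r c vs) ≡ true ⊎ (∃ λ w → elem w (greedy r c vs) ≡ true × c u w ≡ true)
greedy-dominates r c (v ∷ vs) u u∈ ru with bool? (r v ∧ not (conflicts c v (greedy r c vs)))
greedy-dominates r c (v ∷ vs) .v (here refl) ru | inj₁ f rewrite f = inj₁ (true∨ (elem v (greedy r c vs)) (dec-true (v Fin.≟ v) refl))
greedy-dominates r c (v ∷ vs) u (there u∈) ru | inj₁ f rewrite f with greedy-dominates r c vs u u∈ ru
... | inj₁ p = inj₁ (∨true (does (u Fin.≟ v)) p)
... | inj₂ (w , p , q) = inj₂ (w , ∨true (does (w Fin.≟ v)) p , q)
greedy-dominates r c (v ∷ vs) u (there u∈) ru | inj₂ f rewrite f = greedy-dominates r c vs u u∈ ru
greedy-dominates r c (v ∷ vs) .v (here refl) ru | inj₂ f rewrite f | ru with bool? (conflicts c v (greedy r c vs))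
... | inj₁ p = inj₂ (conflicts-true c v (greedy r c vs) p)
... | inj₂ p = ⊥-elim (true≢false (cong not p) f)

lsum : ∀ {n} → List (Fin n) → (Fin n → ℕ) → ℕ
lsum []       f = 0
lsum (v ∷ vs) f = f v + lsum vs f

lsum-∑ : ∀ {m n} (l : List (Fin m)) (f : Fin m → Fin n → ℕ) → lsum l (λ v → ∑ (f v)) ≡ ∑ (λ y → lsum l (λ v → f v y))
lsum-∑ {n = n} [] f = sym (∑-0 n)
lsum-∑ (v ∷ l) f = trans (cong (∑ (f v) +_) (lsum-∑ l f)) (sym (∑-+ (f v) _))

module Packing-bound {m n : ℕ} (r : Fin m → Bool) (c : Fin m → Fin m → Bool) (ball : Fin m → Fin n → Bool) (k : ℕ)
  (big : ∀ v → r v ≡ true → k ≤ count (ball v))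
  (disjoint : ∀ v u y → r v ≡ true → r u ≡ true → ball v y ≡ true → ball u y ≡ true → c v u ≡ true) where

  -- Two selected balls through y would be in conflict, which the greedy choice excludes.
  once : ∀ vs y → lsum (greedy r c vs) (λ v → 𝟙 (ball v y)) ≤ 1
  once []       y = z≤n
  once (v ∷ vs) y with bool? (r v ∧ not (conflicts c v (greedy r c vs)))
  ... | inj₂ f rewrite f = once vs y
  ... | inj₁ f rewrite f with bool? (ball v y)
  ...   | inj₂ e rewrite e = once vs y
  ...   | inj₁ e rewrite e = s≤s (≤-reflexive (none (greedy r c vs) (λ u → greedy-∈ r c vs u) (not-true (proj₂ (∧-true {r v} f)))))
    where
    none : ∀ l → (∀ u → elem u l ≡ true → r u ≡ true) → conflicts c v l ≡ false → lsum l (λ u → 𝟙 (ball u y)) ≡ 0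
    none []      _  _  = refl
    none (u ∷ l) in-r nc with bool? (ball u y)
    ... | inj₁ e′ = ⊥-elim (true≢false (true∨ (conflicts c v l)
            (disjoint v u y (proj₁ (∧-true f)) (in-r u (true∨ (elem u l) (dec-true (u Fin.≟ u) refl))) e e′)) nc)
    ... | inj₂ e′ rewrite e′ = none l (λ w p → in-r w (∨true (does (w Fin.≟ u)) p)) (rest (c v u) nc)
      where
      rest : ∀ a {b} → a ∨ b ≡ false → b ≡ false
      rest false p = p

  greedy-length : ∀ vs → length (greedy r c vs) * k ≤ n
  greedy-length vs = ≤-trans (each (greedy r c vs) (λ u → greedy-∈ r c vs u)) (≤-trans (≤-reflexive (lsum-∑ (greedy r c vs) (λ v y → 𝟙 (ball v y))))
    (≤-trans (∑≤ _ 1 (once vs)) (≤-reflexive (*-identityʳ n))))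
    where
    each : ∀ l → (∀ u → elem u l ≡ true → r u ≡ true) → length l * k ≤ lsum l (λ v → count (ball v))
    each []      _    = z≤n
    each (u ∷ l) in-r = +-mono-≤ (big u (in-r u (true∨ (elem u l) (dec-true (u Fin.≟ u) refl)))) (each l λ w p → in-r w (∨true (does (w Fin.≟ u)) p))

greedy-cong : ∀ {n} {r r′ : Fin n → Bool} {c c′ : Fin n → Fin n → Bool} → (∀ v → r v ≡ r′ v) → (∀ v u → c v u ≡ c′ v u) →
  ∀ vs → greedy r c vs ≡ greedy r′ c′ vs
greedy-cong p q []       = refl
greedy-cong {r = r} {r′} {c} {c′} p q (v ∷ vs) = cong₂ (λ b l → if b then v ∷ l else l)
  (cong₂ (λ a b → a ∧ not b) (p v) (trans (conflicts-cong (greedy r c vs)) (cong (conflicts c′ v) (greedy-cong p q vs)))) (greedy-cong p q vs)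
  where
  conflicts-cong : ∀ l → conflicts c v l ≡ conflicts c′ v l
  conflicts-cong []      = refl
  conflicts-cong (u ∷ l) = cong₂ _∨_ (q v u) (conflicts-cong l)

-- Doubling the scale of approximate distances

-- One doubling of the scale.  A walk of length at most 2S, where S = e′σ, is followed by
-- jumps of length σ to listed vertices; where such a jump is impossible, the hitting set Z
-- is within 9σ and its distances at scale S bridge S / 2 at once.

module Doubling {N : ℕ} (G : Graph N) (A A′ nl : Fin N → Fin N → ℕ) (Z full : Fin N → Bool) (h e′ c j σ H : ℕ)
  (A′≤A : ∀ x y → A′ x y ≤ A x y) (A′≤nl : ∀ x y → A′ x y ≤ nl x y)
  (listed : ∀ {x y ℓ} → Walk G x y ℓ → ℓ ≤ σ → nl x y ≤ ℓ ⊎ full x ≡ true)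
  (near : ∀ x → full x ≡ true → ∃ λ z → Z z ≡ true × (Σ[ ℓ ∈ ℕ ] (ℓ ≤ 9 * σ × Walk G x z ℓ)))
  (bridge : ∀ {x z ℓ} → Z z ≡ true → Walk G x z ℓ → ℓ ≤ H * 2 →
     Σ[ d ∈ ℕ ] (e′ * d ≤ (e′ + c * j) * ℓ × A′ x z ≤ d × A′ z x ≤ d))
  (9σ≤H : 9 * σ ≤ H) where

  open Walks G

  -- b is the budget of bridges, each worth progress H, and m the budget of jumps of length σ. A
  -- bridge takes two hops, to a nearby z and from z to the vertex H further on, and its detour to z
  -- and back is at most 2 * 9σ.
  advance : ∀ b m {x y ℓ} → Walk G x y ℓ → ℓ ≤ b * H → ℓ ≤ m * σ →
    Σ[ d ∈ ℕ ] (e′ * d ≤ (e′ + c * j) * (ℓ + b * (18 * σ)) × Hops A′ (m + b * 2) x y d)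
  advance zero    m       here       b≤ m≤ = 0 , ≤-trans (≤-reflexive (*-zeroʳ e′)) z≤n , stop
  advance zero    m       (step _ _) () m≤
  advance (suc b) zero    here       b≤ m≤ = 0 , ≤-trans (≤-reflexive (*-zeroʳ e′)) z≤n , stop
  advance (suc b) zero    (step _ _) b≤ ()
  advance (suc b) (suc m) {x} {y} {ℓ} w b≤ m≤ = go (split (ℓ ⊓ σ) (m⊓n≤m ℓ σ) w)
    where
    F = e′ + c * j
    ∸-≤ : ∀ r s → ℓ ≤ r + s → ℓ ∸ (ℓ ⊓ r) ≤ s
    ∸-≤ r s le = [ (λ ℓ≤r → ≤-trans (≤-reflexive (trans (cong (ℓ ∸_) (m≤n⇒m⊓n≡m ℓ≤r)) (n∸n≡0 ℓ))) z≤n)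
                 , (λ r≤ℓ → ≤-trans (≤-reflexive (cong (ℓ ∸_) (m≥n⇒m⊓n≡n r≤ℓ))) (≤-trans (∸-monoˡ-≤ r le) (≤-reflexive (m+n∸m≡n r s)))) ]′ (≤-total ℓ r)
    combine-cost : ∀ p q X {d₁ d₂} → e′ * d₁ ≤ F * p → e′ * d₂ ≤ F * q → p + q ≤ X → e′ * (d₁ + d₂) ≤ F * X
    combine-cost p q X {d₁} {d₂} c₁ c₂ le = ≤-trans (≤-reflexive (*-distribˡ-+ e′ d₁ d₂))
      (≤-trans (+-mono-≤ c₁ c₂) (≤-trans (≤-reflexive (sym (*-distribˡ-+ F p q))) (*-monoʳ-≤ F le)))
    jump : full x ≡ true → Σ[ d ∈ ℕ ] (e′ * d ≤ F * (ℓ + suc b * (18 * σ)) × Hops A′ (suc m + suc b * 2) x y d)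
    jump f = over (split (ℓ ⊓ H) (m⊓n≤m ℓ H) w) (near x f)
      where
      g = ℓ ⊓ H
      over : (∃ λ x′ → Walk G x x′ g × Walk G x′ y (ℓ ∸ g)) → (∃ λ z → Z z ≡ true × (Σ[ i ∈ ℕ ] (i ≤ 9 * σ × Walk G x z i))) →
        Σ[ d ∈ ℕ ] (e′ * d ≤ F * (ℓ + suc b * (18 * σ)) × Hops A′ (suc m + suc b * 2) x y d)
      over (x′ , u , v) (z , Zz , i , i≤ , wz) =
        let d₁ , c₁ , a₁ , _ = bridge Zz wz (≤-trans i≤ (≤-trans 9σ≤H (m≤m*n H 2)))
            d₂ , c₂ , _ , a₂ = bridge Zz (reverse u ◅◅ wz) (≤-trans (+-mono-≤ (m⊓n≤n ℓ H) (≤-trans i≤ 9σ≤H)) (≤-reflexive (double H)))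
            d₃ , c₃ , hs     = advance b (suc m) v (∸-≤ H (b * H) b≤) (≤-trans (m∸n≤m ℓ g) m≤)
        in  A′ x z + (A′ z x′ + d₃) ,
            ≤-trans (*-monoʳ-≤ e′ (+-mono-≤ a₁ (+-monoˡ-≤ d₃ a₂)))
              (combine-cost i (g + i + (ℓ ∸ g + b * (18 * σ))) _ c₁ (combine-cost (g + i) (ℓ ∸ g + b * (18 * σ)) _ c₂ c₃ ≤-refl) (total i≤)) ,
            subst (λ n → Hops A′ n x y (A′ x z + (A′ z x′ + d₃))) (hops≡ m b) (hop z (hop x′ hs))
        where
        double : ∀ H → H + H ≡ H * 2
        double = solve-∀
        hops≡ : ∀ m b → suc (suc (suc m + b * 2)) ≡ suc m + suc b * 2
        hops≡ = solve-∀
        total : i ≤ 9 * σ → i + (g + i + (ℓ ∸ g + b * (18 * σ))) ≤ ℓ + suc b * (18 * σ)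
        total i≤ = ≤-trans (≤-reflexive (regroup i g (ℓ ∸ g) (b * (18 * σ))))
          (+-mono-≤ (≤-reflexive (m+[n∸m]≡n (m⊓n≤m ℓ H))) (+-monoˡ-≤ (b * (18 * σ)) (≤-trans (+-mono-≤ i≤ i≤) (≤-reflexive (eighteen σ)))))
          where
          regroup : ∀ i g r t → i + (g + i + (r + t)) ≡ g + r + (i + i + t)
          regroup = solve-∀
          eighteen : ∀ s → 9 * s + 9 * s ≡ 18 * s
          eighteen = solve-∀
    go : (∃ λ x′ → Walk G x x′ (ℓ ⊓ σ) × Walk G x′ y (ℓ ∸ (ℓ ⊓ σ))) →
      Σ[ d ∈ ℕ ] (e′ * d ≤ F * (ℓ + suc b * (18 * σ)) × Hops A′ (suc m + suc b * 2) x y d)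
    go (x′ , u , v) = [ onward , jump ]′ (listed u (m⊓n≤n ℓ σ))
      where
      onward : nl x x′ ≤ ℓ ⊓ σ → Σ[ d ∈ ℕ ] (e′ * d ≤ F * (ℓ + suc b * (18 * σ)) × Hops A′ (suc m + suc b * 2) x y d)
      onward le =
        let d , cost , hs = advance (suc b) m v (≤-trans (m∸n≤m ℓ (ℓ ⊓ σ)) b≤) (∸-≤ σ (m * σ) m≤)
        in  A′ x x′ + d ,
            combine-cost (ℓ ⊓ σ) _ _ (*-mono-≤ (m≤m+n e′ (c * j)) (≤-trans (A′≤nl x x′) le)) cost
              (≤-reflexive (trans (sym (+-assoc (ℓ ⊓ σ) _ _)) (cong (_+ suc b * (18 * σ)) (m+[n∸m]≡n (m⊓n≤m ℓ σ))))) ,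
            hop x′ hs

  -- A walk of length at most 4H needs 4 bridges and 2e′ jumps, hence `h = 2e′ + 8`. The detours add
  -- 72σ, counted at slope at most 2; since ℓ exceeds `2H = e′σ`, this raises the numerator of the
  -- slope by 144, the value of c.
  double : H * 2 ≡ e′ * σ → c ≡ 144 → c * j ≤ e′ → h ≡ e′ * 2 + 8 →
    (∀ {x y ℓ} → Walk G x y ℓ → ℓ ≤ H * 2 → Σ[ d ∈ ℕ ] (e′ * d ≤ (e′ + c * j) * ℓ × Hops A h x y d)) →
    ∀ {x y ℓ} → Walk G x y ℓ → ℓ ≤ H * 2 * 2 → Σ[ d ∈ ℕ ] (e′ * d ≤ (e′ + c * suc j) * ℓ × Hops A′ h x y d)
  double 2H≡ c≡ cj≤ h≡ hyp {x} {y} {ℓ} w ℓ≤ with ℓ ≤? H * 2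
  ... | yes le =
    let d , cost , hs = hyp w le
        d′ , d′≤ , hs′ = hops-mono A′≤A ≤-refl hs
    in  d′ , ≤-trans (*-monoʳ-≤ e′ d′≤) (≤-trans cost (*-monoˡ-≤ ℓ (+-monoʳ-≤ e′ (*-monoʳ-≤ c (n≤1+n j))))) , hs′
  ... | no  gt =
    let d , cost , hs = advance 4 (e′ * 2) w (≤-trans ℓ≤ (≤-reflexive (four H))) (≤-trans ℓ≤ (≤-reflexive (trans (cong (_* 2) 2H≡) (rotate e′ σ))))
    in  d , ≤-trans cost (extra (<⇒≤ (≰⇒> gt))) , subst (λ n → Hops A′ n x y d) (sym h≡) hs
    where
    four : ∀ H → H * 2 * 2 ≡ 4 * H
    four = solve-∀
    rotate : ∀ a b → a * b * 2 ≡ a * 2 * b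
    rotate = solve-∀
    extra : H * 2 ≤ ℓ → (e′ + c * j) * (ℓ + 4 * (18 * σ)) ≤ (e′ + c * suc j) * ℓ
    extra le = begin
      (e′ + c * j) * (ℓ + 4 * (18 * σ))              ≡⟨ expand e′ (c * j) ℓ σ ⟩
      (e′ + c * j) * ℓ + 72 * (e′ + c * j) * σ       ≤⟨ +-monoʳ-≤ ((e′ + c * j) * ℓ) (begin
        72 * (e′ + c * j) * σ                          ≤⟨ *-monoˡ-≤ σ (*-monoʳ-≤ 72 (+-monoʳ-≤ e′ cj≤)) ⟩
        72 * (e′ + e′) * σ                             ≡⟨ twice e′ σ ⟩
        144 * (e′ * σ)                                 ≤⟨ *-monoʳ-≤ 144 (≤-trans (≤-reflexive (sym 2H≡)) le) ⟩
        144 * ℓ                                        ≡⟨ cong (λ z → z * ℓ) {x = 144} {y = c} (sym c≡) ⟩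
        c * ℓ                                          ∎) ⟩
      (e′ + c * j) * ℓ + c * ℓ                       ≡⟨ collect e′ c j ℓ ⟩
      (e′ + c * suc j) * ℓ                           ∎
      where
      open ≤-Reasoning
      expand : ∀ a b l s → (a + b) * (l + 4 * (18 * s)) ≡ (a + b) * l + 72 * (a + b) * s
      expand = solve-∀
      twice : ∀ a s → 72 * (a + a) * s ≡ 144 * (a * s)
      twice = solve-∀
      collect : ∀ a c j l → (a + c * j) * l + c * l ≡ (a + c * suc j) * l
      collect = solve-∀

-- The stretch of a hierarchy of levels

data Chain {n : ℕ} (INF : ℕ) (A : Fin n → Fin n → ℕ) : Fin n → Fin n → ℕ → Set where
  end  : ∀ {x} → Chain INF A x x 0
  link : ∀ {x z c} y → A x y < INF → Chain INF A y z c → Chain INF A x z (A x y + c)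

module Chains {n INF : ℕ} {A : Fin n → Fin n → ℕ} where

  _▻_ : ∀ {x y z c d} → Chain INF A x y c → Chain INF A y z d → Chain INF A x z (c + d)
  end                            ▻ q = q
  _▻_ {d = d} (link {x} {c = c} y lt p) q = subst (Chain INF A x _) (sym (+-assoc (A x y) c d)) (link y lt (p ▻ q))

  flip : (∀ x y → A x y ≡ A y x) → ∀ {x y c} → Chain INF A x y c → Chain INF A y x c
  flip s end = end
  flip s (link {x} {z} {c} y lt p) = subst (Chain INF A z x) (trans (cong (c +_) (trans (+-identityʳ (A y x)) (s y x))) (+-comm c (A x y)))
    (flip s p ▻ link x (subst (_< INF) (s x y) lt) end)

  one : ∀ {x y} → A x y < INF → Chain INF A x y (A x y)
  one {x} {y} lt = subst (Chain INF A x y) (+-identityʳ (A x y)) (link y lt end)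

-- A walk is cut into segments of length at most λ′.  Each segment is either followed
-- closely by a chain, or both its ends are "bad"; everything between the first bad left
-- end and the last bad right end is left to a single bridge.

module Segments {N INF : ℕ} (G : Graph N) (A : Fin N → Fin N → ℕ) (bad : Fin N → Set) (λ′ M μ′ μ c′ : ℕ)
  (slope : (M + μ′) * λ′ + M * c′ ≤ (M + μ) * λ′) (μ′≤μ : μ′ ≤ μ)
  (segment : ∀ {x y ℓ} → Walk G x y ℓ → ℓ ≤ λ′ →
     (Σ[ w ∈ ℕ ] (Chain INF A x y w × M * w ≤ (M + μ′) * ℓ + M * c′)) ⊎ (bad x × bad y)) where

  open Walks G
  open Chains {N} {INF} {A}

  Close : Fin N → Fin N → ℕ → ℕ → Set
  Close x y ℓ extra = Σ[ w ∈ ℕ ] (Chain INF A x y w × M * w ≤ (M + μ) * ℓ + extra)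

  record Split (x y : Fin N) (ℓ : ℕ) : Set where
    constructor cutAt
    field
      {u u′}         : Fin N
      {ℓ₁ ℓ₂ ℓ₃}     : ℕ
      left           : Close x u ℓ₁ 0
      before         : Walk G x u ℓ₁
      bad-u          : bad u
      middle         : Walk G u u′ ℓ₂
      bad-u′         : bad u′
      right          : Close u′ y ℓ₃ (M * c′)
      lengths        : ℓ₁ + ℓ₂ + ℓ₃ ≡ ℓ

  close-end : ∀ {x} e → Close x x 0 e
  close-end e = 0 , end , ≤-trans (≤-reflexive (*-zeroʳ M)) z≤n

  close-++ : ∀ {x y z ℓ ℓ′ e} → Close x y ℓ 0 → Close y z ℓ′ e → Close x z (ℓ + ℓ′) e
  close-++ {ℓ = ℓ} {ℓ′} {e} (w , p , b) (w′ , p′ , b′) = w + w′ , p ▻ p′ ,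
    ≤-trans (≤-reflexive (*-distribˡ-+ M w w′)) (≤-trans (+-mono-≤ b b′) (≤-reflexive (regroup (M + μ) ℓ ℓ′ e)))
    where
    regroup : ∀ f a b e → f * a + 0 + (f * b + e) ≡ f * (a + b) + e
    regroup = solve-∀

  -- Every segment but the last has full length λ′, and there `slope` turns its additive error into
  -- slope; only the last one keeps the term `M * c′`.
  segments : ∀ m {x y ℓ} → Walk G x y ℓ → ℓ ≤ m * λ′ → Close x y ℓ (M * c′) ⊎ Split x y ℓ
  segments zero here le = inj₁ (close-end _)
  segments zero (step _ _) ()
  segments (suc m) {x} {y} {ℓ} w le with ℓ ≤? λ′
  ... | yes short = whole (segment w short)
    where
    whole : (Σ[ d ∈ ℕ ] (Chain INF A x y d × M * d ≤ (M + μ′) * ℓ + M * c′)) ⊎ (bad x × bad y) → Close x y ℓ (M * c′) ⊎ Split x y ℓ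
    whole (inj₁ (d , p , b)) = inj₁ (d , p , ≤-trans b (+-monoˡ-≤ (M * c′) (*-monoˡ-≤ ℓ (+-monoʳ-≤ M μ′≤μ))))
    whole (inj₂ (bx , by))   = inj₂ (cutAt (close-end 0) here bx w by (close-end _) (+-identityʳ ℓ))
  ... | no long = go (split λ′ (<⇒≤ (≰⇒> long)) w)
    where
    total : λ′ + (ℓ ∸ λ′) ≡ ℓ
    total = m+[n∸m]≡n (<⇒≤ (≰⇒> long))
    go : (∃ λ z → Walk G x z λ′ × Walk G z y (ℓ ∸ λ′)) → Close x y ℓ (M * c′) ⊎ Split x y ℓ
    go (z , w₁ , w₂) = join (segment w₁ ≤-refl) (segments m w₂ (≤-trans (∸-monoˡ-≤ λ′ le) (≤-reflexive (m+n∸m≡n λ′ (m * λ′)))))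
      where
      join : (Σ[ d ∈ ℕ ] (Chain INF A x z d × M * d ≤ (M + μ′) * λ′ + M * c′)) ⊎ (bad x × bad z) →
        Close z y (ℓ ∸ λ′) (M * c′) ⊎ Split z y (ℓ ∸ λ′) → Close x y ℓ (M * c′) ⊎ Split x y ℓ
      join (inj₁ (d , p , b)) rest = with-rest (d , p , ≤-trans b (≤-trans slope (≤-reflexive (sym (+-identityʳ _))))) rest
        where
        with-rest : Close x z λ′ 0 → Close z y (ℓ ∸ λ′) (M * c′) ⊎ Split z y (ℓ ∸ λ′) → Close x y ℓ (M * c′) ⊎ Split x y ℓ
        with-rest first (inj₁ c) = inj₁ (subst (λ l → Close x y l (M * c′)) total (close-++ first c))
        with-rest first (inj₂ (cutAt {ℓ₁ = ℓ₁} {ℓ₂} {ℓ₃} l before bu mid bu′ r e)) = inj₂ (cutAt (close-++ first l) (w₁ ◅◅ before) bu mid bu′ r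
          (trans (assoc λ′ ℓ₁ ℓ₂ ℓ₃) (trans (cong (λ′ +_) e) total)))
          where
          assoc : ∀ a b c d → a + b + c + d ≡ a + (b + c + d)
          assoc = solve-∀
      join (inj₂ (bx , bz)) (inj₁ c) = inj₂ (cutAt (close-end 0) here bx w₁ bz c total)
      join (inj₂ (bx , bz)) (inj₂ (cutAt {ℓ₁ = ℓ₁} {ℓ₂} {ℓ₃} l before bu mid bu′ r e)) =
        inj₂ (cutAt (close-end 0) here bx (w₁ ◅◅ (before ◅◅ mid)) bu′ r (trans (+-assoc λ′ (ℓ₁ + ℓ₂) ℓ₃) (trans (cong (λ′ +_) e) total)))

-- Level i works at the scale λᵢ = ρ ^ i.  A vertex of level i either passes to level
-- i + 1 at distance 4λᵢ, or is joined to all vertices of level i within distance 2λᵢ.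

module Stretch {N INF : ℕ} (G : Graph N) (A : Fin N → Fin N → ℕ) (S : ℕ → Fin N → Bool) (e r : ℕ) (1≤e : 1 ≤ e) (1≤r : 1 ≤ r)
  (A-sym : ∀ x y → A x y ≡ A y x)
  (A-sound : ∀ x y → A x y < INF → Σ[ ℓ ∈ ℕ ] (ℓ ≤ A x y × Walk G x y ℓ)) where

  open Walks G
  open Chains {N} {INF} {A}

  -- Slopes are fractions over M. The relative error 1/(4e) of exploration costs r units and each
  -- level one more. As `ρ = 64 M`, the additive error `64 * ρ ^ i` of a level is exactly one unit
  -- at the next scale.
  ρ M : ℕ
  ρ = 256 * (e * r)
  M = 4 * (e * r)

  Joined : ℕ → Fin N → Set
  Joined i v = ∀ {u z} → S i u ≡ true → Walk G v u z → z ≤ 2 * ρ ^ i →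
    Σ[ d ∈ ℕ ] (Chain INF A v u d × 4 * e * d ≤ (4 * e + 1) * z)

  Raised : ℕ → Fin N → ℕ → Set
  Raised i v b = Σ[ p ∈ Fin N ] (S (suc i) p ≡ true × Σ[ w ∈ ℕ ] (Chain INF A v p w × w ≤ b))

  module Analysis
    (S₀ : ∀ v → S 0 v ≡ true)
    (levels : ∀ i → i < r → ∀ v → S i v ≡ true → Raised i v (4 * ρ ^ i) ⊎ Joined i v)
    (last : ∀ v → S r v ≡ true → Joined r v) where

    chain-sound : ∀ {x y w} → Chain INF A x y w → Σ[ ℓ ∈ ℕ ] (ℓ ≤ w × Walk G x y ℓ)
    chain-sound end = 0 , z≤n , here
    chain-sound (link {x} y lt p) = let a , a≤ , u = A-sound x y lt
                                        b , b≤ , v = chain-sound p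
                                    in  a + b , +-mono-≤ a≤ b≤ , (u ◅◅ v)

    additive : ℕ → ℕ
    additive zero    = 0
    additive (suc i) = 64 * ρ ^ i

    Short : ℕ → Fin N → Fin N → ℕ → Set
    Short i x y ℓ = Σ[ w ∈ ℕ ] (Chain INF A x y w × M * w ≤ (M + (r + i)) * ℓ + M * additive i)

    Up : ℕ → Fin N → Set
    Up i x = i < r × Raised i x (8 * ρ ^ i)

    Claim : ℕ → Set
    Claim i = ∀ {x y ℓ} → Walk G x y ℓ → ℓ ≤ ρ ^ i → Short i x y ℓ ⊎ (Up i x × Up i y)

    level : ∀ i → i ≤ r → ∀ v → S i v ≡ true → (i < r × Raised i v (4 * ρ ^ i)) ⊎ Joined i v
    level i i≤r v Sv = [ (λ i<r → [ (λ u → inj₁ (i<r , u)) , inj₂ ]′ (levels i i<r v Sv))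
                       , (λ i≡r → inj₂ (subst (λ j → Joined j v) (sym i≡r) (last v (subst (λ j → S j v ≡ true) i≡r Sv)))) ]′ (m≤n⇒m<n∨m≡n i≤r)

    1≤er : 1 ≤ e * r
    1≤er = *-mono-≤ 1≤e 1≤r

    256≤ρ : 256 ≤ ρ
    256≤ρ = ≤-trans (≤-reflexive (sym (*-identityʳ 256))) (*-monoʳ-≤ 256 1≤er)

    r≤M : 4 * r ≤ M
    r≤M = *-monoʳ-≤ 4 (≤-trans (≤-reflexive (sym (*-identityˡ r))) (*-monoˡ-≤ r 1≤e))

    -- M d ≤ (M + r) z is the bound 4 e d ≤ (4 e + 1) z scaled by r.
    scaled : ∀ {d z} → 4 * e * d ≤ (4 * e + 1) * z → M * d ≤ (M + r) * z
    scaled {d} {z} b = ≤-trans (≤-reflexive (left e r d)) (≤-trans (*-monoʳ-≤ r b) (≤-reflexive (right e r z)))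
      where
      left : ∀ e r d → 4 * (e * r) * d ≡ r * (4 * e * d)
      left = solve-∀
      right : ∀ e r z → r * ((4 * e + 1) * z) ≡ (4 * (e * r) + r) * z
      right = solve-∀

    ≤-of-scaled : ∀ {w x} → M * w ≤ M * x → w ≤ x
    ≤-of-scaled = *-cancelˡ-≤ M {{ℕ.>-nonZero (≤-trans (s≤s z≤n) (≤-trans (*-monoʳ-≤ 4 1≤er) ≤-refl))}}

    base : Claim 0
    base {x} {y} {ℓ} w ℓ≤ = go (level 0 z≤n x (S₀ x)) (level 0 z≤n y (S₀ y))
      where
      go : (0 < r × Raised 0 x (4 * ρ ^ 0)) ⊎ Joined 0 x → (0 < r × Raised 0 y (4 * ρ ^ 0)) ⊎ Joined 0 y → Short 0 x y ℓ ⊎ (Up 0 x × Up 0 y)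
      go (inj₂ j) _ = inj₁ (let d , p , b = j (S₀ y) w (≤-trans ℓ≤ (m≤n*m 1 2)) in
        d , p , ≤-trans (scaled b) (≤-trans (*-monoˡ-≤ ℓ (+-monoʳ-≤ M (m≤m+n r 0))) (m≤m+n _ _)))
      go (inj₁ _) (inj₂ j) = inj₁ (let d , p , b = j (S₀ x) (reverse w) (≤-trans ℓ≤ (m≤n*m 1 2)) in
        d , flip A-sym p , ≤-trans (scaled b) (≤-trans (*-monoˡ-≤ ℓ (+-monoʳ-≤ M (m≤m+n r 0))) (m≤m+n _ _)))
      go (inj₁ (lt , p , Sp , d , c , le)) (inj₁ (lt′ , p′ , Sp′ , d′ , c′ , le′)) =
        inj₂ ((lt , p , Sp , d , c , ≤-trans le (m≤m+n 4 4)) , (lt′ , p′ , Sp′ , d′ , c′ , ≤-trans le′ (m≤m+n 4 4)))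

    additive≤ : ∀ i → M * additive i ≤ ρ ^ i
    additive≤ zero    = ≤-trans (≤-reflexive (*-zeroʳ M)) z≤n
    additive≤ (suc i) = ≤-reflexive (grow e r (ρ ^ i))
      where
      grow : ∀ e r x → 4 * (e * r) * (64 * x) ≡ 256 * (e * r) * x
      grow = solve-∀

    additive≤ρ : ∀ i → additive i ≤ ρ ^ i
    additive≤ρ i = ≤-trans (≤-trans (≤-reflexive (sym (*-identityˡ _))) (*-monoˡ-≤ (additive i) (≤-trans 1≤er (m≤n*m (e * r) 4)))) (additive≤ i)

    slope : ∀ i → (M + (r + i)) * ρ ^ i + M * additive i ≤ (M + (r + suc i)) * ρ ^ i
    slope i = ≤-trans (+-monoʳ-≤ _ (additive≤ i)) (≤-reflexive (more M r i (ρ ^ i)))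
      where
      more : ∀ m r i x → (m + (r + i)) * x + x ≡ (m + (r + suc i)) * x
      more = solve-∀

    module Next (i : ℕ) (i<r : suc i ≤ r) (claim : Claim i) where

      open Segments {N} {INF} G A (Up i) (ρ ^ i) M (r + i) (r + suc i) (additive i) (slope i) (+-monoʳ-≤ r (n≤1+n i)) claim

      λ₀ λ₁ : ℕ
      λ₀ = ρ ^ i
      λ₁ = ρ * λ₀

      μ≤M : r + suc i ≤ M
      μ≤M = ≤-trans (+-monoʳ-≤ r i<r) (≤-trans (≤-trans (m≤m+n (r + r) (r + r)) (≤-reflexive (quad r))) r≤M)
        where
        quad : ∀ r → r + r + (r + r) ≡ 4 * r
        quad = solve-∀

      16λ₀≤λ₁ : 16 * λ₀ ≤ λ₁
      16λ₀≤λ₁ = *-monoˡ-≤ λ₀ (≤-trans (m≤m+n 16 240) 256≤ρ)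

      crude : ∀ {w ℓ c} → M * w ≤ (M + (r + suc i)) * ℓ + M * c → w ≤ 2 * ℓ + c
      crude {w} {ℓ} {c} b = ≤-of-scaled (≤-trans b (≤-trans (+-monoˡ-≤ (M * c) (*-monoˡ-≤ ℓ (+-monoʳ-≤ M μ≤M))) (≤-reflexive (twice M ℓ c))))
        where
        twice : ∀ m l c → (m + m) * l + m * c ≡ m * (2 * l + c)
        twice = solve-∀

      next : Claim (suc i)
      next {x} {y} {ℓ} w ℓ≤ = [ whole , broken ]′ (segments ρ w ℓ≤)
        where
        whole : Close x y ℓ (M * additive i) → Short (suc i) x y ℓ ⊎ (Up (suc i) x × Up (suc i) y)
        whole (d , p , b) = inj₁ (d , p , ≤-trans b (+-monoʳ-≤ _ (*-monoʳ-≤ M (≤-trans (additive≤ρ i) (m≤n*m λ₀ 64)))))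
        broken : Segments.Split {N} {INF} G A (Up i) (ρ ^ i) M (r + i) (r + suc i) (additive i) (slope i) (+-monoʳ-≤ r (n≤1+n i)) claim x y ℓ →
          Short (suc i) x y ℓ ⊎ (Up (suc i) x × Up (suc i) y)
        broken (cutAt {u} {u′} {ℓ₁} {ℓ₂} {ℓ₃} (w₁ , p₁ , b₁) before (_ , s , Ss , a , pa , a≤) mid (_ , s′ , Ss′ , a′ , pa′ , a′≤) (w₃ , p₃ , b₃) len) =
          go (level (suc i) i<r s Ss) (level (suc i) i<r s′ Ss′)
          where
          ℓ₁≤ : ℓ₁ ≤ λ₁
          ℓ₁≤ = ≤-trans (≤-trans (≤-trans (m≤m+n ℓ₁ ℓ₂) (m≤m+n _ ℓ₃)) (≤-reflexive len)) ℓ≤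
          ℓ₂≤ : ℓ₂ ≤ λ₁
          ℓ₂≤ = ≤-trans (≤-trans (≤-trans (m≤n+m ℓ₂ ℓ₁) (m≤m+n _ ℓ₃)) (≤-reflexive len)) ℓ≤
          ℓ₃≤ : ℓ₃ ≤ λ₁
          ℓ₃≤ = ≤-trans (≤-trans (m≤n+m ℓ₃ _) (≤-reflexive len)) ℓ≤
          across : Σ[ z ∈ ℕ ] (z ≤ ℓ₂ + 16 * λ₀ × Walk G s s′ z)
          across = let g , g≤ , v  = chain-sound pa
                       g′ , g′≤ , v′ = chain-sound pa′
                   in  g + (ℓ₂ + g′) , ≤-trans (+-mono-≤ (≤-trans g≤ a≤) (+-monoʳ-≤ ℓ₂ (≤-trans g′≤ a′≤))) (≤-reflexive (sixteen ℓ₂ λ₀)) ,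
                       (reverse v ◅◅ (mid ◅◅ v′))
            where
            sixteen : ∀ b x → 8 * x + (b + 8 * x) ≡ b + 16 * x
            sixteen = solve-∀
          across≤ : proj₁ across ≤ 2 * λ₁
          across≤ = ≤-trans (proj₁ (proj₂ across)) (≤-trans (+-mono-≤ ℓ₂≤ 16λ₀≤λ₁) (≤-reflexive (double λ₁)))
            where
            double : ∀ x → x + x ≡ 2 * x
            double = solve-∀
          -- The additive error collects λ₀ from `additive i`, 16λ₀ for the two climbs, and 32λ₀
          -- because the bridged walk is longer than ℓ₂ by 16λ₀ at slope at most 2; the sum 49 is
          -- rounded up to 64.
          bridged : ∀ {d} → Chain INF A s s′ d → 4 * e * d ≤ (4 * e + 1) * proj₁ across → Short (suc i) x y ℓ
          bridged {d} p b = w₁ + (a + (d + (a′ + w₃))) , (p₁ ▻ (pa ▻ (p ▻ (flip A-sym pa′ ▻ p₃)))) , (begin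
            M * (w₁ + (a + (d + (a′ + w₃))))
              ≡⟨ distribute M w₁ a d a′ w₃ ⟩
            M * w₁ + M * w₃ + M * d + M * (a + a′)
              ≤⟨ +-mono-≤ (+-mono-≤ (+-mono-≤ b₁ b₃) middle) (*-monoʳ-≤ M (+-mono-≤ a≤ a′≤)) ⟩
            F * ℓ₁ + 0 + (F * ℓ₃ + M * additive i) + (F * ℓ₂ + M * (32 * λ₀)) + M * (8 * λ₀ + 8 * λ₀)
              ≡⟨ collect F ℓ₁ ℓ₂ ℓ₃ M (additive i) λ₀ ⟩
            F * (ℓ₁ + ℓ₂ + ℓ₃) + M * (additive i + 48 * λ₀)
              ≤⟨ +-mono-≤ (≤-reflexive (cong (F *_) len)) (*-monoʳ-≤ M (≤-trans (+-monoˡ-≤ (48 * λ₀) (additive≤ρ i)) (≤-trans (≤-reflexive (plus λ₀)) (*-monoˡ-≤ λ₀ (m≤m+n 49 15))))) ⟩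
            F * ℓ + M * (64 * λ₀) ∎)
            where
            open ≤-Reasoning
            F = M + (r + suc i)
            plus : ∀ x → x + 48 * x ≡ 49 * x
            plus = solve-∀
            distribute : ∀ m a b c d f → m * (a + (b + (c + (d + f)))) ≡ m * a + m * f + m * c + m * (b + d)
            distribute = solve-∀
            collect : ∀ f a b c m g x → f * a + 0 + (f * c + m * g) + (f * b + m * (32 * x)) + m * (8 * x + 8 * x) ≡ f * (a + b + c) + m * (g + 48 * x)
            collect = solve-∀
            middle : M * d ≤ F * ℓ₂ + M * (32 * λ₀)
            middle = ≤-trans (scaled b) (≤-trans (*-mono-≤ (+-monoʳ-≤ M (m≤m+n r (suc i))) (proj₁ (proj₂ across)))
              (≤-trans (≤-reflexive (*-distribˡ-+ F ℓ₂ (16 * λ₀))) (+-monoʳ-≤ (F * ℓ₂) (≤-trans (*-monoˡ-≤ (16 * λ₀) (+-monoʳ-≤ M μ≤M)) (≤-reflexive (doubled M λ₀))))))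
              where
              doubled : ∀ m x → (m + m) * (16 * x) ≡ m * (32 * x)
              doubled = solve-∀
          -- From the end of the walk to a bad vertex, up one level, then up another: 2λ₁ + λ₀ + 8λ₀
          -- + 4λ₁ is at most 8λ₁, which fixes the factor 8 in `Up`.
          raise : ∀ {v u t ℓ′ c} → Chain INF A v u t → t ≤ 2 * ℓ′ + c → ℓ′ ≤ λ₁ → c ≤ λ₀ → ∀ {s b} → Chain INF A u s b → b ≤ 8 * λ₀ →
            suc i < r × Raised (suc i) s (4 * λ₁) → Up (suc i) v
          raise {t = t} {ℓ′} {c} p t≤ ℓ′≤ c≤ {b = b} pb b≤ (lt , q , Sq , d , pd , d≤) = lt , q , Sq , t + (b + d) , (p ▻ (pb ▻ pd)) , (begin
            t + (b + d)                               ≤⟨ +-mono-≤ (≤-trans t≤ (+-mono-≤ (*-monoʳ-≤ 2 ℓ′≤) c≤)) (+-mono-≤ b≤ d≤) ⟩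
            2 * λ₁ + λ₀ + (8 * λ₀ + 4 * λ₁)           ≡⟨ sort λ₁ λ₀ ⟩
            6 * λ₁ + 9 * λ₀                           ≤⟨ +-monoʳ-≤ (6 * λ₁) (≤-trans (*-monoˡ-≤ λ₀ (m≤m+n 9 7)) (≤-trans 16λ₀≤λ₁ (m≤n*m λ₁ 2))) ⟩
            6 * λ₁ + 2 * λ₁                           ≡⟨ eight λ₁ ⟩
            8 * λ₁                                    ∎)
            where
            open ≤-Reasoning
            sort : ∀ x y → 2 * x + y + (8 * y + 4 * x) ≡ 6 * x + 9 * y
            sort = solve-∀
            eight : ∀ x → 6 * x + 2 * x ≡ 8 * x
            eight = solve-∀
          go : (suc i < r × Raised (suc i) s (4 * λ₁)) ⊎ Joined (suc i) s → (suc i < r × Raised (suc i) s′ (4 * λ₁)) ⊎ Joined (suc i) s′ →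
            Short (suc i) x y ℓ ⊎ (Up (suc i) x × Up (suc i) y)
          go (inj₂ j) _ = inj₁ (let _ , p , b = j Ss′ (proj₂ (proj₂ across)) across≤ in bridged p b)
          go (inj₁ _) (inj₂ j) = inj₁ (let _ , p , b = j Ss (reverse (proj₂ (proj₂ across))) across≤ in bridged (flip A-sym p) b)
          go (inj₁ up) (inj₁ up′) = inj₂
            ( raise p₁ (crude {c = 0} (≤-trans b₁ (+-monoʳ-≤ _ z≤n))) ℓ₁≤ z≤n pa a≤ up
            , raise (flip A-sym p₃) (crude b₃) ℓ₃≤ (additive≤ρ i) pa′ a′≤ up′ )

    claims : ∀ i → i ≤ r → Claim i
    claims zero    _  = base
    claims (suc i) le = Next.next i le (claims i (<⇒≤ le))

    -- Nothing passes beyond level r, so one more cutting at scale `ρ ^ r`, with no bad vertices,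
    -- treats walks of any length. The final numerator is `2r + 1 ≤ 4r`, and 4r/M = 1/e.
    stretch : ∀ {x y ℓ} → Walk G x y ℓ → Σ[ w ∈ ℕ ] (Chain INF A x y w × e * w ≤ (e + 1) * ℓ + e * (64 * ρ ^ (r ∸ 1)))
    stretch {x} {y} {ℓ} w = finish (Sg.segments ℓ w (≤-trans (≤-reflexive (sym (*-identityʳ ℓ))) (*-monoʳ-≤ ℓ 1≤ρʳ)))
      where
      1≤ρʳ : 1 ≤ ρ ^ r
      1≤ρʳ = m^n>0 ρ {{ℕ.>-nonZero (≤-trans (s≤s z≤n) 256≤ρ)}} r
      top : ∀ {x y ℓ} → Walk G x y ℓ → ℓ ≤ ρ ^ r → Short r x y ℓ ⊎ (⊥ × ⊥)
      top w le = [ inj₁ , (λ (up , _) → ⊥-elim (<-irrefl refl (proj₁ up))) ]′ (claims r ≤-refl w le)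
      module Sg = Segments {N} {INF} G A (λ _ → ⊥) (ρ ^ r) M (r + r) (r + suc r) (additive r) (slope r) (+-monoʳ-≤ r (n≤1+n r)) top
      additive-r : additive r ≡ 64 * ρ ^ (r ∸ 1)
      additive-r = go r 1≤r
        where
        go : ∀ r → 1 ≤ r → additive r ≡ 64 * ρ ^ (r ∸ 1)
        go (suc r) _ = refl
      4r : r + suc r ≤ 4 * r
      4r = ≤-trans (≤-reflexive (+-suc r r)) (≤-trans (+-monoˡ-≤ (r + r) 1≤r) (≤-trans (m≤m+n _ r) (≤-reflexive (quad r))))
        where
        quad : ∀ r → r + (r + r) + r ≡ 4 * r
        quad = solve-∀
      finish : Sg.Close x y ℓ (M * additive r) ⊎ Sg.Split x y ℓ → _
      finish (inj₂ (Sg.cutAt _ _ () _ _ _ _))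
      finish (inj₁ (d , p , b)) = d , p , *-cancelˡ-≤ (4 * r) {{ℕ.>-nonZero (≤-trans 1≤r (m≤n*m r 4))}} (begin
        4 * r * (e * d)                                          ≡⟨ left e r d ⟩
        M * d                                                    ≤⟨ b ⟩
        (M + (r + suc r)) * ℓ + M * additive r                   ≤⟨ +-mono-≤ (*-monoˡ-≤ ℓ (+-monoʳ-≤ M 4r)) (≤-reflexive (cong (M *_) additive-r)) ⟩
        (M + 4 * r) * ℓ + M * (64 * ρ ^ (r ∸ 1))                 ≡⟨ right e r ℓ (64 * ρ ^ (r ∸ 1)) ⟩
        4 * r * ((e + 1) * ℓ + e * (64 * ρ ^ (r ∸ 1)))           ∎)
        where
        open ≤-Reasoning
        left : ∀ e r d → 4 * r * (e * d) ≡ 4 * (e * r) * d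
        left = solve-∀
        right : ∀ e r l c → (4 * (e * r) + 4 * r) * l + 4 * (e * r) * c ≡ 4 * r * ((e + 1) * l + e * c)
        right = solve-∀

-- Routing and the sparse min-plus product

greatest-cong : ∀ (m : ℕ) {P Q : ℕ → Bool} → (∀ i → P i ≡ Q i) → greatest m P ≡ greatest m Q
greatest-cong zero    e = refl
greatest-cong (suc m) {P} {Q} e rewrite e (suc m) with Q (suc m)
... | true  = refl
... | false = greatest-cong m e

%-absorbˡ : ∀ a b n .{{_ : NonZero n}} → (a % n + b) % n ≡ (a + b) % n
%-absorbˡ a b n = trans (%-distribˡ-+ (a % n) b n)
  (trans (cong (λ z → (z + b % n) % n) (m%n%n≡m%n a n)) (sym (%-distribˡ-+ a b n)))

module Latin (q : ℕ) .{{_ : NonZero q}} where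

  lat : Fin q → Fin q → Fin q
  lat i j = fromℕ< (m%n<n (toℕ i + toℕ j) q)

  unlat : Fin q → Fin q → Fin q
  unlat f j = fromℕ< (m%n<n (toℕ f + (q ∸ toℕ j)) q)

  unlat-lat : ∀ i j → unlat (lat i j) j ≡ i
  unlat-lat i j = Fin.toℕ-injective (begin
    toℕ (unlat (lat i j) j)                          ≡⟨ Fin.toℕ-fromℕ< _ ⟩
    (toℕ (lat i j) + (q ∸ toℕ j)) % q                ≡⟨ cong (λ z → (z + (q ∸ toℕ j)) % q) (Fin.toℕ-fromℕ< _) ⟩
    ((toℕ i + toℕ j) % q + (q ∸ toℕ j)) % q          ≡⟨ %-absorbˡ (toℕ i + toℕ j) (q ∸ toℕ j) q ⟩
    (toℕ i + toℕ j + (q ∸ toℕ j)) % q                ≡⟨ cong (_% q) (+-assoc (toℕ i) (toℕ j) _) ⟩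
    (toℕ i + (toℕ j + (q ∸ toℕ j))) % q              ≡⟨ cong (λ z → (toℕ i + z) % q) (m+[n∸m]≡n (<⇒≤ (Fin.toℕ<n j))) ⟩
    (toℕ i + q) % q                                  ≡⟨ [m+n]%n≡m%n (toℕ i) q ⟩
    toℕ i % q                                        ≡⟨ m<n⇒m%n≡m (Fin.toℕ<n i) ⟩
    toℕ i                                            ∎)
    where open ≡-Reasoning

  lat-comm : ∀ i j → lat i j ≡ lat j i
  lat-comm i j = Fin.fromℕ<-cong _ _ (cong (_% q) (+-comm (toℕ i) (toℕ j))) _ _

  unlat-lat′ : ∀ i j → unlat (lat i j) i ≡ j
  unlat-lat′ i j = trans (cong (λ z → unlat z i) (lat-comm i j)) (unlat-lat j i)

module Network (q K′ INF W L : ℕ) .{{_ : NonZero q}} .{{_ : NonZero W}} (slotW : INF * (q * q) < W)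
  (N≡2^L : q * q ≡ 2 ^ L) (costW : q * q * (q * q * (q * q + q * q)) < W) (gatherW : q * q * suc K′ < W)
  (pairW : q * q * (q * q) < W) (1<INF : 1 < INF) (18≤K : 18 ≤ suc K′) where

  N K k : ℕ
  N = q * q
  K = suc K′
  k = q * K

  instance
    N≢0 : NonZero N
    N≢0 = m*n≢0 q q

  open Latin q public
  open Programs N K W public
  open Tables N k INF public

  INF<W : INF < W
  INF<W = ≤-<-trans (m≤m*n INF N) slotW

  cut-cong : ∀ {f g} → (∀ u → f u ≡ g u) → ∀ u → cut f u ≡ cut g u
  cut-cong {f} {g} e u = cong₂ (λ b d → if b then d else INF)
    (cong₂ (λ x y → does (x <? y)) (key-cong u) threshold-cong) (e u)
    where
    key-cong : ∀ u → key f u ≡ key g u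
    key-cong u = cong (λ d → d * N + toℕ u) (e u)
    threshold-cong : threshold f ≡ threshold g
    threshold-cong = greatest-cong (INF * N) λ θ →
      cong (λ c → does (c ≤? k)) (∑-cong λ u → cong (λ x → 𝟙 (does (x <? θ))) (key-cong u))

  clip-id : ∀ m → (∀ j → lookup m j < W) → clip m ≡ m
  clip-id m b = trans (Vec.tabulate-cong (λ j → m<n⇒m%n≡m (b j))) (Vec.tabulate∘lookup m)

  deliver-id : ∀ f → (∀ u j → lookup (f u) j < W) → ∀ u → deliver f u ≡ f u
  deliver-id f b u = trans (Vec.lookup∘tabulate (λ u → clip (f u)) u) (clip-id (f u) (b u))

  single : ℕ → Msg
  single x = replicate K x

  single< : ∀ {x} → x < W → ∀ j → lookup (single x) j < W
  single< {x} lt j = ≤-<-trans (≤-reflexive (Vec.lookup-replicate j x)) lt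

  value : Msg → ℕ
  value m = lookup m zero

  opaque
    -- Message m of every vertex goes to relay m, which then passes to v the message of the source
    -- `σ m v`. The pattern σ is common knowledge, so no addresses are sent.
    relay : (Fin N → Fin N → Fin N) → Prog (Fin N → Msg) (Fin N → Msg)
    relay σ = xch (λ _ x → x) (λ _ _ r → r) >>> xch (λ m r v → r (σ m v)) (λ _ _ r → r)

    relay-rounds : ∀ σ → rounds (relay σ) ≡ 2
    relay-rounds σ = refl

    relay-spec : ∀ σ x → (∀ u m j → lookup (x u m) j < W) → ∀ v m → exec (relay σ) x v m ≡ x (σ m v) m
    relay-spec σ x b v m = trans (deliver-id (λ m′ → deliver (λ u → x u m′) (σ m′ v)) bound m) (first m (σ m v))
      where
      first : ∀ m u → deliver (λ u → x u m) u ≡ x u m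
      first m u = deliver-id (λ u → x u m) (λ u → b u m) u
      bound : ∀ m′ j → lookup (deliver (λ u → x u m′) (σ m′ v)) j < W
      bound m′ j = ≤-<-trans (≤-reflexive (cong (λ z → lookup z j) (first m′ (σ m′ v)))) (b (σ m′ v) m′ j)

  d₁ d₂ : Fin N → Fin q
  d₁ x = proj₁ (remQuot {q} q x)
  d₂ x = proj₂ (remQuot {q} q x)

  d₁-combine : ∀ i j → d₁ (combine i j) ≡ i
  d₁-combine i j = cong proj₁ (Fin.remQuot-combine {q} {q} i j)

  d₂-combine : ∀ i j → d₂ (combine i j) ≡ j
  d₂-combine i j = cong proj₂ (Fin.remQuot-combine {q} {q} i j)

  combine-d : ∀ x → combine (d₁ x) (d₂ x) ≡ x
  combine-d x = Fin.combine-remQuot {q} q x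

  chunk : Table → Fin q → Msg
  chunk f s = tabulate λ j → slot f (toℕ (combine {q} {K} s j))

  chunk< : ∀ f s j → lookup (chunk f s) j < W
  chunk< f s j = ≤-<-trans (≤-reflexive (Vec.lookup∘tabulate (λ j → slot f (toℕ (combine {q} {K} s j))) j)) (≤-<-trans (slot≤ f (toℕ (combine {q} {K} s j))) slotW)

  unchunk : (Fin q → Msg) → Table
  unchunk r = decode {k} λ e → lookup (r (proj₁ (remQuot {q} K e))) (proj₂ (remQuot {q} K e))

  unchunk-chunk : ∀ f r → (∀ u → f u ≤ INF) → size f ≤ k → (∀ s → r s ≡ chunk f s) → ∀ u → unchunk r u ≡ f u
  unchunk-chunk f r b sz e u = trans (decode-cong same u) (decode-slots {k} f b sz u)
    where
    same : ∀ i → lookup (r (proj₁ (remQuot {q} K i))) (proj₂ (remQuot {q} K i)) ≡ slot f (toℕ i)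
    same i = trans (cong (λ m → lookup m (proj₂ (remQuot {q} K i))) (e (proj₁ (remQuot {q} K i))))
      (trans (Vec.lookup∘tabulate (λ j → slot f (toℕ (combine {q} {K} (proj₁ (remQuot {q} K i)) j))) (proj₂ (remQuot {q} K i)))
        (cong (λ z → slot f (toℕ z)) (Fin.combine-remQuot {q} K i)))

  -- Worker (a , b) combines the rows of the vertices (· , a) with the lists of the
  -- vertices (b , ·).  Since both (· , y₂) for fixed (x₁ , a) and (x₁ , ·) for fixed
  -- (a , b) have to travel through distinct relays, the relays are addressed by a
  -- Latin square.

  partial : (Fin q → Fin q → ℕ) → (Fin q → Table) → Fin q → Table
  partial A L x₁ = cut λ u → minF INF λ y₂ → A x₁ y₂ + L y₂ u

  merge : (Fin q → Table) → Table
  merge P = cut λ u → minF INF λ b → P b u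

  minplus : Prog (Table × Table) Table
  minplus =
        -- Worker `(a , b)` learns the entries from `(x₁ , a)` to `(b , y₂)`, each through relay
        -- `(x₁ + b , y₂)`.
        lift (λ x s m → single (proj₁ s (combine (unlat (d₁ m) (d₁ x)) (d₂ m)))) (λ _ s r → proj₂ s , r)
             (relay (λ m v → combine (unlat (d₁ m) (d₂ v)) (d₁ v)))
    -- Worker `(a , b)` learns the lists of all `(b , y₂)`: q lists of q chunks use each of the N
    -- relays once, which is why a list has `k = q * K` entries.
    >>> lift (λ y s m → chunk (proj₁ s) (d₂ m)) (λ _ s r → proj₂ s , r)
             (relay (λ m v → combine (d₂ v) (d₁ m)))
    >>> ret (λ v s → partial (λ x₁ y₂ → value (proj₁ s (combine (lat x₁ (d₂ v)) y₂)))
                             (λ y₂ → unchunk λ t → proj₂ s (combine y₂ t)))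
    -- Vertex `(x₁ , x₂)` collects its partial results from the workers `(x₂ , b)`.
    >>> lift (λ v P m → chunk (P (unlat (d₁ m) (d₂ v))) (d₂ m)) (λ _ _ r → r)
             (relay (λ m v → combine (d₂ v) (unlat (d₁ m) (d₁ v))))
    >>> ret (λ v r → merge λ b → unchunk λ t → r (combine (lat (d₁ v) b) t))

  productT : (Fin N → Table) → (Fin N → Table) → Fin N → Table
  productT A L x = merge λ b → partial (λ x₁ y₂ → A (combine x₁ (d₂ x)) (combine b y₂)) (λ y₂ → L (combine b y₂)) (d₁ x)

  Listed : Table → Set
  Listed f = (∀ u → f u ≤ INF) × size f ≤ k

  cut-listed : ∀ f → (∀ u → f u ≤ INF) → Listed (cut f)
  cut-listed f b = cut≤ f b , size-cut f

  merge-listed : ∀ P → Listed (merge P)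
  merge-listed P = cut-listed (λ u → minF INF λ b → P b u) λ u → minF≤top INF λ b → P b u

  partial-listed : ∀ A L x → Listed (partial A L x)
  partial-listed A L x = cut-listed (λ u → minF INF λ y₂ → A x y₂ + L y₂ u) λ u → minF≤top INF λ y₂ → A x y₂ + L y₂ u

  productT-listed : ∀ A L x → Listed (productT A L x)
  productT-listed A L x = merge-listed λ b → partial (λ x₁ y₂ → A (combine x₁ (d₂ x)) (combine b y₂)) (λ y₂ → L (combine b y₂)) (d₁ x)

  minplus-spec : ∀ (s : Fin N → Table × Table) → (∀ x y → proj₁ (s x) y ≤ INF) → (∀ x → Listed (proj₂ (s x))) →
    ∀ x u → exec minplus s x u ≡ productT (proj₁ ∘ s) (proj₂ ∘ s) x u
  minplus-spec s A≤ L≤ x u = cut-cong (λ u → minF-cong INF (λ b → third b u)) u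
    where
    A = proj₁ ∘ s
    Lt = proj₂ ∘ s
    msg₁ : Fin N → Fin N → Msg
    msg₁ x m = single (A x (combine (unlat (d₁ m) (d₁ x)) (d₂ m)))
    σ₁ σ₂ σ₃ : Fin N → Fin N → Fin N
    σ₁ m v = combine (unlat (d₁ m) (d₂ v)) (d₁ v)
    σ₂ m v = combine (d₂ v) (d₁ m)
    σ₃ m v = combine (d₂ v) (unlat (d₁ m) (d₁ v))
    got₁ : ∀ v x₁ y₂ → value (exec (relay σ₁) msg₁ v (combine (lat x₁ (d₂ v)) y₂)) ≡ A (combine x₁ (d₁ v)) (combine (d₂ v) y₂)
    got₁ v x₁ y₂ = trans (cong value (relay-spec σ₁ msg₁ (λ u m → single< (≤-<-trans (A≤ u _) INF<W)) v (combine (lat x₁ (d₂ v)) y₂)))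
      (trans (Vec.lookup-replicate {n = K} zero _) entries≡)
      where
      entries≡ : A (σ₁ (combine (lat x₁ (d₂ v)) y₂) v)
                   (combine (unlat (d₁ (combine (lat x₁ (d₂ v)) y₂)) (d₁ (σ₁ (combine (lat x₁ (d₂ v)) y₂) v))) (d₂ (combine (lat x₁ (d₂ v)) y₂)))
               ≡ A (combine x₁ (d₁ v)) (combine (d₂ v) y₂)
      entries≡ rewrite d₁-combine (lat x₁ (d₂ v)) y₂ | d₂-combine (lat x₁ (d₂ v)) y₂ | unlat-lat x₁ (d₂ v)
                     | d₁-combine x₁ (d₁ v) | unlat-lat′ x₁ (d₂ v) = refl
    msg₂ : Fin N → Fin N → Msg
    msg₂ y m = chunk (Lt y) (d₂ m)
    got₂ : ∀ v y₂ u → unchunk (λ t → exec (relay σ₂) msg₂ v (combine y₂ t)) u ≡ Lt (combine (d₂ v) y₂) u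
    got₂ v y₂ u = unchunk-chunk (Lt (combine (d₂ v) y₂)) (λ t → exec (relay σ₂) msg₂ v (combine y₂ t))
      (proj₁ (L≤ (combine (d₂ v) y₂))) (proj₂ (L≤ (combine (d₂ v) y₂))) (λ t →
      trans (relay-spec σ₂ msg₂ (λ u m → chunk< (Lt u) (d₂ m)) v (combine y₂ t))
        (cong₂ (λ i j → chunk (Lt (combine (d₂ v) i)) j) (d₁-combine y₂ t) (d₂-combine y₂ t))) u
    A₁ : Fin N → Fin q → Fin q → ℕ
    A₁ v x₁ y₂ = value (exec (relay σ₁) msg₁ v (combine (lat x₁ (d₂ v)) y₂))
    L₁ : Fin N → Fin q → Table
    L₁ v y₂ = unchunk λ t → exec (relay σ₂) msg₂ v (combine y₂ t)
    P : Fin N → Fin q → Table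
    P v = partial (A₁ v) (L₁ v)
    P-spec : ∀ v x₁ u → P v x₁ u ≡
      partial (λ x₁ y₂ → A (combine x₁ (d₁ v)) (combine (d₂ v) y₂)) (λ y₂ → Lt (combine (d₂ v) y₂)) x₁ u
    P-spec v x₁ = cut-cong λ u → minF-cong INF λ y₂ → cong₂ _+_ (got₁ v x₁ y₂) (got₂ v y₂ u)
    send₃ : (Fin N → Fin q → Table) → Fin N → Fin N → Msg
    send₃ Q v m = chunk (Q v (unlat (d₁ m) (d₂ v))) (d₂ m)
    sent₃ : ∀ Q b t → send₃ Q (σ₃ (combine (lat (d₁ x) b) t) x) (combine (lat (d₁ x) b) t)
                    ≡ chunk (Q (combine (d₂ x) b) (d₁ x)) t
    sent₃ Q b t rewrite d₁-combine (lat (d₁ x) b) t | d₂-combine (lat (d₁ x) b) t | unlat-lat′ (d₁ x) b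
                      | d₂-combine (d₂ x) b | unlat-lat (d₁ x) b = refl
    msg₃ : Fin N → Fin N → Msg
    msg₃ = send₃ P
    third : ∀ b u → unchunk (λ t → exec (relay σ₃) msg₃ x (combine (lat (d₁ x) b) t)) u ≡
      partial (λ x₁ y₂ → A (combine x₁ (d₂ x)) (combine b y₂)) (λ y₂ → Lt (combine b y₂)) (d₁ x) u
    third b u = trans (unchunk-chunk (P w (d₁ x)) (λ t → exec (relay σ₃) msg₃ x (combine (lat (d₁ x) b) t))
                        (proj₁ (partial-listed (A₁ w) (L₁ w) (d₁ x))) (proj₂ (partial-listed (A₁ w) (L₁ w) (d₁ x))) chunk≡ u)
                      (trans (P-spec w (d₁ x) u) digits)
      where
      w = combine (d₂ x) b
      chunk≡ : ∀ t → exec (relay σ₃) msg₃ x (combine (lat (d₁ x) b) t) ≡ chunk (P w (d₁ x)) t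
      chunk≡ t = trans (relay-spec σ₃ msg₃ (λ v m → chunk< (P v (unlat (d₁ m) (d₂ v))) (d₂ m)) x (combine (lat (d₁ x) b) t)) (sent₃ P b t)
      digits : partial (λ x₁ y₂ → A (combine x₁ (d₁ w)) (combine (d₂ w) y₂)) (λ y₂ → Lt (combine (d₂ w) y₂)) (d₁ x) u
             ≡ partial (λ x₁ y₂ → A (combine x₁ (d₂ x)) (combine b y₂)) (λ y₂ → Lt (combine b y₂)) (d₁ x) u
      digits rewrite d₁-combine (d₂ x) b | d₂-combine (d₂ x) b = refl

  merge-sound : ∀ P u → merge P u < INF → ∃ λ b → P b u ≡ merge P u
  merge-sound P u lt with minF-attained INF (λ b → P b u) (subst (_< INF) (cut-sound (λ u → minF INF λ b → P b u) u lt) lt)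
  ... | b , e = b , trans e (sym (cut-sound (λ u → minF INF λ b → P b u) u lt))

  merge-good : ∀ P b u D → D < INF → Good (P b) u D → Good (merge P) u D
  merge-good P b u D lt g = Good-cut lt (Good-mono (λ v p → ≤-trans (minF≤ INF (λ b → P b v) b) p) g)

  productT-merge : (Fin N → Table) → (Fin N → Table) → Fin N → Fin q → Table
  productT-merge A L x b = merge λ y₂ u → A (combine (d₁ x) (d₂ x)) (combine b y₂) + L (combine b y₂) u

  product-sound : ∀ A L x u → productT A L x u < INF → ∃ λ y → A x y + L y u ≡ productT A L x u
  product-sound A L x u lt with merge-sound (productT-merge A L x) u lt
  ... | b , eb with merge-sound (λ y₂ u → A (combine (d₁ x) (d₂ x)) (combine b y₂) + L (combine b y₂) u) u (subst (_< INF) (sym eb) lt)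
  ...   | y₂ , ey = combine b y₂ ,
            trans (cong (λ z → A z (combine b y₂) + L (combine b y₂) u) (sym (combine-d x))) (trans ey eb)

  -- Both truncations, of the partial results and of their merger, preserve `Good`, so workers may
  -- truncate before they send.
  product-good : ∀ A L x y u D → A x y + D < INF → Good (L y) u D → Good (productT A L x) u (A x y + D)
  product-good A L x y u D lt g = merge-good (productT-merge A L x) (d₁ y) u _ lt
    (merge-good (λ y₂ u → A (combine (d₁ x) (d₂ x)) (combine (d₁ y) y₂) + L (combine (d₁ y) y₂) u) (d₂ y) u _ lt
      (Good-mono (λ v p → ≤-trans (≤-reflexive (cong₂ (λ x y → A x y + L y v) (combine-d x) (combine-d y))) (+-monoʳ-≤ (A x y) p)) g))

  minplus-rounds : rounds minplus ≡ 6
  minplus-rounds = cong₂ _+_ (relay-rounds _) (cong₂ _+_ (relay-rounds _) (cong (_+ 0) (relay-rounds _)))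

  opaque

    product : Prog (Table × Table) Table
    product = minplus

    product-spec : ∀ (s : Fin N → Table × Table) → (∀ x y → proj₁ (s x) y ≤ INF) → (∀ x → Listed (proj₂ (s x))) →
      ∀ x u → exec product s x u ≡ productT (proj₁ ∘ s) (proj₂ ∘ s) x u
    product-spec = minplus-spec

    product-rounds : rounds product ≡ 6
    product-rounds = minplus-rounds

  listed-cong : ∀ {f g} → (∀ u → g u ≡ f u) → Listed f → Listed g
  listed-cong {f} {g} e (b , sz) = (λ u → ≤-trans (≤-reflexive (e u)) (b u)) ,
    ≤-trans (≤-reflexive (∑-cong λ u → cong (λ d → 𝟙 (does (d <? INF))) (e u))) sz

  module Product (s : Fin N → Table × Table) (A≤ : ∀ x y → proj₁ (s x) y ≤ INF) (L≤ : ∀ x → Listed (proj₂ (s x))) where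

    listed : ∀ x → Listed (exec product s x)
    listed x = listed-cong (product-spec s A≤ L≤ x) (productT-listed (proj₁ ∘ s) (proj₂ ∘ s) x)

    sound : ∀ x u → exec product s x u < INF → ∃ λ y → proj₁ (s x) y + proj₂ (s y) u ≡ exec product s x u
    sound x u lt =
      let y , e = product-sound (proj₁ ∘ s) (proj₂ ∘ s) x u (subst (_< INF) (product-spec s A≤ L≤ x u) lt)
      in  y , trans e (sym (product-spec s A≤ L≤ x u))

    good : ∀ x y u D → proj₁ (s x) y + D < INF → Good (proj₂ (s y)) u D → Good (exec product s x) u (proj₁ (s x) y + D)
    good x y u D lt g = Good-mono (λ v p → ≤-trans (≤-reflexive (product-spec s A≤ L≤ x v)) p)
      (product-good (proj₁ ∘ s) (proj₂ ∘ s) x y u D lt g)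

  opaque
    explore : ℕ → Prog (Table × Table) Table
    explore zero    = ret λ _ → proj₂
    explore (suc h) = lift (λ _ s → s) (λ _ s L → proj₁ s , L) (explore h) >>> product

    explore-rounds : ∀ h → rounds (explore h) ≡ h * 6
    explore-rounds zero    = refl
    explore-rounds (suc h) = trans (cong₂ _+_ (explore-rounds h) product-rounds) (+-comm (h * 6) 6)

  module Explore (s : Fin N → Table × Table) (A≤ : ∀ x y → proj₁ (s x) y ≤ INF) (L≤ : ∀ x → Listed (proj₂ (s x))) where

    A : Fin N → Table
    A x = proj₁ (s x)

    opaque
      unfolding explore

      listed : ∀ h x → Listed (exec (explore h) s x)
      listed zero    x = L≤ x
      listed (suc h) x = Product.listed (λ v → A v , exec (explore h) s v) A≤ (listed h) x

      sound : (Φ : Fin N → Fin N → ℕ → Set) → (∀ x u → proj₂ (s x) u < INF → Φ x u (proj₂ (s x) u)) →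
        (∀ x y u d → A x y < INF → Φ y u d → Φ x u (A x y + d)) →
        ∀ h x u → exec (explore h) s x u < INF → Φ x u (exec (explore h) s x u)
      sound Φ base ext zero    x u lt = base x u lt
      sound Φ base ext (suc h) x u lt = extend (Product.sound (λ v → A v , exec (explore h) s v) A≤ (listed h) x u lt)
        where
        extend : (∃ λ y → A x y + exec (explore h) s y u ≡ exec (explore (suc h)) s x u) →
          Φ x u (exec (explore (suc h)) s x u)
        extend (y , e) = subst (Φ x u) e (ext x y u (exec (explore h) s y u) (≤-<-trans (m≤m+n (A x y) _) sum<)
                           (sound Φ base ext h y u (≤-<-trans (m≤n+m _ (A x y)) sum<)))
          where
          sum< : A x y + exec (explore h) s y u < INF
          sum< = subst (_< INF) (sym e) lt

      good : (∀ x → A x x ≡ 0) → ∀ h x y u d E → Hops A h x y d → Good (proj₂ (s y)) u E → d + E < INF →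
        Good (exec (explore h) s x) u (d + E)
      good A0 zero    x .x u .0 E stop      g lt = g
      -- Hops left over are spent on the self-loop of weight 0.
      good A0 (suc h) x .x u .0 E stop      g lt = subst (λ z → Good (exec (explore (suc h)) s x) u (z + E)) (A0 x)
        (Product.good (λ v → A v , exec (explore h) s v) A≤ (listed h) x x u E
          (subst (λ z → z + E < INF) (sym (A0 x)) lt) (good A0 h x x u 0 E stop g lt))
      good A0 (suc h) x z u ._ E (hop {d = d} y c) g lt = subst (Good (exec (explore (suc h)) s x) u) (sym (+-assoc (A x y) d E))
        (Product.good (λ v → A v , exec (explore h) s v) A≤ (listed h) x y u (d + E) lt′
          (good A0 h y z u d E c g (≤-<-trans (m≤n+m _ (A x y)) lt′)))
        where
        lt′ : A x y + (d + E) < INF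
        lt′ = subst (_< INF) (+-assoc (A x y) d E) lt

  -- Sources, symmetrisation, seed selection and broadcast

  point : Fin N → Table
  point x u = if does (u Fin.≟ x) then 0 else INF

  point-self : ∀ x → point x x ≡ 0
  point-self x = if-true (dec-true (x Fin.≟ x) refl)

  point≤ : ∀ x u → point x u ≤ INF
  point≤ x u with does (u Fin.≟ x)
  ... | true  = z≤n
  ... | false = ≤-refl

  point-only : ∀ x u → point x u < INF → u ≡ x
  point-only x u lt with bool? (does (u Fin.≟ x))
  ... | inj₁ e = holds (u Fin.≟ x) e
  ... | inj₂ e = ⊥-elim (<-irrefl (if-false e) lt)

  point-listed : ∀ x → Listed (point x)
  point-listed x = point≤ x , ≤-trans (count≤1 _ λ i j a b →
    trans (point-only x i (holds (point x i <? INF) a)) (sym (point-only x j (holds (point x j <? INF) b))))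
    (m≤n⇒m≤n*o K (ℕ.>-nonZero⁻¹ q))

  source : Bool → Fin N → Table
  source b x u = if b then point x u else INF

  source-listed : ∀ b x → Listed (source b x)
  source-listed true  x = point-listed x
  source-listed false x = (λ _ → ≤-refl) ,
    ≤-trans (≤-reflexive (count-none {N} (λ _ → does (INF <? INF)) λ _ → dec-false (INF <? INF) (<-irrefl refl))) z≤n

  looped : Fin N → Table → Table
  looped x f u = if does (u Fin.≟ x) then 0 else f u

  looped-self : ∀ x f → looped x f x ≡ 0
  looped-self x f = if-true (dec-true (x Fin.≟ x) refl)

  looped-≤ : ∀ x f u → looped x f u ≤ f u
  looped-≤ x f u with does (u Fin.≟ x)
  ... | true  = z≤n
  ... | false = ≤-refl

  looped-case : ∀ x f u → (u ≡ x × looped x f u ≡ 0) ⊎ (looped x f u ≡ f u)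
  looped-case x f u with bool? (does (u Fin.≟ x))
  ... | inj₁ e = inj₁ (holds (u Fin.≟ x) e , if-true e)
  ... | inj₂ e = inj₂ (if-false e)

  open Seeds N public

  origin : Fin N
  origin = fromℕ< (ℕ.>-nonZero⁻¹ N)

  received : ∀ (f : Fin N → Msg) (g : Fin N → ℕ) → (∀ u → g u < W) → (∀ u → f u ≡ single (g u)) → ∀ u → value (deliver f u) ≡ g u
  received f g b e u = trans (cong value (deliver-id f (λ u j → subst (λ m → lookup m j < W) (sym (e u)) (single< (b u) j)) u))
    (trans (cong value (e u)) (Vec.lookup-replicate {n = K} zero (g u)))

  opaque

    mirror : Prog Table Table
    mirror = xch (λ _ f u → single (f u)) (λ _ f m u → f u ⊓ value (m u))

    mirror-rounds : rounds mirror ≡ 1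
    mirror-rounds = refl

  opaque
    unfolding mirror

    mirror-spec : ∀ (f : Fin N → Table) → (∀ v u → f v u ≤ INF) → ∀ v u → exec mirror f v u ≡ f v u ⊓ f u v
    mirror-spec f b v u = cong (f v u ⊓_) (received _ (λ w → f w v) (λ w → ≤-<-trans (b w v) INF<W) (λ _ → refl) u)

  opaque

    notify : Prog (Fin N → Bool) Bool
    notify = xch (λ _ f u → single (𝟙 (f u))) (λ _ _ m → does (1 ≤? ∑ λ u → value (m u)))

    notify-rounds : rounds notify ≡ 1
    notify-rounds = refl

  1<W : 1 ≤ INF → 1 < W
  1<W le = ≤-<-trans le INF<W

  notify-total : 1 < W → ∀ (f : Fin N → Fin N → Bool) v →
    ∑ (λ u → value (deliver (λ u → single (𝟙 (f u v))) u)) ≡ count (λ u → f u v)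
  notify-total 1<W f v = ∑-cong λ u → received _ (λ u → 𝟙 (f u v)) (λ u → ≤-<-trans (𝟙≤1 (f u v)) 1<W) (λ _ → refl) u

  opaque
    unfolding notify

    notify-true : 1 < W → ∀ f v u → f u v ≡ true → exec notify f v ≡ true
    notify-true 1<W f v u e = dec-true (1 ≤? _) (≤-trans (count-positive (λ u → f u v) u e) (≤-reflexive (sym (notify-total 1<W f v))))

    notify-sound : 1 < W → ∀ f v → exec notify f v ≡ true → ∃ λ u → f u v ≡ true
    notify-sound 1<W f v e = [ id , (λ none → ⊥-elim (<-irrefl (sym (count-none (λ u → f u v) none))
      (≤-trans (holds (1 ≤? ∑ (λ u → value (deliver (λ u → single (𝟙 (f u v))) u))) e) (≤-reflexive (notify-total 1<W f v))))) ]′ (count-witness (λ u → f u v))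

  opaque

    -- Conditional expectations, half a seed at a time: vertex `s₁` totals the costs of all seeds
    -- that begin with `s₁`, everyone fixes the best first half, and the second half is found in the
    -- same way.
    select : Prog (Seed → ℕ) Seed
    select =
          xch (λ _ c s₁ → single (∑ λ s₂ → c (s₁ , s₂))) (λ _ c m → c , ∑ (λ u → value (m u)))
      >>> xch (λ _ st _ → single (proj₂ st)) (λ v st m → proj₁ st , argmin v (λ u → value (m u)))
      >>> xch (λ _ st s₂ → single (proj₁ st (proj₂ st , s₂))) (λ _ st m → proj₂ st , ∑ (λ u → value (m u)))
      >>> xch (λ _ st _ → single (proj₂ st)) (λ v st m → proj₁ st , argmin v (λ u → value (m u)))

    select-rounds : rounds select ≡ 4
    select-rounds = refl

  module Select (c : Fin N → Seed → ℕ) (b : ℕ) (c≤ : ∀ v s → c v s ≤ b) (fits : N * (N * b) < W) where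

    T₁ : Fin N → ℕ
    T₁ s₁ = ∑ λ v → ∑ λ s₂ → c v (s₁ , s₂)

    best₁ : Fin N
    best₁ = argmin origin T₁

    T₂ : Fin N → ℕ
    T₂ s₂ = ∑ λ v → c v (best₁ , s₂)

    chosen : Seed
    chosen = best₁ , argmin origin T₂

    row≤ : ∀ v s₁ → ∑ (λ s₂ → c v (s₁ , s₂)) ≤ N * b
    row≤ v s₁ = ∑≤ _ b λ s₂ → c≤ v (s₁ , s₂)

    N*b<W : N * b < W
    N*b<W = ≤-<-trans (m≤n*m (N * b) N) fits

    b<W : b < W
    b<W = ≤-<-trans (m≤n*m b N) N*b<W

    total₁ : ∀ s₁ → ∑ (λ u → value (deliver (λ v → single (∑ λ s₂ → c v (s₁ , s₂))) u)) ≡ T₁ s₁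
    total₁ s₁ = ∑-cong (received _ (λ v → ∑ λ s₂ → c v (s₁ , s₂)) (λ v → ≤-<-trans (row≤ v s₁) N*b<W) (λ _ → refl))

    T₁<W : ∀ s₁ → T₁ s₁ < W
    T₁<W s₁ = ≤-<-trans (∑≤ _ (N * b) λ v → row≤ v s₁) fits

    T₂<W : ∀ s₂ → T₂ s₂ < W
    T₂<W s₂ = ≤-<-trans (∑≤ _ b λ v → c≤ v (best₁ , s₂)) N*b<W

    pick₁ : Fin N → Fin N
    pick₁ v = argmin v λ u → value (deliver (λ s₁ → single (∑ (λ u → value (deliver (λ v → single (∑ λ s₂ → c v (s₁ , s₂))) u)))) u)

    pick₁≡ : ∀ v → pick₁ v ≡ best₁
    pick₁≡ v = argmin-cong v origin (received _ T₁ T₁<W (λ s₁ → cong single (total₁ s₁)))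

    total₂ : ∀ s₂ → ∑ (λ u → value (deliver (λ v → single (c v (pick₁ v , s₂))) u)) ≡ T₂ s₂
    total₂ s₂ = ∑-cong (received _ (λ v → c v (best₁ , s₂)) (λ v → ≤-<-trans (c≤ v _) b<W) (λ v → cong (λ z → single (c v (z , s₂))) (pick₁≡ v)))

    opaque
      unfolding select

      select-spec : ∀ v → exec select c v ≡ chosen
      select-spec v = cong₂ _,_ (pick₁≡ v) (argmin-cong v origin (received _ T₂ T₂<W (λ s₂ → cong single (total₂ s₂))))

    chosen-best : N * N * ∑ (λ v → c v chosen) ≤ ∑∑ (λ s → ∑ (λ v → c v s))
    chosen-best = begin
      N * N * ∑ (λ v → c v chosen)                      ≡⟨ *-assoc N N _ ⟩
      N * (N * T₂ (proj₂ chosen))                       ≤⟨ *-monoʳ-≤ N (argmin-average origin T₂) ⟩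
      N * ∑ T₂                                          ≡⟨ cong (N *_) (∑-swap (λ s₂ v → c v (best₁ , s₂))) ⟩
      N * T₁ best₁                                      ≤⟨ argmin-average origin T₁ ⟩
      ∑ T₁                                              ≡⟨ ∑-cong (λ s₁ → ∑-swap (λ v s₂ → c v (s₁ , s₂))) ⟩
      ∑∑ (λ s → ∑ (λ v → c v s))                        ∎
      where open ≤-Reasoning

  -- Items are shifted by one so that 0 means "not from this sender". At most one sender fills a
  -- position, so its owner can simply add what arrives.
  placed : ℕ → List ℕ → ℕ → ℕ
  placed p l e = if does (p ≤? e) then nth (map suc l) 0 (e ∸ p) else 0

  opaque

    -- After the lengths are known, the item at global position e goes to the vertex that owns e
    -- among `N * K` positions; then each vertex broadcasts its K words, and all lists are common
    -- knowledge.
    gather : Prog (List ℕ) (Fin N → Fin K → ℕ)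
    gather =
          xch (λ _ l _ → single (length l)) (λ _ l m → l , λ u → value (m u))
      >>> xch (λ v st m → tabulate λ j → placed (Prefix.pos (proj₂ st) v) (proj₁ st) (toℕ (combine {N} {K} m j)))
              (λ _ _ m j → ∑ λ u → lookup (m u) j)
      >>> xch (λ _ f _ → tabulate f) (λ _ _ m u j → lookup (m u) j)

    gather-rounds : rounds gather ≡ 3
    gather-rounds = refl

  module Gather (x : Fin N → List ℕ) (total : ∑ (λ v → length (x v)) ≤ N * K) (NK<W : N * K < W)
    (items< : ∀ v i → i ∈ x v → suc i < W) where

    len : Fin N → ℕ
    len v = length (x v)

    open Prefix len

    everything : Fin N → Fin K → ℕ
    everything m j = ∑ λ u → placed (pos u) (x u) (toℕ (combine {N} {K} m j))

    placed-case : ∀ u e → placed (pos u) (x u) e ≡ 0 ⊎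
      (pos u ≤ e × e < pos u + len u × ∃ λ i → i ∈ x u × placed (pos u) (x u) e ≡ suc i)
    placed-case u e with bool? (does (pos u ≤? e))
    ... | inj₂ f = inj₁ (if-false f)
    ... | inj₁ f with e ∸ pos u <? len u
    ...   | no ¬lt = inj₁ (trans (if-true f) (nth-overflow (map suc (x u)) 0 (e ∸ pos u)
              (≤-trans (≤-reflexive (Data.List.Properties.length-map suc (x u))) (≮⇒≥ ¬lt))))
    ...   | yes lt with nth-∈ (map suc (x u)) 0 (e ∸ pos u)
    ...     | inj₂ eq = inj₁ (trans (if-true f) eq)
    ...     | inj₁ mem with Mem.∈-map⁻ suc mem
    ...       | i , i∈ , eq = inj₂ (holds (pos u ≤? e) f ,
                subst (_< pos u + len u) (m+[n∸m]≡n (holds (pos u ≤? e) f)) (+-monoʳ-< (pos u) lt) ,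
                i , i∈ , trans (if-true f) eq)

    placed-other : ∀ u v e → u ≢ v → pos v ≤ e → e < pos v + len v → placed (pos u) (x u) e ≡ 0
    placed-other u v e u≢v lo hi with placed-case u e
    ... | inj₁ z = z
    ... | inj₂ (lo′ , hi′ , _) with <-cmp′ (toℕ u) (toℕ v)
      where
      open import Relation.Binary using (tri<; tri≈; tri>)
      <-cmp′ : ∀ a b → a < b ⊎ b < a ⊎ a ≡ b
      <-cmp′ a b with <-cmp a b
      ... | tri< p _ _ = inj₁ p
      ... | tri≈ _ p _ = inj₂ (inj₂ p)
      ... | tri> _ _ p = inj₂ (inj₁ p)
    ...   | inj₁ u<v = ⊥-elim (<-irrefl refl (<-≤-trans hi′ (≤-trans (pos-next u<v) lo)))
    ...   | inj₂ (inj₁ v<u) = ⊥-elim (<-irrefl refl (<-≤-trans hi (≤-trans (pos-next v<u) lo′)))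
    ...   | inj₂ (inj₂ e′) = ⊥-elim (u≢v (Fin.toℕ-injective e′))

    everything-complete : ∀ v i → i ∈ x v → ∃ λ m → ∃ λ j → everything m j ≡ suc i
    everything-complete v i i∈ with ∈-nth 0 (Mem.∈-map⁺ suc i∈)
    ... | o , o< , eq = proj₁ (remQuot {N} K at) , proj₂ (remQuot {N} K at) ,
          trans (cong (λ z → ∑ λ u → placed (pos u) (x u) z) slot≡)
          (trans (∑-only _ v λ u u≢v → placed-other u v (pos v + o) u≢v (m≤m+n _ o) (+-monoʳ-< (pos v) o<len))
          (trans (if-true (dec-true (pos v ≤? pos v + o) (m≤m+n _ o))) (trans (cong (nth (map suc (x v)) 0) (m+n∸m≡n (pos v) o)) eq)))
      where
      o<len : o < len v
      o<len = <-≤-trans o< (≤-reflexive (Data.List.Properties.length-map suc (x v)))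
      e<NK : pos v + o < N * K
      e<NK = <-≤-trans (+-monoʳ-< (pos v) o<len) (≤-trans (pos-total v) total)
      at : Fin (N * K)
      at = fromℕ< e<NK
      slot≡ : toℕ (combine {N} {K} (proj₁ (remQuot {N} K at)) (proj₂ (remQuot {N} K at))) ≡ pos v + o
      slot≡ = trans (cong toℕ (Fin.combine-remQuot {N} K at)) (Fin.toℕ-fromℕ< e<NK)

    everything-sound : ∀ m j → everything m j ≡ 0 ⊎ (∃ λ v → ∃ λ i → i ∈ x v × everything m j ≡ suc i)
    everything-sound m j with count-witness (λ u → not (does (placed (pos u) (x u) (toℕ (combine {N} {K} m j)) ≟ 0)))
    ... | inj₂ none = inj₁ (trans (∑-cong λ u → zero-of _ (none u)) (∑-0 N))
      where
      zero-of : ∀ y → not (does (y ≟ 0)) ≡ false → y ≡ 0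
      zero-of zero _ = refl
    ... | inj₁ (v , nz) with placed-case v (toℕ (combine {N} {K} m j))
    ...   | inj₁ z = ⊥-elim (true≢false (trans (cong (λ y → not (does (y ≟ 0))) (sym z)) nz) refl)
    ...   | inj₂ (lo , hi , i , i∈ , eq) = inj₂ (v , i , i∈ ,
              trans (∑-only _ v λ u u≢v → placed-other u v _ u≢v lo hi) eq)

    everything<W : ∀ m j → everything m j < W
    everything<W m j with everything-sound m j
    ... | inj₁ z = ≤-<-trans (≤-reflexive z) (≤-<-trans z≤n NK<W)
    ... | inj₂ (v , i , i∈ , eq) = ≤-<-trans (≤-reflexive eq) (items< v i i∈)

    lens : Fin N → Fin N → ℕ
    lens v u = value (deliver (λ u → single (len u)) u)

    lens≡ : ∀ v u → lens v u ≡ len u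
    lens≡ v = received _ len (λ u → ≤-<-trans (≤-trans (term≤∑ len u) total) NK<W) (λ _ → refl)

    pos≡ : ∀ v → Prefix.pos (lens v) v ≡ pos v
    pos≡ v = ∑-cong λ u → cong (λ z → if does (toℕ u <? toℕ v) then z else 0) (lens≡ v u)

    sent : Fin N → Fin N → Msg
    sent m v = tabulate λ j → placed (Prefix.pos (lens v) v) (x v) (toℕ (combine {N} {K} m j))

    sent≡ : ∀ m v j → lookup (sent m v) j ≡ placed (pos v) (x v) (toℕ (combine {N} {K} m j))
    sent≡ m v j = trans (Vec.lookup∘tabulate (λ j → placed (Prefix.pos (lens v) v) (x v) (toℕ (combine {N} {K} m j))) j)
      (cong (λ p → placed p (x v) (toℕ (combine {N} {K} m j))) (pos≡ v))

    sent< : ∀ m v j → lookup (sent m v) j < W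
    sent< m v j = ≤-<-trans (≤-reflexive (sent≡ m v j)) (≤-<-trans (term≤∑ (λ u → placed (pos u) (x u) (toℕ (combine {N} {K} m j))) v) (everything<W m j))

    collected : Fin N → Fin K → ℕ
    collected m j = ∑ λ u → lookup (deliver (sent m) u) j

    collected≡ : ∀ m j → collected m j ≡ everything m j
    collected≡ m j = ∑-cong λ u → trans (cong (λ z → lookup z j) (deliver-id (sent m) (λ u → sent< m u) u)) (sent≡ m u j)

    opaque
      unfolding gather

      gather-spec : ∀ v m j → exec gather x v m j ≡ everything m j
      gather-spec v m j = trans (cong (λ z → lookup z j) (deliver-id (λ m → tabulate (collected m)) bound m))
        (trans (Vec.lookup∘tabulate (collected m) j) (collected≡ m j))
        where
        bound : ∀ m j → lookup (tabulate (collected m)) j < W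
        bound m j = ≤-<-trans (≤-reflexive (trans (Vec.lookup∘tabulate (collected m) j) (collected≡ m j))) (everything<W m j)

  -- Nearest vertices by repeated squaring

  square : Prog Table Table
  square = lift (λ v L → looped v L , L) (λ _ _ L → L) product

  neighbours : Prog Table Table
  neighbours = lift (λ v row → looped v row , point v) (λ _ _ L → L) product

  nearest : ℕ → Prog Table Table
  nearest zero    = neighbours
  nearest (suc J) = nearest J >>> square

  nearest-rounds : ∀ J → rounds (nearest J) ≡ suc J * 6
  nearest-rounds zero    = product-rounds
  nearest-rounds (suc J) = trans (cong₂ _+_ (nearest-rounds J) product-rounds) (+-comm (suc J * 6) 6)

  module Lists (G : Graph N) (1<INF : 1 < INF) where

    open Walks G

    Reach : Fin N → Fin N → ℕ → Set
    Reach x y d = Σ[ ℓ ∈ ℕ ] (ℓ ≤ d × Walk G x y ℓ)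

    reach-refl : ∀ {x} d → Reach x x d
    reach-refl d = 0 , z≤n , here

    reach-trans : ∀ {x y z c d} → Reach x y c → Reach y z d → Reach x z (c + d)
    reach-trans (ℓ , p , w) (m , p′ , w′) = ℓ + m , +-mono-≤ p p′ , (w ◅◅ w′)

    reach-sym : ∀ {x y d} → Reach x y d → Reach y x d
    reach-sym (ℓ , p , w) = ℓ , p , reverse w

    reach-≤ : ∀ {x y c d} → c ≤ d → Reach x y c → Reach x y d
    reach-≤ c≤d (ℓ , p , w) = ℓ , ≤-trans p c≤d , w

    row : Fin N → Table
    row x u = if Graph.adj G x u then 1 else INF

    row≤ : ∀ x u → row x u ≤ INF
    row≤ x u with Graph.adj G x u
    ... | true  = <⇒≤ 1<INF
    ... | false = ≤-refl

    row-sound : ∀ x u → row x u < INF → Reach x u (row x u)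
    row-sound x u lt with bool? (Graph.adj G x u)
    ... | inj₁ e rewrite e = 1 , ≤-refl , step e here
    ... | inj₂ e rewrite e = ⊥-elim (<-irrefl refl lt)

    row-edge : ∀ {x u} → Graph.adj G x u ≡ true → row x u ≡ 1
    row-edge e = if-true e

    looped-≤INF : ∀ (f : Fin N → Table) → (∀ x u → f x u ≤ INF) → ∀ x u → looped x (f x) u ≤ INF
    looped-≤INF f b x u = ≤-trans (looped-≤ x (f x) u) (b x u)

    looped-sound : ∀ (f : Fin N → Table) → (∀ x u → f x u < INF → Reach x u (f x u)) →
      ∀ x u → looped x (f x) u < INF → Reach x u (looped x (f x) u)
    looped-sound f s x u lt with looped-case x (f x) u
    ... | inj₁ (refl , e) = reach-refl _
    ... | inj₂ e = subst (Reach x u) (sym e) (s x u (subst (_< INF) e lt))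

    near : ℕ → Fin N → Table
    near J = exec (nearest J) row

    Sound : (Fin N → Table) → Set
    Sound f = ∀ x u → f x u < INF → Reach x u (f x u)

    product-reach : ∀ (A L : Fin N → Table) → (∀ x y → A x y ≤ INF) → (∀ x → Listed (L x)) → Sound A → Sound L →
      Sound (exec product (λ v → A v , L v))
    product-reach A L A≤ L≤ As Ls x u lt =
      let y , e = Product.sound (λ v → A v , L v) A≤ L≤ x u lt
          sum<  = subst (_< INF) (sym e) lt
      in  subst (Reach x u) e (reach-trans (As x y (≤-<-trans (m≤m+n (A x y) (L y u)) sum<)) (Ls y u (≤-<-trans (m≤n+m (L y u) (A x y)) sum<)))

    point-sound : Sound point
    point-sound x u lt with point-only x u lt
    ... | refl = reach-refl _

    near-listed : ∀ J x → Listed (near J x)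
    near-listed zero    x = Product.listed (λ v → looped v (row v) , point v) (looped-≤INF row row≤) point-listed x
    near-listed (suc J) x = Product.listed (λ v → looped v (near J v) , near J v) (looped-≤INF (near J) (λ x → proj₁ (near-listed J x))) (near-listed J) x

    near-sound : ∀ J → Sound (near J)
    near-sound zero    = product-reach (λ v → looped v (row v)) point (looped-≤INF row row≤) point-listed (looped-sound row row-sound) point-sound
    near-sound (suc J) = product-reach (λ v → looped v (near J v)) (near J) (looped-≤INF (near J) (λ x → proj₁ (near-listed J x)))
      (near-listed J) (looped-sound (near J) (near-sound J)) (near-sound J)

    good-≤ : ∀ f u {D E} → D ≤ E → Good f u D → Good f u E
    good-≤ f u D≤E = Good-mono {f} {f} {u} (λ v p → ≤-trans p D≤E)

    -- The walk is split at `2 ^ J`. If the list of x is already full within the first part, its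
    -- zero self-loop carries this over; otherwise the midpoint is listed and its own guarantee
    -- applies.
    near-complete : ∀ J {x u ℓ} → Walk G x u ℓ → ℓ ≤ 2 ^ J → ℓ < INF → Good (near J x) u ℓ
    near-complete zero {x} here ℓ≤ lt = subst (Good (near 0 x) x) (trans (+-identityʳ _) (looped-self x (row x)))
      (Product.good (λ v → looped v (row v) , point v) (looped-≤INF row row≤) point-listed x x x 0
        (subst (_< INF) (sym (trans (+-identityʳ _) (looped-self x (row x)))) lt) (inj₁ (≤-reflexive (point-self x))))
    near-complete zero {x} {u} (step e here) ℓ≤ lt = good-≤ (near 0 x) u le
      (Product.good (λ v → looped v (row v) , point v) (looped-≤INF row row≤) point-listed x u u 0 (≤-<-trans le lt) (inj₁ (≤-reflexive (point-self u))))
      where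
      le : looped x (row x) u + 0 ≤ 1
      le = ≤-trans (≤-reflexive (+-identityʳ _)) (≤-trans (looped-≤ x (row x) u) (≤-reflexive (row-edge e)))
    near-complete zero (step e (step e′ w)) (s≤s ()) lt
    near-complete (suc J) {x} {u} {ℓ} w ℓ≤ lt = join (split i i≤ℓ w)
      where
      i = ℓ ⊓ 2 ^ J
      i≤ℓ : i ≤ ℓ
      i≤ℓ = m⊓n≤m ℓ (2 ^ J)
      rest≤ : ℓ ∸ i ≤ 2 ^ J
      rest≤ = [ (λ ℓ≤2^J → ≤-trans (≤-reflexive (trans (cong (ℓ ∸_) (m≤n⇒m⊓n≡m ℓ≤2^J)) (n∸n≡0 ℓ))) z≤n)
              , (λ 2^J≤ℓ → ≤-trans (≤-reflexive (cong (ℓ ∸_) (m≥n⇒m⊓n≡n 2^J≤ℓ)))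
                  (≤-trans (∸-monoˡ-≤ (2 ^ J) ℓ≤) (≤-reflexive (trans (m+n∸m≡n (2 ^ J) (2 ^ J + 0)) (+-identityʳ _))))) ]′ (≤-total ℓ (2 ^ J))
      good : ∀ y D → looped x (near J x) y + D < INF → Good (near J y) u D → Good (near (suc J) x) u (looped x (near J x) y + D)
      good y D = Product.good (λ v → looped v (near J v) , near J v) (looped-≤INF (near J) (λ x → proj₁ (near-listed J x))) (near-listed J) x y u D
      join : (∃ λ y → Walk G x y i × Walk G y u (ℓ ∸ i)) → Good (near (suc J) x) u ℓ
      join (y , a , b) = via (near-complete J a (m⊓n≤n ℓ (2 ^ J)) (≤-<-trans i≤ℓ lt))
        where
        via : Good (near J x) y i → Good (near (suc J) x) u ℓ
        via (inj₂ full) = good-≤ (near (suc J) x) u (≤-trans (≤-reflexive (cong (_+ i) (looped-self x (near J x)))) i≤ℓ)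
          (good x i (≤-<-trans (≤-reflexive (cong (_+ i) (looped-self x (near J x)))) (≤-<-trans i≤ℓ lt)) (inj₂ full))
        via (inj₁ le) = good-≤ (near (suc J) x) u le′ (good y (ℓ ∸ i) (≤-<-trans le′ lt) (near-complete J b rest≤ (≤-<-trans (m∸n≤m ℓ i) lt)))
          where
          le′ : looped x (near J x) y + (ℓ ∸ i) ≤ ℓ
          le′ = ≤-trans (+-monoˡ-≤ (ℓ ∸ i) (≤-trans (looped-≤ x (near J x) y) le)) (≤-reflexive (m+[n∸m]≡n i≤ℓ))

  -- A small set that hits every full list

  module Ruling (t : ℕ) (2t≤L : t + t ≤ L) (ττ≡q : 2 ^ t * 2 ^ t ≡ q)
    (costW′ : q * q * (q * q * (2 ^ t * 2 ^ t + q * q)) < W) (σ h : ℕ) where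

    open Family N L N≡2^L t 2t≤L
    open Hitting N L N≡2^L t 2t≤L

    -- Candidates whose balls meet are within 4σ of each other, and the current approximate
    -- distances have stretch at most 2.
    R : ℕ
    R = 8 * σ

    fullA : Table → Bool
    fullA f = does (k ≤? count (within f σ))

    -- Empty unless the list is full, so that only full lists are charged when missed.
    ballA : Table → Fin N → Bool
    ballA f u = fullA f ∧ within f σ u

    target : Fin N → Table → Seed → Fin N
    target v f s = if missed (ballA f) s then v else pivot (ballA f) v s

    claim : Fin N → Table → Seed → Fin N → Bool
    claim v f s u = fullA f ∧ does (u Fin.≟ target v f s)

    candidates : Prog Table Bool
    candidates = lift (λ v f → cost true (ballA f) v) (λ _ → _,_) select
             >>> lift (λ v st → claim v (proj₁ st) (proj₂ st)) (λ _ _ b → b) notify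

    fullB : Table → Bool
    fullB f = does (k ≤? count (within f R))

    -- A candidate whose list is hit is represented by its pivot. A missed candidate stays if its
    -- list is full; a missed one with a short list has few candidates around it, and sampling
    -- cannot thin these, so they go to the independent set.
    keep rest : Fin N → Bool → Table → Seed → Bool
    keep v b f s = b ∧ (picks s v ∨ (missed (within f R) s ∧ fullB f))
    rest v b f s = b ∧ (missed (within f R) s ∧ not (fullB f))

    code : Fin N → Fin N → ℕ
    code v u = toℕ v * N + toℕ u

    items : Fin N → Bool → Table → Seed → List ℕ
    items v b f s = if rest v b f s then map (code v) (filter (λ u → f u ≤? R) (allFin N)) else []

    recorded : (Fin N → Fin K → ℕ) → Fin N → Fin N → Bool
    recorded tbl v u = does (1 ≤? ∑ λ m → count λ j → does (tbl m j ≟ suc (code v u)))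

    -- Self-loops mark the vertices of `rest`, each of which lists itself. Conflicts are symmetrised
    -- since approximate distances may list a pair on one side only.
    independent : (Fin N → Fin N → Bool) → List (Fin N)
    independent c = greedy (λ v → c v v) (λ v u → c v u ∨ c u v) (allFin N)

    thin : Prog (Table × Bool) Bool
    thin = lift (λ v s → proj₁ s , source (proj₂ s) v) (λ _ s f → proj₂ s , f) (explore h)
       >>> lift (λ v s → cost (proj₁ s) (within (proj₂ s) R) v) (λ _ → _,_) select
       >>> lift (λ v s → items v (proj₁ (proj₁ s)) (proj₂ (proj₁ s)) (proj₂ s))
                (λ v s tbl → keep v (proj₁ (proj₁ s)) (proj₂ (proj₁ s)) (proj₂ s) ∨ elem v (independent (recorded tbl))) gather

    opaque

      ruling : Prog (Table × Table) Bool
      ruling = lift (λ _ → proj₁) (λ _ s b → proj₂ s , b) candidates >>> thin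

      ruling-rounds : rounds ruling ≡ 12 + h * 6
      ruling-rounds = trans (cong₂ _+_ (cong₂ _+_ select-rounds notify-rounds) (cong₂ _+_ (explore-rounds h) (cong₂ _+_ select-rounds gather-rounds)))
        (arith (h * 6))
        where
        arith : ∀ x → 5 + (x + 7) ≡ 12 + x
        arith = solve-∀

    ττ≤k : τ * τ ≤ k
    ττ≤k = ≤-trans (≤-reflexive ττ≡q) (m≤m*n q K)

    recorded-cong : ∀ {f g} → (∀ m j → f m j ≡ g m j) → ∀ v u → recorded f v u ≡ recorded g v u
    recorded-cong e v u = cong (λ z → does (1 ≤? z)) (∑-cong λ m → ∑-cong λ j → cong (λ z → 𝟙 (does (z ≟ suc (code v u)))) (e m j))

    code-injective : ∀ {v u v′ u′} → code v u ≡ code v′ u′ → v ≡ v′ × u ≡ u′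
    code-injective {v} {u} {v′} {u′} e = Fin.combine-injective v u v′ u′ (Fin.toℕ-injective
      (trans (Fin.toℕ-combine v u) (trans (cong (_+ toℕ u) (*-comm N (toℕ v))) (trans e (sym (trans (Fin.toℕ-combine v′ u′) (cong (_+ toℕ u′) (*-comm N (toℕ v′)))))))))

    code< : ∀ v u → suc (code v u) < W
    code< v u = ≤-<-trans (≤-trans (s≤s (≤-reflexive (sym (trans (Fin.toℕ-combine v u) (cong (_+ toℕ u) (*-comm N (toℕ v)))))))
      (Fin.toℕ<n (combine v u))) pairW

    module StageA (G : Graph N) (nl : Fin N → Table)
      (nl-reach : ∀ x y → nl x y ≤ σ → Lists.Reach G 1<INF x y σ) (seedA : Seed)
      (best : N * N * ∑ (λ v → cost true (ballA (nl v)) v seedA) ≤ ∑∑ (λ s → ∑ (λ v → cost true (ballA (nl v)) v s))) where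

      open Lists G 1<INF

      module CA = Chosen (λ _ → true) (λ v → ballA (nl v)) seedA best

      full : Fin N → Bool
      full v = fullA (nl v)

      tgt : Fin N → Fin N
      tgt v = target v (nl v) seedA

      tgt-cases : ∀ v → (tgt v ≡ v × missed (ballA (nl v)) seedA ≡ true) ⊎ (ballA (nl v) (tgt v) ≡ true × picks seedA (tgt v) ≡ true)
      tgt-cases v with bool? (missed (ballA (nl v)) seedA)
      ... | inj₁ e = inj₁ (if-true e , e)
      ... | inj₂ e = inj₂ (subst (λ u → ballA (nl v) u ≡ true × picks seedA u ≡ true) (sym (if-false e)) (pivot-hits (ballA (nl v)) v seedA e))

      tgt-near : ∀ v → Reach v (tgt v) σ
      tgt-near v with tgt-cases v
      ... | inj₁ (e , _) = subst (λ u → Reach v u σ) (sym e) (reach-refl σ)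
      ... | inj₂ (b , _) = nl-reach v (tgt v) (holds (nl v (tgt v) ≤? σ) (proj₂ (∧-true {full v} b)))

      ballA-count : ∀ v → full v ≡ true → k ≤ count (ballA (nl v))
      ballA-count v e = ≤-trans (holds (k ≤? count (within (nl v) σ)) e) (count-mono λ u p → true∧ e p)

      -- A target is sampled, or it is its own target with a missed full list; `joined` counts both
      -- kinds.
      C-size : ∀ C → (∀ u → C u ≡ true → ∃ λ v → full v ≡ true × u ≡ tgt v) → τ * count C ≤ N * 4
      C-size C C-sound = ≤-trans (*-monoʳ-≤ τ (count-mono covered)) (≤-trans (CA.joined k ττ≤k full ballA-count)
        (*-monoˡ-≤ 4 (count≤n {N} (λ _ → true))))
        where
        covered : ∀ u → C u ≡ true → picks seedA u ∨ (missed (ballA (nl u)) seedA ∧ full u) ≡ true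
        covered u e with C-sound u e
        ... | v , fv , refl with tgt-cases v
        ...   | inj₂ (_ , p) = true∨ _ p
        ...   | inj₁ (e′ , m) = ∨true (picks seedA (tgt v)) (subst (λ z → missed (ballA (nl z)) seedA ∧ full z ≡ true) (sym e′) (true∧ m fv))

    module StageB (G : Graph N) (C : Fin N → Bool) (E : Fin N → Table)
      (E-reach : ∀ v u → E v u ≤ R → Lists.Reach G 1<INF v u R × C u ≡ true)
      (E-good : ∀ x u ℓ → C u ≡ true → Walk G x u ℓ → ℓ ≤ 4 * σ → Good (E x) u R)
      (seedB : Seed)
      (best : N * N * ∑ (λ v → cost (C v) (within (E v) R) v seedB) ≤ ∑∑ (λ s → ∑ (λ v → cost (C v) (within (E v) R) v s)))
      (C-size : τ * count C ≤ N * 4) where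

      open Lists G 1<INF

      module CB = Chosen C (λ v → within (E v) R) seedB best

      kp rs : Fin N → Bool
      kp v = keep v (C v) (E v) seedB
      rs v = rest v (C v) (E v) seedB

      its : Fin N → List ℕ
      its v = items v (C v) (E v) seedB

      -- `light` gives 2τ|C|, which is at most 8N, within the `N * K` words that `gather` can carry.
      its-length : ∑ (λ v → length (its v)) ≤ N * K
      its-length = begin
        ∑ (λ v → length (its v))                                             ≤⟨ ∑-mono each ⟩
        ∑ (λ v → 𝟙 (C v ∧ missed (within (E v) R) seedB) * count (within (E v) R)) ≤⟨ CB.light ⟩
        count C * (2 * τ)                                                     ≡⟨ rotate (count C) 2 τ ⟩
        τ * count C * 2                                                       ≤⟨ *-monoˡ-≤ 2 C-size ⟩
        N * 4 * 2                                                             ≡⟨ *-assoc N 4 2 ⟩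
        N * 8                                                                 ≤⟨ *-monoʳ-≤ N (≤-trans (m≤m+n 8 10) 18≤K) ⟩
        N * K                                                                 ∎
        where
        open ≤-Reasoning
        rotate : ∀ a b c → a * (b * c) ≡ c * a * b
        rotate = solve-∀
        each : ∀ v → length (its v) ≤ 𝟙 (C v ∧ missed (within (E v) R) seedB) * count (within (E v) R)
        each v = bound (C v) (missed (within (E v) R) seedB) (fullB (E v))
          where
          bound : ∀ a b c → length (if a ∧ (b ∧ not c) then map (code v) (filter (λ u → E v u ≤? R) (allFin N)) else []) ≤ 𝟙 (a ∧ b) * count (within (E v) R)
          bound false b     c     = z≤n
          bound true  false c     = z≤n
          bound true  true  true  = z≤n
          bound true  true  false = ≤-reflexive (trans (Data.List.Properties.length-map (code v) (filter (λ u → E v u ≤? R) (allFin N)))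
            (trans (length-filter (λ u → E v u ≤? R) id) (sym (+-identityʳ _))))

      its-∈ : ∀ v i → i ∈ its v → rs v ≡ true × ∃ λ u → E v u ≤ R × i ≡ code v u
      its-∈ v i i∈ = go i∈
        where
        go : i ∈ items v (C v) (E v) seedB → rs v ≡ true × ∃ λ u → E v u ≤ R × i ≡ code v u
        go i∈ with bool? (rs v)
        ... | inj₂ e with () ← subst (i ∈_) (if-false e) i∈
        ... | inj₁ e with Mem.∈-map⁻ (code v) (subst (i ∈_) (if-true e) i∈)
        ...   | u , u∈ , eq = e , u , proj₂ (Mem.∈-filter⁻ (λ u → E v u ≤? R) {xs = allFin N} u∈) , eq

      ∈-its : ∀ v u → rs v ≡ true → E v u ≤ R → code v u ∈ its v
      ∈-its v u e le = subst (code v u ∈_) (sym (if-true e))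
        (Mem.∈-map⁺ (code v) (Mem.∈-filter⁺ (λ u → E v u ≤? R) (Mem.∈-allFin u) le))

      module Edges (tbl : Fin N → Fin K → ℕ)
        (tbl-complete : ∀ v i → i ∈ its v → ∃ λ m → ∃ λ j → tbl m j ≡ suc i)
        (tbl-sound : ∀ m j → tbl m j ≡ 0 ⊎ (∃ λ v → ∃ λ i → i ∈ its v × tbl m j ≡ suc i)) where

        edge : Fin N → Fin N → Bool
        edge = recorded tbl

        edge-sound : ∀ v u → edge v u ≡ true → rs v ≡ true × E v u ≤ R
        edge-sound v u e = find (count-witness (λ m → does (1 ≤? count (λ j → does (tbl m j ≟ suc (code v u))))))
          where
          find : (∃ λ m → does (1 ≤? count (λ j → does (tbl m j ≟ suc (code v u)))) ≡ true) ⊎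
                 (∀ m → does (1 ≤? count (λ j → does (tbl m j ≟ suc (code v u)))) ≡ false) → rs v ≡ true × E v u ≤ R
          find (inj₂ none) = ⊥-elim (<-irrefl (sym (trans (∑-cong λ m → n<1⇒n≡0 (≰⇒> (fails (1 ≤? _) (none m)))) (∑-0 N))) (holds (1 ≤? _) e))
          find (inj₁ (m , p)) = find′ (count-witness (λ j → does (tbl m j ≟ suc (code v u))))
            where
            find′ : (∃ λ j → does (tbl m j ≟ suc (code v u)) ≡ true) ⊎ (∀ j → does (tbl m j ≟ suc (code v u)) ≡ false) →
              rs v ≡ true × E v u ≤ R
            find′ (inj₂ none) = ⊥-elim (<-irrefl (sym (count-none _ none)) (holds (1 ≤? _) p))
            find′ (inj₁ (j , q′)) = done (tbl-sound m j)
              where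
              done : tbl m j ≡ 0 ⊎ (∃ λ w → ∃ λ i → i ∈ its w × tbl m j ≡ suc i) → rs v ≡ true × E v u ≤ R
              done (inj₁ z) with () ← trans (sym z) (holds (tbl m j ≟ suc (code v u)) q′)
              done (inj₂ (w , i , i∈ , eq)) =
                let r , u′ , le , eq′ = its-∈ w i i∈
                    a , b = code-injective (trans (sym eq′) (suc-injective (trans (sym eq) (holds (tbl m j ≟ suc (code v u)) q′))))
                in  subst (λ z → rs z ≡ true) a r , subst₂ (λ z z′ → E z z′ ≤ R) a b le

        edge-complete : ∀ v u → rs v ≡ true → E v u ≤ R → edge v u ≡ true
        edge-complete v u r le =
          let m , j , eq = tbl-complete v (code v u) (∈-its v u r le)
          in  dec-true (1 ≤? _) (≤-trans (count-positive (λ j → does (tbl m j ≟ suc (code v u))) j (dec-true (tbl m j ≟ suc (code v u)) eq))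
                (term≤∑ (λ m → count λ j → does (tbl m j ≟ suc (code v u))) m))

        rs-self : ∀ v → rs v ≡ true → edge v v ≡ true
        rs-self v r = edge-complete v v r (self (E-good v v 0 (proj₁ (∧-true r)) here z≤n))
          where
          self : Good (E v) v R → E v v ≤ R
          self (inj₁ le) = le
          self (inj₂ fl) = ⊥-elim (true≢false (dec-true (k ≤? count (within (E v) R)) fl) (not-true (proj₂ (∧-true (proj₂ (∧-true {C v} r))))))

        M : List (Fin N)
        M = independent edge

        conflict : Fin N → Fin N → Bool
        conflict v u = edge v u ∨ edge u v

        Z : Fin N → Bool
        Z v = kp v ∨ elem v M

        -- At most σ to a candidate and at most 8σ from there to Z.
        dominates : ∀ x s → C s ≡ true → Reach x s σ → ∃ λ z → Z z ≡ true × Reach x z (9 * σ)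
        dominates x = from
          where
          in-Z : ∀ z → kp z ≡ true → Z z ≡ true
          in-Z z e = true∨ (elem z M) e
          in-M : ∀ z → elem z M ≡ true → Z z ≡ true
          in-M z e = ∨true (kp z) e
          from : ∀ s → C s ≡ true → Reach x s σ → ∃ λ z → Z z ≡ true × Reach x z (9 * σ)
          from s Cs r with bool? (missed (within (E s) R) seedB)
          ... | inj₂ e = let a , b = pivot-hits (within (E s) R) s seedB e
                             r′ , c = E-reach s (pivot (within (E s) R) s seedB) (holds (E s (pivot (within (E s) R) s seedB) ≤? R) a)
                         in  pivot (within (E s) R) s seedB , in-Z _ (true∧ c (true∨ _ b)) , reach-trans r r′
          ... | inj₁ e with bool? (fullB (E s))
          ...   | inj₁ f = s , in-Z s (true∧ Cs (∨true (picks seedB s) (true∧ e f))) , reach-≤ (m≤n*m σ 9) r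
          ...   | inj₂ f with greedy-dominates (λ v → edge v v) conflict (allFin N) s (Mem.∈-allFin s) (rs-self s (true∧ Cs (true∧ e (cong not f))))
          ...     | inj₁ m = s , in-M s m , reach-≤ (m≤n*m σ 9) r
          ...     | inj₂ (w , m , c) with ∨-true {edge s w} c
          ...       | inj₁ ed = w , in-M w m , reach-trans r (proj₁ (E-reach s w (proj₂ (edge-sound s w ed))))
          ...       | inj₂ ed = w , in-M w m , reach-trans r (reach-sym (proj₁ (E-reach w s (proj₂ (edge-sound w s ed)))))

        module Balls (nl : Fin N → Table) (nl-reach : ∀ x y → nl x y ≤ σ → Reach x y σ)
          (client : ∀ s → C s ≡ true → ∃ λ x → k ≤ count (within (nl x) σ) × Reach x s σ) where

          -- The full ball of the vertex on whose behalf v became a candidate; it lies within 2σ of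
          -- v.
          ball : Fin N → Fin N → Bool
          ball v y = decide (bool? (C v))
            where
            decide : (C v ≡ true) ⊎ (C v ≡ false) → Bool
            decide (inj₁ e) = within (nl (proj₁ (client v e))) σ y
            decide (inj₂ _) = false

          ball-near : ∀ v y → ball v y ≡ true → Reach v y (σ + σ)
          ball-near v y e with bool? (C v)
          ... | inj₁ f = reach-trans (reach-sym (proj₂ (proj₂ (client v f)))) (nl-reach _ y (holds (nl (proj₁ (client v f)) y ≤? σ) e))
          ... | inj₂ _ with () ← e

          ball-big : ∀ v → edge v v ≡ true → k ≤ count (ball v)
          ball-big v e with bool? (C v)
          ... | inj₁ f = proj₁ (proj₂ (client v f))
          ... | inj₂ f = ⊥-elim (true≢false (proj₁ (∧-true (proj₁ (edge-sound v v e)))) f)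

          -- A common point puts u within 4σ of v; as the list of v is not full, `E-good` forces u
          -- onto it.
          ball-disjoint : ∀ v u y → edge v v ≡ true → edge u u ≡ true → ball v y ≡ true → ball u y ≡ true → conflict v u ≡ true
          ball-disjoint v u y ev eu bv bu = true∨ _ (edge-complete v u rv (near-v (E-good v u (proj₁ r) (proj₁ (∧-true ru)) (proj₂ (proj₂ r)) (proj₁ (proj₂ r)))))
            where
            rv = proj₁ (edge-sound v v ev)
            ru = proj₁ (edge-sound u u eu)
            r : Reach v u (4 * σ)
            r = reach-≤ (≤-reflexive (four σ)) (reach-trans (ball-near v y bv) (reach-sym (ball-near u y bu)))
              where
              four : ∀ s → s + s + (s + s) ≡ 4 * s
              four = solve-∀
            near-v : Good (E v) u R → E v u ≤ R
            near-v (inj₁ le) = le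
            near-v (inj₂ fl) = ⊥-elim (true≢false (dec-true (k ≤? count (within (E v) R)) fl) (not-true (proj₂ (∧-true (proj₂ (∧-true {C v} rv))))))

          open Packing-bound (λ v → edge v v) conflict ball k ball-big ball-disjoint

          M-length : length M ≤ q
          M-length = *-cancelʳ-≤ (length M) q q (≤-trans (*-monoʳ-≤ (length M) (m≤m*n q K)) (greedy-length (allFin N)))

          kp-count : count kp ≤ q * 16
          kp-count = *-cancelˡ-≤ q (begin
            q * count kp            ≡⟨ cong (_* count kp) (sym ττ≡q) ⟩
            τ * τ * count kp        ≡⟨ *-assoc τ τ _ ⟩
            τ * (τ * count kp)      ≤⟨ *-monoʳ-≤ τ (CB.joined k ττ≤k (λ v → fullB (E v)) (λ v e → holds (k ≤? count (within (E v) R)) e)) ⟩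
            τ * (count C * 4)       ≡⟨ sym (*-assoc τ (count C) 4) ⟩
            τ * count C * 4         ≤⟨ *-monoˡ-≤ 4 C-size ⟩
            N * 4 * 4               ≡⟨ sixteen q ⟩
            q * (q * 16)            ∎)
            where
            open ≤-Reasoning
            sixteen : ∀ x → x * x * 4 * 4 ≡ x * (x * 16)
            sixteen = solve-∀

          -- Two samplings with `τ * τ = q` leave at most 16q vertices and the packing adds at most
          -- q. Strict inequality is essential later, hence the requirement `18 ≤ K`.
          Z-size : count Z < k
          Z-size = begin-strict
            count Z                                ≤⟨ ∑-mono (λ v → either (kp v) (elem v M)) ⟩
            ∑ (λ v → 𝟙 (kp v) + 𝟙 (elem v M))      ≡⟨ ∑-+ (λ v → 𝟙 (kp v)) (λ v → 𝟙 (elem v M)) ⟩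
            count kp + count (λ v → elem v M)      ≤⟨ +-mono-≤ kp-count (≤-trans (elem-count M) M-length) ⟩
            q * 16 + q                             ≡⟨ seventeen q ⟩
            q * 17                                 <⟨ *-monoʳ-< q (n<1+n 17) ⟩
            q * 18                                 ≤⟨ *-monoʳ-≤ q 18≤K ⟩
            k                                      ∎
            where
            open ≤-Reasoning
            seventeen : ∀ x → x * 16 + x ≡ x * 17
            seventeen = solve-∀
            either : ∀ a b → 𝟙 (a ∨ b) ≤ 𝟙 a + 𝟙 b
            either true  b = s≤s z≤n
            either false b = ≤-refl

    module Spec (G : Graph N) (nl A : Fin N → Table) (nl-sound : Lists.Sound G 1<INF nl)
      (A≤ : ∀ x y → A x y ≤ INF) (A0 : ∀ x → A x x ≡ 0) (A-sound : Lists.Sound G 1<INF A) (R<INF : R < INF)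
      (short : ∀ x y ℓ → Walk G x y ℓ → ℓ ≤ 4 * σ → Σ[ d ∈ ℕ ] (d ≤ R × Hops A h x y d)) where

      open Lists G 1<INF

      1<W′ : 1 < W
      1<W′ = <-trans 1<INF INF<W

      costA : Fin N → Seed → ℕ
      costA v = cost true (ballA (nl v)) v

      module SA = Select costA (τ * τ + N) (λ v → cost≤ true (ballA (nl v)) v) costW′

      seedA : Seed
      seedA = SA.chosen

      nl-reach : ∀ x y → nl x y ≤ σ → Reach x y σ
      nl-reach x y le = reach-≤ le (nl-sound x y (≤-<-trans (≤-trans le (m≤n*m σ 8)) R<INF))

      module A′ = StageA G nl nl-reach seedA SA.chosen-best

      claims : Fin N → Fin N → Bool
      claims v = claim v (nl v) (exec select costA v)

      claims≡ : ∀ v u → claims v u ≡ claim v (nl v) seedA u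
      claims≡ v u = cong (λ s → claim v (nl v) s u) (SA.select-spec v)

      C : Fin N → Bool
      C = exec candidates nl

      C-target : ∀ v → A′.full v ≡ true → C (A′.tgt v) ≡ true
      C-target v e = notify-true 1<W′ claims (A′.tgt v) v (trans (claims≡ v (A′.tgt v)) (true∧ e (dec-true (A′.tgt v Fin.≟ A′.tgt v) refl)))

      C-sound : ∀ u → C u ≡ true → ∃ λ v → A′.full v ≡ true × u ≡ A′.tgt v
      C-sound u e = let v , c = notify-sound 1<W′ claims u e
                        a , b = ∧-true (trans (sym (claims≡ v u)) c)
                    in  v , a , holds (u Fin.≟ A′.tgt v) b

      start₀ : Fin N → Table × Table
      start₀ v = A v , source (C v) v

      E : Fin N → Table
      E = exec (explore h) start₀

      module X = Explore start₀ A≤ (λ v → source-listed (C v) v)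

      source-C : ∀ x u → source (C x) x u < INF → C u ≡ true × u ≡ x
      source-C x u = go (C x) refl
        where
        go : ∀ b → C x ≡ b → source b x u < INF → C u ≡ true × u ≡ x
        go true  e lt = subst (λ z → C z ≡ true) (sym (point-only x u lt)) e , point-only x u lt
        go false e lt = ⊥-elim (<-irrefl refl lt)

      E-sound : ∀ x u → E x u < INF → Reach x u (E x u) × C u ≡ true
      E-sound = X.sound (λ x u d → Reach x u d × C u ≡ true)
        (λ x u lt → (subst (λ z → Reach x z (source (C x) x u)) (sym (proj₂ (source-C x u lt))) (reach-refl (source (C x) x u))) , proj₁ (source-C x u lt))
        (λ x y u d lt r → reach-trans (A-sound x y lt) (proj₁ r) , proj₂ r) h

      E-good : ∀ x u ℓ → C u ≡ true → Walk G x u ℓ → ℓ ≤ 4 * σ → Good (E x) u R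
      E-good x u ℓ Cu w ℓ≤ =
        let d , d≤ , c = short x u ℓ w ℓ≤
            g = X.good A0 h x u u d 0 c (inj₁ (≤-reflexive (trans (cong (λ b → source b u u) Cu) (point-self u))))
                  (≤-<-trans (≤-reflexive (+-identityʳ d)) (≤-<-trans d≤ R<INF))
        in  good-≤ (E x) u (≤-trans (≤-reflexive (+-identityʳ d)) d≤) g

      costB : Fin N → Seed → ℕ
      costB v = cost (C v) (within (E v) R) v

      module SB = Select costB (τ * τ + N) (λ v → cost≤ (C v) (within (E v) R) v) costW′

      seedB : Seed
      seedB = SB.chosen

      E-reach : ∀ v u → E v u ≤ R → Reach v u R × C u ≡ true
      E-reach v u le = let r , c = E-sound v u (≤-<-trans le R<INF) in reach-≤ le r , c

      module B′ = StageB G C E E-reach E-good seedB SB.chosen-best (A′.C-size C C-sound)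

      sent : Fin N → List ℕ
      sent v = items v (C v) (E v) (exec select costB v)

      sent≡ : ∀ v → sent v ≡ B′.its v
      sent≡ v = cong (items v (C v) (E v)) (SB.select-spec v)

      sent-length : ∑ (λ v → length (sent v)) ≤ N * K
      sent-length = ≤-trans (≤-reflexive (∑-cong λ v → cong length (sent≡ v))) B′.its-length

      sent< : ∀ v i → i ∈ sent v → suc i < W
      sent< v i i∈ = let _ , u , _ , eq = B′.its-∈ v i (subst (i ∈_) (sent≡ v) i∈) in subst (λ z → suc z < W) (sym eq) (code< v u)

      module Ga = Gather sent sent-length gatherW sent<

      its-complete : ∀ v i → i ∈ B′.its v → ∃ λ m → ∃ λ j → Ga.everything m j ≡ suc i
      its-complete v i i∈ = Ga.everything-complete v i (subst (i ∈_) (sym (sent≡ v)) i∈)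

      its-sound : ∀ m j → Ga.everything m j ≡ 0 ⊎ (∃ λ v → ∃ λ i → i ∈ B′.its v × Ga.everything m j ≡ suc i)
      its-sound m j = [ inj₁ , (λ (v , i , i∈ , eq) → inj₂ (v , i , subst (i ∈_) (sent≡ v) i∈ , eq)) ]′ (Ga.everything-sound m j)

      module E′ = B′.Edges Ga.everything its-complete its-sound

      client : ∀ s → C s ≡ true → ∃ λ x → k ≤ count (within (nl x) σ) × Reach x s σ
      client s e = let x , f , eq = C-sound s e in
        x , holds (k ≤? count (within (nl x) σ)) f , subst (λ z → Reach x z σ) (sym eq) (A′.tgt-near x)

      Z : Fin N → Bool
      Z = exec ruling (λ v → nl v , A v)

      opaque
        unfolding ruling

        Z≡ : ∀ v → Z v ≡ E′.Z v
        Z≡ v = cong₂ (λ s l → keep v (C v) (E v) s ∨ elem v l) (SB.select-spec v)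
          (greedy-cong (λ x → same x x) (λ x y → cong₂ _∨_ (same x y) (same y x)) (allFin N))
          where
          same : ∀ x y → recorded (exec gather sent v) x y ≡ E′.edge x y
          same = recorded-cong (Ga.gather-spec v)

      dominates : ∀ x → A′.full x ≡ true → ∃ λ z → Z z ≡ true × Reach x z (9 * σ)
      dominates x f = let z , e , r = E′.dominates x (A′.tgt x) (C-target x f) (A′.tgt-near x) in z , trans (Z≡ z) e , r

      Z-size : count Z < k
      Z-size = ≤-<-trans (≤-reflexive (∑-cong λ v → cong 𝟙 (Z≡ v))) (E′.Balls.Z-size nl nl-reach client)

    ruling-facts : ∀ (G : Graph N) (nl A : Fin N → Table) → let open Lists G 1<INF in Sound nl →
      (∀ x y → A x y ≤ INF) → (∀ x → A x x ≡ 0) → Sound A → R < INF →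
      (∀ x y ℓ → Walk G x y ℓ → ℓ ≤ 4 * σ → Σ[ d ∈ ℕ ] (d ≤ R × Hops A h x y d)) →
      (∀ x → does (k ≤? count (within (nl x) σ)) ≡ true → ∃ λ z → exec ruling (λ v → nl v , A v) z ≡ true × Reach x z (9 * σ)) ×
      count (exec ruling (λ v → nl v , A v)) < k
    ruling-facts G nl A nl-sound A≤ A0 A-sound R<INF short =
      Spec.dominates G nl A nl-sound A≤ A0 A-sound R<INF short , Spec.Z-size G nl A nl-sound A≤ A0 A-sound R<INF short

  -- Approximate distances through all scales

  module Scales (t : ℕ) (2t≤L : t + t ≤ L) (ττ≡q : 2 ^ t * 2 ^ t ≡ q)
    (costW′ : q * q * (q * q * (2 ^ t * 2 ^ t + q * q)) < W) (J a : ℕ) where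


    h : ℕ
    h = 2 ^ a * 2 + 8

    hittingSet : ℕ → Prog (Table × Table) Bool
    hittingSet σ = Ruling.ruling t 2t≤L ττ≡q costW′ σ h

    scale : ℕ → Prog (Table × Table) (Table × Table)
    scale σ = lift (λ _ s → s) (λ _ → _,_) (hittingSet σ)
          >>> lift (λ v s → proj₂ (proj₁ s) , source (proj₂ s) v) (λ _ s f → proj₁ s , f) (explore h)
          >>> lift (λ v s u → proj₂ (proj₁ s) u ⊓ proj₂ s u) (λ _ s f → proj₁ (proj₁ s) , f) mirror

    scales : ℕ → Prog (Table × Table) (Table × Table)
    scales zero    = ret (λ _ s → s)
    scales (suc i) = scales i >>> scale (2 ^ i)

    weave : Prog Table Table
    weave = lift (λ _ row → row) (λ v row f → f , looped v (λ u → row u ⊓ f u)) (nearest J)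
        >>> scales (J ∸ a)
        >>> ret (λ _ → proj₂)

    scales-rounds : ∀ i → rounds (scales i) ≡ i * (13 + h * 12)
    scales-rounds zero    = refl
    scales-rounds (suc i) = trans (cong₂ _+_ (scales-rounds i) (cong₂ _+_ (Ruling.ruling-rounds t 2t≤L ττ≡q costW′ (2 ^ i) h) (cong₂ _+_ (explore-rounds h) mirror-rounds)))
      (arith (i * (13 + h * 12)) h)
      where
      arith : ∀ x h → x + (12 + h * 6 + (h * 6 + 1)) ≡ 13 + h * 12 + x
      arith = solve-∀

    weave-rounds : rounds weave ≡ suc J * 6 + (J ∸ a) * (13 + h * 12)
    weave-rounds = cong₂ _+_ (nearest-rounds J) (trans (cong (_+ 0) (scales-rounds (J ∸ a))) (+-identityʳ _))

    module Spec (G : Graph N) (2^J≤N : 2 ^ J ≤ N) (INF≡4N : INF ≡ 4 * N) (5≤a : 5 ≤ a) (144J≤2^a : 144 * J ≤ 2 ^ a) where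

      open Lists G 1<INF
      open Walks G

      HopBound : ℕ → (Fin N → Table) → Set
      HopBound i A = ∀ {x y ℓ} → Walk G x y ℓ → ℓ ≤ 2 ^ (a + i) → Σ[ d ∈ ℕ ] (2 ^ a * d ≤ (2 ^ a + 144 * i) * ℓ × Hops A h x y d)

      record Inv (i : ℕ) (s : Fin N → Table × Table) : Set where
        field
          nl-sound : Sound (proj₁ ∘ s)
          nl-good  : ∀ {x u ℓ} → Walk G x u ℓ → ℓ ≤ 2 ^ J → Good (proj₁ (s x)) u ℓ
          A≤       : ∀ x y → proj₂ (s x) y ≤ INF
          A0       : ∀ x → proj₂ (s x) x ≡ 0
          A-sound  : Sound (proj₂ ∘ s)
          A≤nl     : ∀ x y → proj₂ (s x) y ≤ proj₁ (s x) y
          hops     : HopBound i (proj₂ ∘ s)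

      2N<INF : 2 * N < INF
      2N<INF = subst (2 * N <_) (sym INF≡4N) (*-monoˡ-< N {2} {4} (s≤s (s≤s (s≤s z≤n))))

      2^J<INF : 2 ^ J < INF
      2^J<INF = ≤-<-trans (≤-trans 2^J≤N (m≤n*m N 2)) 2N<INF

      module Step (i : ℕ) (i< : i < J ∸ a) (s : Fin N → Table × Table) (inv : Inv i s) where

        open Inv inv

        nl A : Fin N → Table
        nl x = proj₁ (s x)
        A  x = proj₂ (s x)

        σ : ℕ
        σ = 2 ^ i

        a+i<J : a + i < J
        a+i<J = ≤-trans (≤-reflexive (sym (+-suc a i))) (≤-trans (+-monoʳ-≤ a i<) (≤-reflexive (m+[n∸m]≡n a≤J)))
          where
          a≤J : a ≤ J
          a≤J = [ id , (λ J≤a → ⊥-elim (n≮0 (<-≤-trans i< (≤-reflexive (m≤n⇒m∸n≡0 J≤a))))) ]′ (≤-total a J)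

        scale≡ : 2 ^ (a + i) ≡ 2 ^ a * σ
        scale≡ = ^-distribˡ-+-* 2 a i

        scale≤ : 2 ^ (a + i) ≤ N
        scale≤ = ≤-trans (^-monoʳ-≤ 2 (<⇒≤ a+i<J)) 2^J≤N

        32≤2^a : 32 ≤ 2 ^ a
        32≤2^a = ^-monoʳ-≤ 2 5≤a

        cj≤ : 144 * i ≤ 2 ^ a
        cj≤ = ≤-trans (*-monoʳ-≤ 144 (<⇒≤ (≤-<-trans (m≤n+m i a) a+i<J))) 144J≤2^a

        at-most-twice : ∀ {d ℓ} → 2 ^ a * d ≤ (2 ^ a + 144 * i) * ℓ → d ≤ 2 * ℓ
        at-most-twice {d} {ℓ} le = *-cancelˡ-≤ (2 ^ a) {{m^n≢0 2 a}} (≤-trans le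
          (≤-trans (*-monoˡ-≤ ℓ (+-monoʳ-≤ (2 ^ a) cj≤)) (≤-reflexive (twice (2 ^ a) ℓ))))
          where
          twice : ∀ x y → (x + x) * y ≡ x * (2 * y)
          twice = solve-∀

        8σ≤N : 8 * σ ≤ N
        8σ≤N = ≤-trans (*-monoˡ-≤ σ (≤-trans (m≤m+n 8 24) 32≤2^a)) (≤-trans (≤-reflexive (sym scale≡)) scale≤)

        short : ∀ x y ℓ → Walk G x y ℓ → ℓ ≤ 4 * σ → Σ[ d ∈ ℕ ] (d ≤ 8 * σ × Hops A h x y d)
        short x y ℓ w ℓ≤ =
          let d , cost , hs = hops w (≤-trans ℓ≤ (≤-trans (*-monoˡ-≤ σ (≤-trans (m≤m+n 4 28) 32≤2^a)) (≤-reflexive (sym scale≡))))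
          in  d , ≤-trans (at-most-twice cost) (≤-trans (*-monoʳ-≤ 2 ℓ≤) (≤-reflexive (eight σ))) , hs
          where
          eight : ∀ s → 2 * (4 * s) ≡ 8 * s
          eight = solve-∀

        Z-facts : (∀ x → does (k ≤? count (within (nl x) σ)) ≡ true → ∃ λ z → exec (hittingSet σ) s z ≡ true × Reach x z (9 * σ)) ×
          count (exec (hittingSet σ) s) < k
        Z-facts = Ruling.ruling-facts t 2t≤L ττ≡q costW′ σ h
          G nl A nl-sound A≤ A0 A-sound (≤-<-trans (≤-trans 8σ≤N (m≤n*m N 2)) 2N<INF) short

        Z : Fin N → Bool
        Z = exec (hittingSet σ) s

        start₀ : Fin N → Table × Table
        start₀ v = A v , source (Z v) v

        D : Fin N → Table
        D = exec (explore h) start₀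

        module X = Explore start₀ A≤ (λ v → source-listed (Z v) v)

        source-Z : ∀ x u → source (Z x) x u < INF → Z u ≡ true × u ≡ x
        source-Z x u = go (Z x) refl
          where
          go : ∀ b → Z x ≡ b → source b x u < INF → Z u ≡ true × u ≡ x
          go true  e lt = subst (λ z → Z z ≡ true) (sym (point-only x u lt)) e , point-only x u lt
          go false e lt = ⊥-elim (<-irrefl refl lt)

        D-sound : ∀ x u → D x u < INF → Reach x u (D x u) × Z u ≡ true
        D-sound = X.sound (λ x u d → Reach x u d × Z u ≡ true)
          (λ x u lt → (subst (λ z → Reach x z (source (Z x) x u)) (sym (proj₂ (source-Z x u lt))) (reach-refl (source (Z x) x u))) , proj₁ (source-Z x u lt))
          (λ x y u d lt r → reach-trans (A-sound x y lt) (proj₁ r) , proj₂ r) h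

        -- Only vertices of Z occur in D, and they are fewer than k, so the alternative "the list is
        -- full" cannot arise.
        D-complete : ∀ x z d → Z z ≡ true → Hops A h x z d → d < INF → D x z ≤ d
        D-complete x z d Zz hs lt = only (X.good A0 h x z z d 0 hs (inj₁ (≤-reflexive (trans (cong (λ b → source b z z) Zz) (point-self z))))
            (≤-<-trans (≤-reflexive (+-identityʳ d)) lt))
          where
          only : Good (D x) z (d + 0) → D x z ≤ d
          only (inj₁ le) = ≤-trans le (≤-reflexive (+-identityʳ d))
          only (inj₂ fl) = ⊥-elim (<-irrefl refl (≤-<-trans (≤-trans fl (count-mono λ u e →
            proj₂ (D-sound x u (≤-<-trans (holds (D x u ≤? d + 0) e) (≤-<-trans (≤-reflexive (+-identityʳ d)) lt))))) (proj₂ Z-facts)))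

        new : Fin N → Table
        new = exec mirror (λ v u → A v u ⊓ D v u)

        new≡ : ∀ x y → new x y ≡ (A x y ⊓ D x y) ⊓ (A y x ⊓ D y x)
        new≡ = mirror-spec (λ v u → A v u ⊓ D v u) (λ v u → ≤-trans (m⊓n≤m (A v u) (D v u)) (A≤ v u))

        new≤A : ∀ x y → new x y ≤ A x y
        new≤A x y = ≤-trans (≤-reflexive (new≡ x y)) (≤-trans (m⊓n≤m _ _) (m⊓n≤m _ _))

        new≤D : ∀ x y → new x y ≤ D x y × new y x ≤ D x y
        new≤D x y = ≤-trans (≤-reflexive (new≡ x y)) (≤-trans (m⊓n≤m _ _) (m⊓n≤n (A x y) _)) ,
                    ≤-trans (≤-reflexive (new≡ y x)) (≤-trans (m⊓n≤n (A y x ⊓ D y x) _) (m⊓n≤n (A x y) _))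

        min-sound : ∀ x y → A x y ⊓ D x y < INF → Reach x y (A x y ⊓ D x y)
        min-sound x y lt = [ (λ e → subst (Reach x y) (sym e) (A-sound x y (subst (_< INF) e lt)))
                           , (λ e → subst (Reach x y) (sym e) (proj₁ (D-sound x y (subst (_< INF) e lt)))) ]′ (⊓-sel (A x y) (D x y))

        new-sound : Sound new
        new-sound x y lt = subst (Reach x y) (sym (new≡ x y)) (go (subst (_< INF) (new≡ x y) lt))
          where
          go : (A x y ⊓ D x y) ⊓ (A y x ⊓ D y x) < INF → Reach x y ((A x y ⊓ D x y) ⊓ (A y x ⊓ D y x))
          go lt = [ (λ e → subst (Reach x y) (sym e) (min-sound x y (subst (_< INF) e lt)))
                  , (λ e → subst (Reach x y) (sym e) (reach-sym (min-sound y x (subst (_< INF) e lt)))) ]′ (⊓-sel (A x y ⊓ D x y) (A y x ⊓ D y x))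

        -- Half of the scale `2 ^ (a + i)` already treated; a bridge of this length plus a detour of
        -- 9σ is still within that scale.
        H : ℕ
        H = 2 ^ (a ∸ 1) * σ

        2H≡ : H * 2 ≡ 2 ^ a * σ
        2H≡ = trans (rotate (2 ^ (a ∸ 1)) σ) (cong (λ x → 2 ^ x * σ) (m+[n∸m]≡n (≤-trans (s≤s z≤n) 5≤a)))
          where
          rotate : ∀ x y → x * y * 2 ≡ 2 * x * y
          rotate = solve-∀

        9σ≤H : 9 * σ ≤ H
        9σ≤H = *-monoˡ-≤ σ (≤-trans (m≤m+n 9 7) (^-monoʳ-≤ 2 (∸-monoˡ-≤ 1 5≤a)))

        near-bridge : ∀ {x z ℓ} → Z z ≡ true → Walk G x z ℓ → ℓ ≤ H * 2 →
          Σ[ d ∈ ℕ ] (2 ^ a * d ≤ (2 ^ a + 144 * i) * ℓ × new x z ≤ d × new z x ≤ d)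
        near-bridge {x} {z} {ℓ} Zz w ℓ≤ =
          let ℓ≤′ = ≤-trans ℓ≤ (≤-reflexive (trans 2H≡ (sym scale≡)))
              d , cost , hs = hops w ℓ≤′
              Dle = D-complete x z d Zz hs (≤-<-trans (≤-trans (at-most-twice cost) (*-monoʳ-≤ 2 (≤-trans ℓ≤′ scale≤))) 2N<INF)
          in  d , cost , ≤-trans (proj₁ (new≤D x z)) Dle , ≤-trans (proj₂ (new≤D x z)) Dle

        jump-or-full : ∀ {x y ℓ} → Walk G x y ℓ → ℓ ≤ σ → nl x y ≤ ℓ ⊎ does (k ≤? count (within (nl x) σ)) ≡ true
        jump-or-full {x} {y} {ℓ} w ℓ≤ = go (nl-good w (≤-trans ℓ≤ (^-monoʳ-≤ 2 (<⇒≤ (≤-<-trans (m≤n+m i a) a+i<J)))))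
          where
          go : Good (nl x) y ℓ → nl x y ≤ ℓ ⊎ does (k ≤? count (within (nl x) σ)) ≡ true
          go (inj₁ le) = inj₁ le
          go (inj₂ fl) = inj₂ (dec-true (k ≤? count (within (nl x) σ)) (≤-trans fl (count-mono λ u e →
            dec-true (nl x u ≤? σ) (≤-trans (holds (nl x u ≤? ℓ) e) ℓ≤))))

        module Db = Doubling G A new nl Z (λ x → does (k ≤? count (within (nl x) σ))) h (2 ^ a) 144 i σ H
          new≤A (λ x y → ≤-trans (new≤A x y) (A≤nl x y)) jump-or-full (proj₁ Z-facts) near-bridge 9σ≤H

        new-hops : HopBound (suc i) new
        new-hops w ℓ≤ =
          Db.double 2H≡ refl cj≤ refl (λ w le → hops w (≤-trans le (≤-reflexive (trans 2H≡ (sym scale≡))))) w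
            (≤-trans ℓ≤ (≤-reflexive (trans (cong (2 ^_) (+-suc a i)) (trans (*-comm 2 (2 ^ (a + i))) (cong (_* 2) (trans scale≡ (sym 2H≡)))))))

        step-inv : Inv (suc i) (exec (scale σ) s)
        step-inv = record
          { nl-sound = nl-sound
          ; nl-good  = nl-good
          ; A≤       = λ x y → ≤-trans (new≤A x y) (A≤ x y)
          ; A0       = λ x → n≤0⇒n≡0 (≤-trans (new≤A x x) (≤-reflexive (A0 x)))
          ; A-sound  = new-sound
          ; A≤nl     = λ x y → ≤-trans (new≤A x y) (A≤nl x y)
          ; hops     = new-hops
          }

      init : Fin N → Table × Table
      init v = near J v , looped v (λ u → row v u ⊓ near J v u)

      init-inv : Inv 0 init
      init-inv = record
        { nl-sound = near-sound J
        ; nl-good  = λ w ℓ≤ → near-complete J w ℓ≤ (≤-<-trans ℓ≤ 2^J<INF)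
        ; A≤       = λ x y → ≤-trans (looped-≤ x (λ u → row x u ⊓ near J x u) y) (≤-trans (m⊓n≤m (row x y) _) (row≤ x y))
        ; A0       = λ x → looped-self x (λ u → row x u ⊓ near J x u)
        ; A-sound  = looped-sound (λ x u → row x u ⊓ near J x u) λ x u lt →
            [ (λ e → subst (Reach x u) (sym e) (row-sound x u (subst (_< INF) e lt)))
            , (λ e → subst (Reach x u) (sym e) (near-sound J x u (subst (_< INF) e lt))) ]′ (⊓-sel (row x u) (near J x u))
        ; A≤nl     = λ x y → ≤-trans (looped-≤ x (λ u → row x u ⊓ near J x u) y) (m⊓n≤n (row x y) _)
        -- Walks of length at most `2 ^ a` are followed edge by edge, since `2 ^ a ≤ h`.
        ; hops     = λ {x} {y} {ℓ} w ℓ≤ →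
            let d , d≤ , hs = along w
                d′ , d′≤ , hs′ = hops-mono {B = λ x → proj₂ (init x)} (λ _ _ → ≤-refl) (≤-trans (≤-trans ℓ≤ (≤-reflexive (cong (2 ^_) (+-identityʳ a)))) (≤-trans (m≤m*n (2 ^ a) 2) (m≤m+n (2 ^ a * 2) 8))) hs
            in  d′ , *-mono-≤ (m≤m+n (2 ^ a) _) (≤-trans d′≤ d≤) , hs′
        }
        where
        along : ∀ {x y ℓ} → Walk G x y ℓ → Σ[ d ∈ ℕ ] (d ≤ ℓ × Hops (λ x → proj₂ (init x)) ℓ x y d)
        along here = 0 , z≤n , stop
        along (step {u} {v} e w) =
          let d , d≤ , hs = along w
          in  _ , +-mono-≤ (≤-trans (looped-≤ u (λ z → row u z ⊓ near J u z) v) (≤-trans (m⊓n≤m (row u v) _) (≤-reflexive (row-edge e)))) d≤ , hop v hs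

      inv : ∀ i → i ≤ J ∸ a → Inv i (exec (scales i) init)
      inv zero    _  = init-inv
      inv (suc i) le = Step.step-inv i le (exec (scales i) init) (inv i (<⇒≤ le))

      woven : Fin N → Table
      woven = exec weave row

      woven-inv : Inv (J ∸ a) (exec (scales (J ∸ a)) init)
      woven-inv = inv (J ∸ a) ≤-refl

      woven-facts : (∀ x y → woven x y ≤ INF) × (∀ x → woven x x ≡ 0) × Sound woven ×
        (∀ {x y ℓ} → Walk G x y ℓ → ℓ ≤ 2 ^ J → Σ[ d ∈ ℕ ] (2 ^ a * d ≤ (2 ^ a + 144 * (J ∸ a)) * ℓ × Hops woven h x y d))
      woven-facts = Inv.A≤ woven-inv , Inv.A0 woven-inv , Inv.A-sound woven-inv ,
        λ w ℓ≤ → Inv.hops woven-inv w (≤-trans ℓ≤ (^-monoʳ-≤ 2 (m≤n+m∸n J a)))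

  -- One level of the emulator

  module Levels (h : ℕ) where


    entries# : (Fin N → Table) → ℕ
    entries# E = ∑ λ v → size (E v)

    module Level (t : ℕ) (2t≤L : t + t ≤ L) (D : ℕ) where

      open Family N L N≡2^L t 2t≤L
      open Hitting N L N≡2^L t 2t≤L

      full : Table → Bool
      full f = does (k ≤? count (within f D))

      wants : Fin N → Table → Seed → Fin N → Bool
      wants v f s u = if missed (within f D) s then not (full f) ∧ within f D u else does (u Fin.≟ pivot (within f D) v s)

      edges : Fin N → Bool → Table → Seed → Table
      edges v b f s u = if b ∧ wants v f s u then f u else INF

      joins : Fin N → Bool → Table → Seed → Bool
      joins v b f s = b ∧ (picks s v ∨ (missed (within f D) s ∧ full f))

      level : Prog (Table × Table × Bool) (Table × Table × Bool)
      level = lift (λ v s → proj₁ s , source (proj₂ (proj₂ s)) v) (λ _ → _,_) (explore h)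
          >>> lift (λ v s → cost (proj₂ (proj₂ (proj₁ s))) (within (proj₂ s) D) v) (λ _ → _,_) select
          >>> lift (λ v s → edges v (proj₂ (proj₂ (proj₁ (proj₁ s)))) (proj₂ (proj₁ s)) (proj₂ s))
                   (λ v s E → proj₁ (proj₁ (proj₁ s)) , (λ u → proj₁ (proj₂ (proj₁ (proj₁ s))) u ⊓ E u) ,
                              joins v (proj₂ (proj₂ (proj₁ (proj₁ s)))) (proj₂ (proj₁ s)) (proj₂ s)) mirror

      level-rounds : rounds level ≡ h * 6 + 5
      level-rounds = cong₂ _+_ (explore-rounds h) (cong₂ _+_ select-rounds mirror-rounds)

      module Choice (S : Fin N → Bool) (F : Fin N → Table) (F≤ : ∀ v u → F v u ≤ INF) (D<INF : D < INF)
        (F-S : ∀ v u → F v u < INF → S u ≡ true) (s : Seed)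
        (best : N * N * ∑ (λ v → cost (S v) (within (F v) D) v s) ≤ ∑∑ (λ s → ∑ (λ v → cost (S v) (within (F v) D) v s))) where

        module Ch = Chosen S (λ v → within (F v) D) s best

        E : Fin N → Table
        E v = edges v (S v) (F v) s

        S′ : Fin N → Bool
        S′ v = joins v (S v) (F v) s

        E≤ : ∀ v u → E v u ≤ INF
        E≤ v u with S v ∧ wants v (F v) s u
        ... | true  = F≤ v u
        ... | false = ≤-refl

        E-sound : ∀ v u → E v u < INF → E v u ≡ F v u
        E-sound v u lt with S v ∧ wants v (F v) s u
        ... | true  = refl
        ... | false = ⊥-elim (<-irrefl refl lt)

        S′-size : τ * τ ≤ k → τ * count S′ ≤ count S * 4
        S′-size ττ≤k = Ch.joined k ττ≤k (λ v → full (F v)) (λ v e → holds (k ≤? count (within (F v) D)) e)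

        -- One pivot for each vertex whose list is hit, and otherwise only missed lists, whose total
        -- size `light` bounds.
        E-size : entries# E ≤ count S + count S * (2 * τ)
        E-size = ≤-trans (∑-mono each) (≤-trans (≤-reflexive (∑-+ (𝟙 ∘ S) (λ v → 𝟙 (S v ∧ missed (within (F v) D) s) * count (within (F v) D))))
          (+-monoʳ-≤ (count S) Ch.light))
          where
          finite : ∀ v u → does (E v u <? INF) ≡ true → S v ∧ wants v (F v) s u ≡ true
          finite v u e = [ id , (λ f → ⊥-elim (<-irrefl (if-false f) (holds (E v u <? INF) e))) ]′ (bool? (S v ∧ wants v (F v) s u))
          each : ∀ v → size (E v) ≤ 𝟙 (S v) + 𝟙 (S v ∧ missed (within (F v) D) s) * count (within (F v) D)
          each v = ≤-trans (count-mono (finite v)) (bound (S v) (missed (within (F v) D) s) (full (F v)))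
            where
            bound : ∀ a m f → count (λ u → a ∧ (if m then not f ∧ within (F v) D u else does (u Fin.≟ pivot (within (F v) D) v s)))
              ≤ 𝟙 a + 𝟙 (a ∧ m) * count (within (F v) D)
            bound false m     f     = ≤-reflexive (count-none {N} (λ _ → false) λ _ → refl)
            bound true  false f     = ≤-trans (count≤1 _ λ i j p r → trans (holds (i Fin.≟ _) p) (sym (holds (j Fin.≟ _) r))) (≤-reflexive refl)
            bound true  true  true  = ≤-trans (≤-reflexive (count-none {N} (λ _ → false) λ _ → refl)) z≤n
            bound true  true  false = ≤-trans (≤-reflexive (sym (+-identityʳ _))) (n≤1+n _)

        linked : ∀ v → S v ≡ true → (∃ λ p → S′ p ≡ true × (p ≡ v ⊎ E v p ≤ D)) ⊎
          (∀ u d → d ≤ D → Good (F v) u d → E v u ≤ d)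
        linked v Sv with bool? (missed (within (F v) D) s)
        ... | inj₂ hit =
          let a , b = pivot-hits (within (F v) D) v s hit
              p     = pivot (within (F v) D) v s
              le    = holds (F v p ≤? D) a
          in  inj₁ (p , true∧ (F-S v p (≤-<-trans le D<INF)) (true∨ _ b) ,
                    inj₂ (≤-trans (≤-reflexive (if-true (true∧ Sv (trans (if-false hit) (dec-true (p Fin.≟ p) refl))))) le))
        ... | inj₁ miss with bool? (full (F v))
        ...   | inj₁ f = inj₁ (v , true∧ Sv (∨true (picks s v) (true∧ miss f)) , inj₁ refl)
        ...   | inj₂ f = inj₂ λ u d d≤D → λ
                { (inj₁ le) → ≤-trans (≤-reflexive (if-true (true∧ Sv (trans (if-true miss) (true∧ (cong not f) (dec-true (F v u ≤? D) (≤-trans le d≤D))))))) le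
                ; (inj₂ fl) → ⊥-elim (fails (k ≤? count (within (F v) D)) f (≤-trans fl (count-mono λ w e →
                    dec-true (F v w ≤? D) (≤-trans (holds (F v w ≤? d) e) d≤D)))) }

    -- The last level needs no sampling: with fewer than k vertices its lists are complete, so all
    -- pairs within D are joined.
    closing : ℕ → Prog (Table × Table × Bool) Table
    closing D = lift (λ v s → proj₁ s , source (proj₂ (proj₂ s)) v) (λ _ → _,_) (explore h)
            >>> lift (λ v s u → if proj₂ (proj₂ (proj₁ s)) ∧ within (proj₂ s) D u then proj₂ s u else INF)
                     (λ v s E u → proj₁ (proj₂ (proj₁ s)) u ⊓ E u) mirror

    closing-rounds : ∀ D → rounds (closing D) ≡ h * 6 + 1
    closing-rounds D = cong₂ _+_ (explore-rounds h) mirror-rounds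

    size-min : ∀ (f g : Fin N → Table) (h : Fin N → Table) → (∀ v u → h v u ≡ f v u ⊓ g v u) → entries# h ≤ entries# f + entries# g
    size-min f g h e = ≤-trans (∑-mono λ v → ≤-trans (∑-mono λ u → bit v u) (≤-reflexive (∑-+ (λ u → 𝟙 (does (f v u <? INF))) (λ u → 𝟙 (does (g v u <? INF))))))
      (≤-reflexive (∑-+ (size ∘ f) (size ∘ g)))
      where
      bit : ∀ v u → 𝟙 (does (h v u <? INF)) ≤ 𝟙 (does (f v u <? INF)) + 𝟙 (does (g v u <? INF))
      bit v u with bool? (does (f v u <? INF)) | bool? (does (g v u <? INF))
      ... | inj₁ a | _      rewrite a = ≤-trans (𝟙≤1 _) (s≤s z≤n)
      ... | inj₂ a | inj₁ b rewrite a | b = 𝟙≤1 _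
      ... | inj₂ a | inj₂ b rewrite a | b = ≤-reflexive (cong 𝟙 (dec-false (h v u <? INF) λ lt →
        [ (λ e′ → fails (f v u <? INF) a (subst (_< INF) (trans (e v u) e′) lt))
        , (λ e′ → fails (g v u <? INF) b (subst (_< INF) (trans (e v u) e′) lt)) ]′ (⊓-sel (f v u) (g v u))))

    size-flip : ∀ (f : Fin N → Table) → entries# (λ v u → f u v) ≡ entries# f
    size-flip f = sym (∑-swap (λ v u → 𝟙 (does (f v u <? INF))))

    module Run (G : Graph N) (A : Fin N → Table)
      (A≤ : ∀ x y → A x y ≤ INF) (A0 : ∀ x → A x x ≡ 0) (A-sound : Lists.Sound G 1<INF A) where

      open Lists G 1<INF

      source-S : ∀ (S : Fin N → Bool) x u → source (S x) x u < INF → S u ≡ true × u ≡ x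
      source-S S x u = go (S x) refl
        where
        go : ∀ b → S x ≡ b → source b x u < INF → S u ≡ true × u ≡ x
        go true  e lt = subst (λ z → S z ≡ true) (sym (point-only x u lt)) e , point-only x u lt
        go false e lt = ⊥-elim (<-irrefl refl lt)

      module Explored (S : Fin N → Bool) where

        start₀ : Fin N → Table × Table
        start₀ v = A v , source (S v) v

        F : Fin N → Table
        F = exec (explore h) start₀

        module X = Explore start₀ A≤ (λ v → source-listed (S v) v)

        F≤ : ∀ v u → F v u ≤ INF
        F≤ v = proj₁ (X.listed h v)

        F-sound : ∀ x u → F x u < INF → Reach x u (F x u) × S u ≡ true
        F-sound = X.sound (λ x u d → Reach x u d × S u ≡ true)
          (λ x u lt → (subst (λ z → Reach x z (source (S x) x u)) (sym (proj₂ (source-S S x u lt))) (reach-refl (source (S x) x u))) , proj₁ (source-S S x u lt))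
          (λ x y u d lt r → reach-trans (A-sound x y lt) (proj₁ r) , proj₂ r) h

        F-good : ∀ x u d → S u ≡ true → Hops A h x u d → d < INF → Good (F x) u d
        F-good x u d Su hs lt = good-≤ (F x) u (≤-reflexive (+-identityʳ d))
          (X.good A0 h x u u d 0 hs (inj₁ (≤-reflexive (trans (cong (λ b → source b u u) Su) (point-self u)))) (≤-<-trans (≤-reflexive (+-identityʳ d)) lt))


      record Valid (Hm : Fin N → Table) : Set where
        field
          sound     : Sound Hm
          symmetric : ∀ x y → Hm x y ≡ Hm y x
          bounded   : ∀ x y → Hm x y ≤ INF

      module Add (Hm E H′ : Fin N → Table) (Hv : Valid Hm) (Es : Sound E) (E≤ : ∀ v u → E v u ≤ INF)
        (H′≡ : ∀ v u → H′ v u ≡ Hm v u ⊓ (E v u ⊓ E u v)) where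

        added-valid : Valid H′
        added-valid = record
          { sound     = λ x y lt → subst (Reach x y) (sym (H′≡ x y)) (reach x y (subst (_< INF) (H′≡ x y) lt))
          ; symmetric = λ x y → trans (H′≡ x y) (trans (cong₂ _⊓_ (Valid.symmetric Hv x y) (⊓-comm (E x y) (E y x))) (sym (H′≡ y x)))
          ; bounded   = λ x y → ≤-trans (≤-reflexive (H′≡ x y)) (≤-trans (m⊓n≤m (Hm x y) _) (Valid.bounded Hv x y))
          }
          where
          either : ∀ x y → E x y ⊓ E y x < INF → Reach x y (E x y ⊓ E y x)
          either x y lt = [ (λ e → subst (Reach x y) (sym e) (Es x y (subst (_< INF) e lt)))
                          , (λ e → subst (Reach x y) (sym e) (reach-sym (Es y x (subst (_< INF) e lt)))) ]′ (⊓-sel (E x y) (E y x))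
          reach : ∀ x y → Hm x y ⊓ (E x y ⊓ E y x) < INF → Reach x y (Hm x y ⊓ (E x y ⊓ E y x))
          reach x y lt = [ (λ e → subst (Reach x y) (sym e) (Valid.sound Hv x y (subst (_< INF) e lt)))
                         , (λ e → subst (Reach x y) (sym e) (either x y (subst (_< INF) e lt))) ]′ (⊓-sel (Hm x y) (E x y ⊓ E y x))

        added-size : entries# H′ ≤ entries# Hm + (entries# E + entries# E)
        added-size = ≤-trans (size-min Hm (λ v u → E v u ⊓ E u v) H′ H′≡)
          (+-monoʳ-≤ (entries# Hm) (≤-trans (size-min E (λ v u → E u v) _ (λ _ _ → refl)) (≤-reflexive (cong (entries# E +_) (size-flip E)))))

        added≤ : ∀ v u → H′ v u ≤ Hm v u × H′ v u ≤ E v u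
        added≤ v u = ≤-trans (≤-reflexive (H′≡ v u)) (m⊓n≤m _ _) , ≤-trans (≤-reflexive (H′≡ v u)) (≤-trans (m⊓n≤n (Hm v u) _) (m⊓n≤m _ _))

      module AtLevel (t : ℕ) (2t≤L : t + t ≤ L) (D : ℕ) (D<INF : D < INF) (st : Fin N → Table × Table × Bool)
        (A≡ : ∀ v → proj₁ (st v) ≡ A v) (Hv : Valid (λ v → proj₁ (proj₂ (st v)))) where

        open Level t 2t≤L D
        open Hitting N L N≡2^L t 2t≤L using (cost; cost≤)

        τ : ℕ
        τ = 2 ^ t

        S : Fin N → Bool
        S v = proj₂ (proj₂ (st v))

        Hm : Fin N → Table
        Hm v = proj₁ (proj₂ (st v))

        open Explored S

        ττ≤N : τ * τ ≤ N
        ττ≤N = ≤-trans (≤-reflexive (sym (^-distribˡ-+-* 2 t t))) (≤-trans (^-monoʳ-≤ 2 2t≤L) (≤-reflexive (sym N≡2^L)))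

        F₁ : Fin N → Table
        F₁ = exec (explore h) (λ v → proj₁ (st v) , source (S v) v)

        F₁≡ : ∀ v → F₁ v ≡ F v
        F₁≡ = exec-cong (explore h) (λ v → cong (_, source (S v) v) (A≡ v))

        cost₁ : Fin N → Seed → ℕ
        cost₁ v = cost (S v) (within (F₁ v) D) v

        module Se = Select cost₁ (N + N) (λ v s → ≤-trans (cost≤ (S v) (within (F₁ v) D) v s) (+-monoˡ-≤ N ττ≤N)) costW

        seed : Seed
        seed = Se.chosen

        best : N * N * ∑ (λ v → cost (S v) (within (F v) D) v seed) ≤ ∑∑ (λ s → ∑ (λ v → cost (S v) (within (F v) D) v s))
        best = subst₂ _≤_ (cong (N * N *_) (∑-cong λ v → cong (λ f → cost (S v) (within f D) v seed) (F₁≡ v)))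
                          (∑∑-cong λ s → ∑-cong λ v → cong (λ f → cost (S v) (within f D) v s) (F₁≡ v)) Se.chosen-best

        module C = Choice S F F≤ D<INF (λ v u lt → proj₂ (F-sound v u lt)) seed best

        E₁ : Fin N → Table
        E₁ v = edges v (S v) (F₁ v) (exec select cost₁ v)

        E₁≡ : ∀ v → E₁ v ≡ C.E v
        E₁≡ v = cong₂ (edges v (S v)) (F₁≡ v) (Se.select-spec v)

        out : Fin N → Table × Table × Bool
        out = exec level st

        S′ : Fin N → Bool
        S′ v = proj₂ (proj₂ (out v))

        H′ : Fin N → Table
        H′ v = proj₁ (proj₂ (out v))

        S′≡ : ∀ v → S′ v ≡ C.S′ v
        S′≡ v = cong₂ (joins v (S v)) (F₁≡ v) (Se.select-spec v)

        H′≡ : ∀ v u → H′ v u ≡ Hm v u ⊓ (C.E v u ⊓ C.E u v)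
        H′≡ v u = cong (Hm v u ⊓_) (trans (mirror-spec E₁ (λ v u → subst (λ f → f u ≤ INF) (sym (E₁≡ v)) (C.E≤ v u)) v u)
          (cong₂ (λ f g → f u ⊓ g v) (E₁≡ v) (E₁≡ u)))

        open Add Hm C.E H′ Hv (λ x y lt → subst (Reach x y) (sym (C.E-sound x y lt)) (proj₁ (F-sound x y (subst (_< INF) (C.E-sound x y lt) lt)))) C.E≤ H′≡ public

        out-A : ∀ v → proj₁ (out v) ≡ A v
        out-A v = A≡ v

        S′-size : τ * τ ≤ k → τ * count S′ ≤ count S * 4
        S′-size le = ≤-trans (≤-reflexive (cong (τ *_) (∑-cong λ v → cong 𝟙 (S′≡ v)))) (C.S′-size le)

        E-size : entries# C.E ≤ count S + count S * (2 * τ)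
        E-size = C.E-size

        linked : ∀ v → S v ≡ true → (∃ λ p → S′ p ≡ true × (p ≡ v ⊎ H′ v p ≤ D)) ⊎
          (∀ u d → S u ≡ true → d ≤ D → Hops A h v u d → H′ v u ≤ d)
        linked v Sv = [ (λ (p , e , l) → inj₁ (p , trans (S′≡ p) e , [ inj₁ , (λ le → inj₂ (≤-trans (proj₂ (added≤ v p)) le)) ]′ l))
                      , (λ f → inj₂ λ u d Su d≤D hs → ≤-trans (proj₂ (added≤ v u)) (f u d d≤D (F-good v u d Su hs (≤-<-trans d≤D D<INF)))) ]′ (C.linked v Sv)

      module AtEnd (D : ℕ) (D<INF : D < INF) (st : Fin N → Table × Table × Bool)
        (A≡ : ∀ v → proj₁ (st v) ≡ A v) (Hv : Valid (λ v → proj₁ (proj₂ (st v)))) where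

        S : Fin N → Bool
        S v = proj₂ (proj₂ (st v))

        Hm : Fin N → Table
        Hm v = proj₁ (proj₂ (st v))

        open Explored S

        F₁ : Fin N → Table
        F₁ = exec (explore h) (λ v → proj₁ (st v) , source (S v) v)

        F₁≡ : ∀ v → F₁ v ≡ F v
        F₁≡ = exec-cong (explore h) (λ v → cong (_, source (S v) v) (A≡ v))

        E : Fin N → Table
        E v u = if S v ∧ within (F v) D u then F v u else INF

        E₁ : Fin N → Table
        E₁ v u = if S v ∧ within (F₁ v) D u then F₁ v u else INF

        E₁≡ : ∀ v u → E₁ v u ≡ E v u
        E₁≡ v u = cong (λ f → if S v ∧ within f D u then f u else INF) (F₁≡ v)

        E≤ : ∀ v u → E v u ≤ INF
        E≤ v u with S v ∧ within (F v) D u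
        ... | true  = F≤ v u
        ... | false = ≤-refl

        E-finite : ∀ v u → E v u < INF → S v ∧ within (F v) D u ≡ true
        E-finite v u lt = [ id , (λ f → ⊥-elim (<-irrefl (if-false f) lt)) ]′ (bool? (S v ∧ within (F v) D u))

        E-sound : Sound E
        E-sound v u lt = subst (Reach v u) (sym e) (proj₁ (F-sound v u (subst (_< INF) e lt)))
          where
          e : E v u ≡ F v u
          e = if-true (E-finite v u lt)

        H′ : Fin N → Table
        H′ = exec (closing D) st

        H′≡ : ∀ v u → H′ v u ≡ Hm v u ⊓ (E v u ⊓ E u v)
        H′≡ v u = cong (Hm v u ⊓_) (trans (mirror-spec E₁ (λ v u → ≤-trans (≤-reflexive (E₁≡ v u)) (E≤ v u)) v u) (cong₂ _⊓_ (E₁≡ v u) (E₁≡ u v)))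

        open Add Hm E H′ Hv E-sound E≤ H′≡ public

        E-size : entries# E ≤ count S * count S
        E-size = ≤-trans (∑-mono row-size) (≤-reflexive (∑-*ʳ (𝟙 ∘ S) (count S)))
          where
          row-size : ∀ v → size (E v) ≤ 𝟙 (S v) * count S
          row-size v = ≤-trans (∑-mono λ u → bit u) (≤-reflexive (∑-*ˡ (𝟙 (S v)) (𝟙 ∘ S)))
            where
            bit : ∀ u → 𝟙 (does (E v u <? INF)) ≤ 𝟙 (S v) * 𝟙 (S u)
            bit u = ≤-trans (𝟙-mono _ (S v ∧ S u) λ e → let a , b = ∧-true {S v} (E-finite v u (holds (E v u <? INF) e)) in
                true∧ a (proj₂ (F-sound v u (≤-<-trans (holds (F v u ≤? D) b) D<INF))))
              (≤-reflexive (𝟙-∧ (S v) (S u)))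

        linked : count S < k → ∀ v u d → S v ≡ true → S u ≡ true → d ≤ D → Hops A h v u d → H′ v u ≤ d
        linked few v u d Sv Su d≤D hs = ≤-trans (proj₂ (added≤ v u)) (go (F-good v u d Su hs (≤-<-trans d≤D D<INF)))
          where
          go : Good (F v) u d → E v u ≤ d
          go (inj₁ le) = ≤-trans (≤-reflexive (if-true (true∧ Sv (dec-true (F v u ≤? D) (≤-trans le d≤D))))) le
          go (inj₂ fl) = ⊥-elim (<-irrefl refl (≤-<-trans (≤-trans fl (count-mono λ w e →
            proj₂ (F-sound v w (≤-<-trans (≤-trans (holds (F v w ≤? d) e) d≤D) D<INF)))) few))

  -- All levels: number of edges and stretch

  module Emulate (h : ℕ) (D tt : ℕ → ℕ) (2tt≤L : ∀ i → tt i + tt i ≤ L) where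

    open Levels h

    stages : ℕ → Prog (Table × Table × Bool) (Table × Table × Bool)
    stages zero    = ret (λ _ s → s)
    stages (suc i) = stages i >>> Level.level (tt i) (2tt≤L i) (D i)

    emulate : ℕ → Prog Table Table
    emulate r = ret (λ _ A → A , (λ _ → INF) , true) >>> stages r >>> closing (D r)

    stages-rounds : ∀ i → rounds (stages i) ≡ i * (h * 6 + 5)
    stages-rounds zero    = refl
    stages-rounds (suc i) = trans (cong₂ _+_ (stages-rounds i) (Level.level-rounds (tt i) (2tt≤L i) (D i))) (+-comm (i * (h * 6 + 5)) (h * 6 + 5))

    emulate-rounds : ∀ r → rounds (emulate r) ≡ r * (h * 6 + 5) + (h * 6 + 1)
    emulate-rounds r = cong₂ _+_ (stages-rounds r) (closing-rounds (D r))

    module Outcome (G : Graph N) (A : Fin N → Table)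
      (A≤ : ∀ x y → A x y ≤ INF) (A0 : ∀ x → A x x ≡ 0) (A-sound : Lists.Sound G 1<INF A) (D<INF : ∀ i → D i < INF) where

      open Lists G 1<INF

      open Run G A A≤ A0 A-sound

      st : ℕ → Fin N → Table × Table × Bool
      st i = exec (stages i) (λ v → A v , (λ _ → INF) , true)

      S : ℕ → Fin N → Bool
      S i v = proj₂ (proj₂ (st i v))

      Hm : ℕ → Fin N → Table
      Hm i v = proj₁ (proj₂ (st i v))

      final : ℕ → Fin N → Table
      final r = exec (emulate r) A

      st-A : ∀ i v → proj₁ (st i v) ≡ A v
      valid : ∀ i → Valid (Hm i)

      module At (i : ℕ) = AtLevel (tt i) (2tt≤L i) (D i) (D<INF i) (st i) (st-A i) (valid i)

      st-A zero    v = refl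
      st-A (suc i) v = At.out-A i v

      valid zero = record
        { sound     = λ _ _ lt → ⊥-elim (<-irrefl refl lt)
        ; symmetric = λ _ _ → refl
        ; bounded   = λ _ _ → ≤-refl
        }
      valid (suc i) = At.added-valid i

      module End (r : ℕ) = AtEnd (D r) (D<INF r) (st r) (st-A r) (valid r)

      final-valid : ∀ r → Valid (final r)
      final-valid r = End.added-valid r

      final-symmetric : ∀ r x y → final r x y ≡ final r y x
      final-symmetric r = Valid.symmetric (final-valid r)

      final-sound : ∀ r → Sound (final r)
      final-sound r = Valid.sound (final-valid r)

      S-size : ∀ i → 2 ^ tt i * 2 ^ tt i ≤ k → 2 ^ tt i * count (S (suc i)) ≤ count (S i) * 4
      S-size i = At.S′-size i

      Hm-size : ∀ i → entries# (Hm (suc i)) ≤ entries# (Hm i) + 2 * (count (S i) + count (S i) * (2 * 2 ^ tt i))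
      Hm-size i = ≤-trans (At.added-size i) (+-monoʳ-≤ (entries# (Hm i)) (≤-trans (+-mono-≤ (At.E-size i) (At.E-size i)) (≤-reflexive (twice (count (S i) + count (S i) * (2 * 2 ^ tt i))))))
        where
        twice : ∀ x → x + x ≡ 2 * x
        twice = solve-∀

      final-size : ∀ r → entries# (final r) ≤ entries# (Hm r) + 2 * (count (S r) * count (S r))
      final-size r = ≤-trans (End.added-size r) (+-monoʳ-≤ (entries# (Hm r)) (≤-trans (+-mono-≤ (End.E-size r) (End.E-size r)) (≤-reflexive (twice (count (S r) * count (S r))))))
        where
        twice : ∀ x → x + x ≡ 2 * x
        twice = solve-∀

      Hm-suc : ∀ i x y → Hm (suc i) x y ≤ Hm i x y
      Hm-suc i x y = proj₁ (At.added≤ i x y)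

      Hm-mono : ∀ i j x y → Hm (j + i) x y ≤ Hm i x y
      Hm-mono i zero    x y = ≤-refl
      Hm-mono i (suc j) x y = ≤-trans (Hm-suc (j + i) x y) (Hm-mono i j x y)

      final≤ : ∀ r i → i ≤ r → ∀ x y → final r x y ≤ Hm i x y
      final≤ r i i≤r x y = ≤-trans (proj₁ (End.added≤ r x y)) (subst (λ j → Hm j x y ≤ Hm i x y) (m∸n+n≡m i≤r) (Hm-mono i (r ∸ i) x y))

      linked : ∀ i v → S i v ≡ true → (∃ λ p → S (suc i) p ≡ true × (p ≡ v ⊎ Hm (suc i) v p ≤ D i)) ⊎
        (∀ u d → S i u ≡ true → d ≤ D i → Hops A h v u d → Hm (suc i) v u ≤ d)
      linked i = At.linked i

      linked-end : ∀ r → count (S r) < k → ∀ v u d → S r v ≡ true → S r u ≡ true → d ≤ D r → Hops A h v u d → final r v u ≤ d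
      linked-end r = End.linked r

      entries#-none : entries# (Hm 0) ≡ 0
      entries#-none = trans (∑-cong λ v → count-none {N} (λ _ → does (INF <? INF)) (λ _ → dec-false (INF <? INF) (<-irrefl refl))) (∑-0 N)

      module Sizes (a E : ℕ) (L≡ : L ≡ a + a + (a + a)) (AA : ℕ → ℕ) (AA0 : AA 0 ≡ 0) (AA-mono : ∀ i → AA i ≤ AA (suc i))
        (AA-step : ∀ i → AA (suc i) ≤ AA i + a) (AA-double : ∀ i → AA (suc i) ≤ AA i + AA i + E)
        (tt≡ : ∀ i → tt i ≡ 2 + (AA (suc i) ∸ AA i)) (16≤K : 16 ≤ K) (q≡ : q ≡ 2 ^ (a + a)) where

        δ : ℕ → ℕ
        δ i = AA (suc i) ∸ AA i

        τ≡ : ∀ i → 2 ^ tt i ≡ 4 * 2 ^ δ i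
        τ≡ i = trans (cong (2 ^_) (tt≡ i)) (^-distribˡ-+-* 2 2 (δ i))

        δ≤a : ∀ i → δ i ≤ a
        δ≤a i = ≤-trans (∸-monoˡ-≤ (AA i) (AA-step i)) (≤-reflexive (m+n∸m≡n (AA i) a))

        ττ≤k : ∀ i → 2 ^ tt i * 2 ^ tt i ≤ k
        ττ≤k i = begin
          2 ^ tt i * 2 ^ tt i               ≡⟨ cong₂ _*_ (τ≡ i) (τ≡ i) ⟩
          4 * 2 ^ δ i * (4 * 2 ^ δ i)       ≡⟨ sixteen (2 ^ δ i) ⟩
          2 ^ δ i * 2 ^ δ i * 16            ≤⟨ *-mono-≤ (≤-trans (*-mono-≤ (^-monoʳ-≤ 2 (δ≤a i)) (^-monoʳ-≤ 2 (δ≤a i))) (≤-reflexive (trans (sym (^-distribˡ-+-* 2 a a)) (sym q≡)))) 16≤K ⟩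
          k                                 ∎
          where
          open ≤-Reasoning
          sixteen : ∀ x → 4 * x * (4 * x) ≡ x * x * 16
          sixteen = solve-∀

        -- The summand 2 in `tt` makes the sample four times sparser, which absorbs the constant 4
        -- of `S-size`.
        shrink : ∀ i → 2 ^ δ i * count (S (suc i)) ≤ count (S i)
        shrink i = *-cancelˡ-≤ 4 (≤-trans (≤-reflexive (trans (sym (*-assoc 4 (2 ^ δ i) _)) (cong (_* count (S (suc i))) (sym (τ≡ i)))))
          (≤-trans (S-size i (ττ≤k i)) (≤-reflexive (*-comm (count (S i)) 4))))

        thin : ∀ i → count (S i) * 2 ^ AA i ≤ N
        thin zero    = ≤-trans (≤-reflexive (trans (cong (λ x → count (S 0) * 2 ^ x) AA0) (*-identityʳ _))) (count≤n (S 0))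
        thin (suc i) = begin
          count (S (suc i)) * 2 ^ AA (suc i)             ≡⟨ cong (λ x → count (S (suc i)) * 2 ^ x) (sym (m∸n+n≡m (AA-mono i))) ⟩
          count (S (suc i)) * 2 ^ (δ i + AA i)           ≡⟨ cong (count (S (suc i)) *_) (^-distribˡ-+-* 2 (δ i) (AA i)) ⟩
          count (S (suc i)) * (2 ^ δ i * 2 ^ AA i)       ≡⟨ regroup (count (S (suc i))) (2 ^ δ i) (2 ^ AA i) ⟩
          2 ^ δ i * count (S (suc i)) * 2 ^ AA i         ≤⟨ *-monoˡ-≤ (2 ^ AA i) (shrink i) ⟩
          count (S i) * 2 ^ AA i                         ≤⟨ thin i ⟩
          N                                              ∎
          where
          open ≤-Reasoning
          regroup : ∀ x y z → x * (y * z) ≡ y * x * z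
          regroup = solve-∀

        1≤2^ : ∀ x → 1 ≤ 2 ^ x
        1≤2^ x = m^n>0 2 x

        -- The missed lists cost |S i| * 2^δ up to a constant, with δ at most `AA i + E`, while
        -- `thin` bounds |S i| * 2^(AA i) by N. A sparse level can thus afford an equally large
        -- further thinning.
        per-level : ∀ i → count (S i) + count (S i) * (2 * 2 ^ tt i) ≤ 9 * (N * 2 ^ E)
        per-level i = begin
          count (S i) + count (S i) * (2 * 2 ^ tt i)            ≡⟨ cong (λ x → count (S i) + count (S i) * (2 * x)) (τ≡ i) ⟩
          count (S i) + count (S i) * (2 * (4 * 2 ^ δ i))       ≡⟨ cong (count (S i) +_) (eight (count (S i)) (2 ^ δ i)) ⟩
          count (S i) + 8 * (count (S i) * 2 ^ δ i)             ≤⟨ +-mono-≤ small (*-monoʳ-≤ 8 product≤) ⟩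
          N * 2 ^ E + 8 * (N * 2 ^ E)                           ∎
          where
          open ≤-Reasoning
          eight : ∀ x y → x * (2 * (4 * y)) ≡ 8 * (x * y)
          eight = solve-∀
          small : count (S i) ≤ N * 2 ^ E
          small = ≤-trans (count≤n (S i)) (≤-trans (≤-reflexive (sym (*-identityʳ N))) (*-monoʳ-≤ N (1≤2^ E)))
          product≤ : count (S i) * 2 ^ δ i ≤ N * 2 ^ E
          product≤ = ≤-trans (*-monoʳ-≤ (count (S i)) (≤-trans (^-monoʳ-≤ 2 (≤-trans (∸-monoˡ-≤ (AA i) (AA-double i))
              (≤-reflexive (trans (cong (_∸ AA i) (+-assoc (AA i) (AA i) E)) (m+n∸m≡n (AA i) (AA i + E)))))) (≤-reflexive (^-distribˡ-+-* 2 (AA i) E))))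
            (≤-trans (≤-reflexive (sym (*-assoc (count (S i)) (2 ^ AA i) (2 ^ E)))) (*-monoˡ-≤ (2 ^ E) (thin i)))

        Hm-total : ∀ i → entries# (Hm i) ≤ i * (18 * (N * 2 ^ E))
        Hm-total zero    = ≤-reflexive entries#-none
        Hm-total (suc i) = ≤-trans (Hm-size i) (≤-trans (+-mono-≤ (Hm-total i) (≤-trans (*-monoʳ-≤ 2 (per-level i)) (≤-reflexive (sym (*-assoc 2 9 (N * 2 ^ E))))))
          (≤-reflexive (+-comm _ (18 * (N * 2 ^ E)))))

        S-end : ∀ r → AA r ≡ a + a → count (S r) ≤ q
        S-end r e = *-cancelʳ-≤ (count (S r)) q q (≤-trans (≤-reflexive (cong (count (S r) *_) (trans q≡ (cong (2 ^_) (sym e))))) (thin r))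

        -- Edges are recorded at both ends: 2 * 9 per level, and 2 for the at most `q * q = N` pairs
        -- of the last level.
        total : ∀ r → 1 ≤ r → AA r ≡ a + a → entries# (final r) ≤ 20 * (r * (N * 2 ^ E))
        total r 1≤r e = begin
          entries# (final r)                                            ≤⟨ final-size r ⟩
          entries# (Hm r) + 2 * (count (S r) * count (S r))             ≤⟨ +-mono-≤ (Hm-total r) (*-monoʳ-≤ 2 (≤-trans (*-mono-≤ (S-end r e) (S-end r e)) N≤)) ⟩
          r * (18 * (N * 2 ^ E)) + 2 * (r * (N * 2 ^ E))                ≡⟨ twenty r (N * 2 ^ E) ⟩
          20 * (r * (N * 2 ^ E))                                        ∎
          where
          open ≤-Reasoning
          twenty : ∀ r x → r * (18 * x) + 2 * (r * x) ≡ 20 * (r * x)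
          twenty = solve-∀
          N≤ : N ≤ r * (N * 2 ^ E)
          N≤ = ≤-trans (≤-trans (≤-reflexive (sym (*-identityʳ N))) (*-monoʳ-≤ N (1≤2^ E))) (≤-trans (≤-reflexive (sym (*-identityˡ _))) (*-monoˡ-≤ (N * 2 ^ E) 1≤r))

        few : ∀ r → AA r ≡ a + a → count (S r) < k
        few r e = ≤-<-trans (S-end r e) (<-≤-trans (m<m*n q 2 (s≤s (s≤s z≤n))) (*-monoʳ-≤ q (≤-trans (m≤m+n 2 14) 16≤K)))

      module Quality (e r : ℕ) (1≤e : 1 ≤ e) (1≤r : 1 ≤ r) (last-few : count (S r) < k)
        (D≡ : ∀ i → D i ≡ (4 * (256 * (e * r)) ^ i) ⊓ (2 * N)) (2N<INF : 2 * N < INF)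
        (explored : ∀ {x y z} → Walk G x y z → z ≤ N → z ≤ 2 * (256 * (e * r)) ^ r → Σ[ d ∈ ℕ ] (4 * e * d ≤ (4 * e + 1) * z × Hops A h x y d)) where

        open Walks G
        open Chains {N} {INF} {final r}

        H : Fin N → Table
        H = final r

        module St = Stretch {N} {INF} G H S e r 1≤e 1≤r (Valid.symmetric (final-valid r)) (Valid.sound (final-valid r))

        1≤ρ : 1 ≤ St.ρ
        1≤ρ = ≤-trans (*-mono-≤ 1≤e 1≤r) (m≤n*m (e * r) 256)

        -- Stretch 2 applied to a walk of length at most `2ρ^i`, shortened to at most N steps, gives
        -- the two terms `4ρ^i` and 2N in `D i`; the second stays below INF.
        found : ∀ i → i ≤ r → ∀ {v u z} → Walk G v u z → z ≤ 2 * St.ρ ^ i → Σ[ d ∈ ℕ ] (d ≤ D i × 4 * e * d ≤ (4 * e + 1) * z × Hops A h v u d)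
        found i i≤r {v} {u} {z} w z≤ =
          let z′ , z′≤z , z′≤N , w′ = shorten z w
              d , cost , hs = explored w′ z′≤N (≤-trans z′≤z (≤-trans z≤ (*-monoʳ-≤ 2 (^-monoʳ-≤ St.ρ {{ℕ.>-nonZero 1≤ρ}} i≤r))))
              d≤2z′ = twice cost
          in  d , ≤-trans (⊓-glb (≤-trans d≤2z′ (≤-trans (*-monoʳ-≤ 2 (≤-trans z′≤z z≤)) (≤-reflexive (sym (*-assoc 2 2 (St.ρ ^ i)))))) (≤-trans d≤2z′ (*-monoʳ-≤ 2 z′≤N)))
                          (≤-reflexive (sym (D≡ i))) ,
              ≤-trans cost (*-monoʳ-≤ (4 * e + 1) z′≤z) , hs
          where
          twice : ∀ {d z} → 4 * e * d ≤ (4 * e + 1) * z → d ≤ 2 * z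
          twice {d} {z} le = *-cancelˡ-≤ (4 * e) {{ℕ.>-nonZero (≤-trans 1≤e (m≤n*m e 4))}} (≤-trans le
            (≤-trans (*-monoˡ-≤ z (+-monoʳ-≤ (4 * e) (≤-trans 1≤e (m≤n*m e 4)))) (≤-reflexive (dbl (4 * e) z))))
            where
            dbl : ∀ x z → (x + x) * z ≡ x * (2 * z)
            dbl = solve-∀

        D-small : ∀ i → D i ≤ 4 * St.ρ ^ i
        D-small i = ≤-trans (≤-reflexive (D≡ i)) (m⊓n≤m _ _)

        chain : ∀ {v u d} → H v u ≤ d → d < INF → Σ[ c ∈ ℕ ] (Chain INF H v u c × c ≤ d)
        chain le lt = _ , one (≤-<-trans le lt) , le

        joined : ∀ i → i ≤ r → ∀ v → (∀ u d → S i u ≡ true → d ≤ D i → Hops A h v u d → H v u ≤ d) → St.Joined i v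
        joined i i≤r v f {u} Su w z≤ =
          let d , d≤ , cost , hs = found i i≤r w z≤
              c , p , c≤ = chain (f u d Su d≤ hs) (≤-<-trans d≤ (D<INF i))
          in  c , p , ≤-trans (*-monoʳ-≤ (4 * e) c≤) cost

        S₀ : ∀ v → S 0 v ≡ true
        S₀ v = refl

        levels : ∀ i → i < r → ∀ v → S i v ≡ true → St.Raised i v (4 * St.ρ ^ i) ⊎ St.Joined i v
        levels i i<r v Sv = [ (λ (p , Sp , c) → inj₁ (p , Sp , raise p c)) ,
            (λ f → inj₂ λ {u} {z} → joined i (<⇒≤ i<r) v (λ u d Su d≤ hs → ≤-trans (final≤ r (suc i) i<r v u) (f u d Su d≤ hs)) {u} {z}) ]′ (linked i v Sv)
          where
          raise : ∀ p → p ≡ v ⊎ Hm (suc i) v p ≤ D i → Σ[ w ∈ ℕ ] (Chain INF H v p w × w ≤ 4 * St.ρ ^ i)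
          raise p (inj₁ eq) = 0 , subst (λ z → Chain INF H v z 0) (sym eq) end , z≤n
          raise p (inj₂ le) = let c , ch , c≤ = chain (≤-trans (final≤ r (suc i) i<r v p) le) (D<INF i) in c , ch , ≤-trans c≤ (D-small i)

        last : ∀ v → S r v ≡ true → St.Joined r v
        last v Sv = joined r ≤-refl v (λ u d Su d≤ hs → linked-end r last-few v u d Sv Su d≤ hs)

        stretch : ∀ {x y ℓ} → Walk G x y ℓ → Σ[ w ∈ ℕ ] (Chain INF H x y w × e * w ≤ (e + 1) * ℓ + e * (64 * (256 * (e * r)) ^ (r ∸ 1)))
        stretch = St.Analysis.stretch S₀ levels last

  -- Composition of approximate distances and emulator

  module Assembly (a e r J a′ E : ℕ) (AA : ℕ → ℕ) (2a≤L : a + a ≤ L) (ττ≡q : 2 ^ a * 2 ^ a ≡ q)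
    (costW′ : q * q * (q * q * (2 ^ a * 2 ^ a + q * q)) < W)
    (2tt≤L : ∀ i → 2 + (AA (suc i) ∸ AA i) + (2 + (AA (suc i) ∸ AA i)) ≤ L) where

    ρ h : ℕ
    ρ = 256 * (e * r)
    h = 2 ^ a′ * 2 + 8

    D : ℕ → ℕ
    D i = (4 * ρ ^ i) ⊓ (2 * N)

    row : Graph N → Fin N → Table
    row G x u = if Graph.adj G x u then 1 else INF

    opaque

      woven : Prog Table Table
      woven = Scales.weave a 2a≤L ττ≡q costW′ J a′

      program : Prog Table Table
      program = woven >>> Emulate.emulate h D (λ i → 2 + (AA (suc i) ∸ AA i)) 2tt≤L r

      program-rounds : rounds program ≡ suc J * 6 + (J ∸ a′) * (13 + h * 12) + (r * (h * 6 + 5) + (h * 6 + 1))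
      program-rounds = cong₂ _+_ (Scales.weave-rounds a 2a≤L ττ≡q costW′ J a′)
        (Emulate.emulate-rounds h D (λ i → 2 + (AA (suc i) ∸ AA i)) 2tt≤L r)

    module Result (1≤e : 1 ≤ e) (1≤r : 1 ≤ r) (2^J≤N : 2 ^ J ≤ N) (INF≡4N : INF ≡ 4 * N) (5≤a′ : 5 ≤ a′) (144J≤ : 144 * J ≤ 2 ^ a′)
      (576eJ≤ : 4 * e * (144 * J) ≤ 2 ^ a′) (≤2^J : ∀ {z} → z ≤ N → z ≤ 2 * ρ ^ r → z ≤ 2 ^ J)
      (L≡ : L ≡ a + a + (a + a)) (AA0 : AA 0 ≡ 0) (AA-mono : ∀ i → AA i ≤ AA (suc i)) (AA-step : ∀ i → AA (suc i) ≤ AA i + a)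
      (AA-double : ∀ i → AA (suc i) ≤ AA i + AA i + E) (AA-end : AA r ≡ a + a) (q≡ : q ≡ 2 ^ (a + a)) (G : Graph N) where

      open Walks G

      H A : Fin N → Table
      H = exec program (row G)
      A = exec woven (row G)

      2N<INF : 2 * N < INF
      2N<INF = Scales.Spec.2N<INF a 2a≤L ττ≡q costW′ J a′ G 2^J≤N INF≡4N 5≤a′ 144J≤

      D<INF : ∀ i → D i < INF
      D<INF i = ≤-<-trans (m⊓n≤n (4 * ρ ^ i) (2 * N)) 2N<INF

      opaque
        unfolding program

        facts : (∀ x y → A x y ≤ INF) × (∀ x → A x x ≡ 0) × Lists.Sound G 1<INF A ×
          (∀ {x y ℓ} → Walk G x y ℓ → ℓ ≤ 2 ^ J → Σ[ d ∈ ℕ ] (2 ^ a′ * d ≤ (2 ^ a′ + 144 * (J ∸ a′)) * ℓ × Hops A h x y d))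
        facts = Scales.Spec.woven-facts a 2a≤L ττ≡q costW′ J a′ G 2^J≤N INF≡4N 5≤a′ 144J≤

        H≡ : H ≡ exec (Emulate.emulate h D (λ i → 2 + (AA (suc i) ∸ AA i)) 2tt≤L r) A
        H≡ = refl

      explored : ∀ {x y z} → Walk G x y z → z ≤ N → z ≤ 2 * ρ ^ r → Σ[ d ∈ ℕ ] (4 * e * d ≤ (4 * e + 1) * z × Hops A h x y d)
      explored {z = z} w z≤N z≤ = let d , cost , hs = proj₂ (proj₂ (proj₂ facts)) w (≤2^J z≤N z≤) in d , rescale cost , hs
        where
        -- The accumulated relative error, at most 144 J / 2^a′, has to stay below the 1/(4e)
        -- granted to exploration; this is where 576 = 4 * 144 comes from.
        rescale : ∀ {d} → 2 ^ a′ * d ≤ (2 ^ a′ + 144 * (J ∸ a′)) * z → 4 * e * d ≤ (4 * e + 1) * z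
        rescale {d} cost = *-cancelˡ-≤ (2 ^ a′) {{m^n≢0 2 a′}} (begin
          2 ^ a′ * (4 * e * d)                            ≡⟨ swap₁ (2 ^ a′) (4 * e) d ⟩
          4 * e * (2 ^ a′ * d)                            ≤⟨ *-monoʳ-≤ (4 * e) (≤-trans cost (*-monoˡ-≤ z (+-monoʳ-≤ (2 ^ a′) (*-monoʳ-≤ 144 (m∸n≤m J a′))))) ⟩
          4 * e * ((2 ^ a′ + 144 * J) * z)                ≡⟨ expand (4 * e) (2 ^ a′) (144 * J) z ⟩
          4 * e * 2 ^ a′ * z + 4 * e * (144 * J) * z      ≤⟨ +-monoʳ-≤ (4 * e * 2 ^ a′ * z) (*-monoˡ-≤ z 576eJ≤) ⟩
          4 * e * 2 ^ a′ * z + 2 ^ a′ * z                 ≡⟨ collect (4 * e) (2 ^ a′) z ⟩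
          2 ^ a′ * ((4 * e + 1) * z)                      ∎)
          where
          open ≤-Reasoning
          swap₁ : ∀ x y z → x * (y * z) ≡ y * (x * z)
          swap₁ = solve-∀
          expand : ∀ x y w z → x * ((y + w) * z) ≡ x * y * z + x * w * z
          expand = solve-∀
          collect : ∀ x y z → x * y * z + y * z ≡ y * ((x + 1) * z)
          collect = solve-∀

      A≤ = proj₁ facts
      A0 = proj₁ (proj₂ facts)
      A-sound = proj₁ (proj₂ (proj₂ facts))

      open Emulate h D (λ i → 2 + (AA (suc i) ∸ AA i)) 2tt≤L using (module Outcome)

      Correct : (Fin N → Table) → Set
      Correct H = (∀ x y → H x y ≡ H y x) × (∀ x y → H x y < INF → Σ[ ℓ ∈ ℕ ] (ℓ ≤ H x y × Walk G x y ℓ)) ×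
        ∑ (λ v → count (λ u → does (H v u <? INF))) ≤ 20 * (r * (N * 2 ^ E)) ×
        (∀ {x y ℓ} → Walk G x y ℓ → Σ[ w ∈ ℕ ] (Chain INF H x y w × e * w ≤ (e + 1) * ℓ + e * (64 * ρ ^ (r ∸ 1))))

      correct : Correct H
      correct = subst Correct (sym H≡)
        ( Outcome.final-symmetric G A A≤ A0 A-sound D<INF r
        , Outcome.final-sound G A A≤ A0 A-sound D<INF r
        , Outcome.Sizes.total G A A≤ A0 A-sound D<INF a E L≡ AA AA0 AA-mono AA-step AA-double (λ _ → refl) 16≤K q≡ r 1≤r AA-end
        , Outcome.Quality.stretch G A A≤ A0 A-sound D<INF e r 1≤e 1≤r
            (Outcome.Sizes.few G A A≤ A0 A-sound D<INF a E L≡ AA AA0 AA-mono AA-step AA-double (λ _ → refl) 16≤K q≡ r AA-end)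
            (λ _ → refl) 2N<INF explored )
        where
        16≤K : 16 ≤ K
        16≤K = ≤-trans (m≤m+n 16 2) 18≤K

-- Logarithms, densities and the round count

up : ℕ → ℕ
up zero    = 0
up (suc n) = if does (suc n ≤? 2 ^ up n) then up n else suc (up n)

≤2^up : ∀ n → n ≤ 2 ^ up n
≤2^up zero    = z≤n
≤2^up (suc n) with bool? (does (suc n ≤? 2 ^ up n))
... | inj₁ e rewrite e = holds (suc n ≤? 2 ^ up n) e
... | inj₂ e rewrite e = ≤-trans (+-mono-≤ (m^n>0 2 (up n)) (≤2^up n)) (≤-reflexive (cong (2 ^ up n +_) (sym (+-identityʳ _))))

2^up-suc≤ : ∀ n → 2 ^ up (suc n) ≤ 2 * suc n
2^up-suc≤ zero    = s≤s z≤n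
2^up-suc≤ (suc n) = go (bool? (does (suc (suc n) ≤? 2 ^ up (suc n))))
  where
  go : (does (suc (suc n) ≤? 2 ^ up (suc n)) ≡ true) ⊎ (does (suc (suc n) ≤? 2 ^ up (suc n)) ≡ false) → 2 ^ up (suc (suc n)) ≤ 2 * suc (suc n)
  go (inj₁ e) = ≤-trans (≤-reflexive (cong (2 ^_) (if-true e))) (≤-trans (2^up-suc≤ n) (*-monoʳ-≤ 2 (n≤1+n (suc n))))
  go (inj₂ e) = ≤-trans (≤-reflexive (cong (2 ^_) (if-false e))) (*-monoʳ-≤ 2 (<⇒≤ (≰⇒> (fails (suc (suc n) ≤? 2 ^ up (suc n)) e))))

2^up≤ : ∀ n → 1 ≤ n → 2 ^ up n ≤ 2 * n
2^up≤ (suc n) _ = 2^up-suc≤ n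

m≤2^m : ∀ m → m < 2 ^ m
m≤2^m zero    = s≤s z≤n
m≤2^m (suc m) = ≤-trans (+-mono-≤ (m^n>0 2 m) (m≤2^m m)) (≤-reflexive (cong (2 ^ m +_) (sym (+-identityʳ _))))

2^-cancel : ∀ {m n} → 2 ^ m ≤ 2 ^ n → m ≤ n
2^-cancel {m} {n} le = ≮⇒≥ λ n<m → <-irrefl refl (<-≤-trans (^-monoʳ-< 2 (s≤s (s≤s z≤n)) n<m) le)

-- The exponents of the densities of the levels: at most doubling, at most a per step,
-- and reaching a + a after r steps.

module Exponents (a r : ℕ) (2≤r : 2 ≤ r) where

  instance
    2^r≢0 : NonZero (2 ^ r)
    2^r≢0 = m^n≢0 2 r

  -- As `N = 2 ^ (4 * a)`, the power `2 ^ E` is N^(1/2^r) up to a factor 2.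
  E : ℕ
  E = suc (4 * a / 2 ^ r)

  AA : ℕ → ℕ
  AA zero    = 0
  -- Doubling bounds the edges of a level, the step a keeps `τ * τ ≤ k`, and at the cap 2a at most q
  -- vertices are left.
  AA (suc i) = (AA i + AA i + E) ⊓ ((AA i + a) ⊓ (a + a))

  AA≤2a : ∀ i → AA i ≤ a + a
  AA≤2a zero    = z≤n
  AA≤2a (suc i) = ≤-trans (m⊓n≤n (AA i + AA i + E) _) (m⊓n≤n (AA i + a) (a + a))

  AA-mono : ∀ i → AA i ≤ AA (suc i)
  AA-mono i = ⊓-glb (≤-trans (m≤m+n (AA i) (AA i)) (m≤m+n _ E)) (⊓-glb (m≤m+n (AA i) a) (AA≤2a i))

  AA-step : ∀ i → AA (suc i) ≤ AA i + a
  AA-step i = ≤-trans (m⊓n≤n (AA i + AA i + E) _) (m⊓n≤m (AA i + a) (a + a))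

  AA-double : ∀ i → AA (suc i) ≤ AA i + AA i + E
  AA-double i = m⊓n≤m _ _

  ≤AA-suc : ∀ i {b} → b ≤ AA i + AA i + E → b ≤ AA i + a → b ≤ a + a → b ≤ AA (suc i)
  ≤AA-suc i p s t = ⊓-glb p (⊓-glb s t)

  4a≤ : 4 * a ≤ 2 ^ r * E
  4a≤ = ≤-trans (≤-reflexive (m≡m%n+[m/n]*n (4 * a) (2 ^ r))) (≤-trans (+-monoˡ-≤ _ (<⇒≤ (m%n<n (4 * a) (2 ^ r))))
    (≤-reflexive (*-comm E (2 ^ r))))

  E-upper : E * 2 ^ r ≤ 4 * a + 2 ^ r
  E-upper = ≤-trans (+-monoʳ-≤ (2 ^ r) (≤-trans (m≤n+m _ (4 * a % 2 ^ r)) (≤-reflexive (sym (m≡m%n+[m/n]*n (4 * a) (2 ^ r))))))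
    (≤-reflexive (+-comm (2 ^ r) (4 * a)))

  -- `AA i + E` at least doubles at every step until it reaches a.
  growth : ∀ i → (2 ^ i * E) ⊓ a ≤ AA i + E
  growth zero    = ≤-trans (m⊓n≤m (1 * E) a) (≤-reflexive (*-identityˡ E))
  growth (suc i) = [ (λ 2A+E → ≤-trans (≤-trans double (≤-reflexive (shift (AA i) E))) (+-monoˡ-≤ E (≤-reflexive (sym 2A+E))))
                   , (λ other → ≤-trans (m⊓n≤n (2 ^ suc i * E) a) (≤-trans ([ (λ s → ≤-trans (m≤n+m a (AA i)) (≤-reflexive (sym (trans other s))))
                                                            , (λ s → ≤-trans (m≤m+n a a) (≤-reflexive (sym (trans other s)))) ]′ (⊓-sel (AA i + a) (a + a))) (m≤m+n _ E))) ]′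
    (⊓-sel (AA i + AA i + E) ((AA i + a) ⊓ (a + a)))
    where
    shift : ∀ x e → x + e + (x + e) ≡ x + x + e + e
    shift = solve-∀
    double : (2 ^ suc i * E) ⊓ a ≤ AA i + E + (AA i + E)
    double = [ (λ e → ≤-trans (≤-trans (m⊓n≤m (2 ^ suc i * E) a) (≤-reflexive (twice (2 ^ i) E)))
                              (+-mono-≤ (≤-trans (≤-reflexive (sym e)) (growth i)) (≤-trans (≤-reflexive (sym e)) (growth i))))
             , (λ e → ≤-trans (m⊓n≤n (2 ^ suc i * E) a) (≤-trans (≤-trans (≤-reflexive (sym e)) (growth i)) (m≤m+n _ _))) ]′ (⊓-sel (2 ^ i * E) a)
      where
      twice : ∀ x e → 2 * x * e ≡ x * e + x * e
      twice = solve-∀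

  -- `E ≥ 4a / 2 ^ r` brings `AA + E` to a after r - 2 steps; the next step brings `AA` itself to a,
  -- and the last one adds a.
  AA-end : AA r ≡ a + a
  AA-end = ≤-antisym (AA≤2a r) (subst (λ i → a + a ≤ AA i) (m+[n∸m]≡n 2≤r) (top (r ∸ 2) reach))
    where
    reach : a ≤ AA (r ∸ 2) + E
    reach = ≤-trans (⊓-glb (*-cancelˡ-≤ 4 (≤-trans 4a≤ (≤-reflexive (trans (cong (λ i → 2 ^ i * E) (sym (m+[n∸m]≡n 2≤r)))
      (trans (cong (_* E) (^-distribˡ-+-* 2 2 (r ∸ 2))) (*-assoc 4 (2 ^ (r ∸ 2)) E)))))) ≤-refl) (growth (r ∸ 2))
    top : ∀ i → a ≤ AA i + E → a + a ≤ AA (suc (suc i))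
    top i le = ≤AA-suc (suc i) (≤-trans (+-mono-≤ first first) (m≤m+n _ E)) (+-monoˡ-≤ a first) ≤-refl
      where
      first : a ≤ AA (suc i)
      first = ≤AA-suc i (≤-trans le (≤-trans (m≤n+m (AA i + E) (AA i)) (≤-reflexive (sym (+-assoc (AA i) (AA i) E))))) (m≤n+m a (AA i)) (m≤m+n a a)

-- The summands are the nearest lists, the doublings, the levels and the closing. With h = O(e J)
-- all of them are O(e (J + r)²).
rounds-bound : ∀ c e J r h → 1 ≤ e → h ≤ c * (e * suc J) →
  suc J * 6 + J * (13 + h * 12) + (r * (h * 6 + 5) + (h * 6 + 1)) ≤ (25 + 24 * c) * (e * ((suc J + r) * (suc J + r)))
rounds-bound c e J r h 1≤e h≤ = ≤-trans
  (+-mono-≤ (+-mono-≤ (≤-trans (≤-reflexive (*-comm (suc J) 6)) (*-monoʳ-≤ 6 (≤-trans J≤Y Y≤Z)))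
                      (≤-trans (*-mono-≤ (≤-trans (n≤1+n J) J≤Y) (+-monoʳ-≤ 13 (*-monoˡ-≤ 12 h≤Y))) (≤-trans (≤-reflexive (second Y c e)) (+-monoˡ-≤ _ (*-monoʳ-≤ 13 Y≤Z)))))
            (+-mono-≤ (≤-trans (*-mono-≤ (m≤n+m r (suc J)) (+-monoˡ-≤ 5 (*-monoˡ-≤ 6 h≤Y))) (≤-trans (≤-reflexive (third Y c e)) (+-monoʳ-≤ _ (*-monoʳ-≤ 5 Y≤Z))))
                      (+-mono-≤ (≤-trans (*-monoˡ-≤ 6 h≤Y) (≤-trans (≤-reflexive (fourth Y c e)) (*-monoʳ-≤ (6 * c) (*-monoʳ-≤ e Y≤YY)))) (≤-trans 1≤Y Y≤Z))))
  (≤-reflexive (collect c Z))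
  where
  Y Z : ℕ
  Y = suc J + r
  Z = e * (Y * Y)
  1≤Y : 1 ≤ Y
  1≤Y = s≤s z≤n
  J≤Y : suc J ≤ Y
  J≤Y = m≤m+n (suc J) r
  Y≤YY : Y ≤ Y * Y
  Y≤YY = m≤m*n Y Y
  Y≤Z : Y ≤ Z
  Y≤Z = ≤-trans Y≤YY (≤-trans (≤-reflexive (sym (*-identityˡ _))) (*-monoˡ-≤ (Y * Y) 1≤e))
  h≤Y : h ≤ c * (e * Y)
  h≤Y = ≤-trans h≤ (*-monoʳ-≤ c (*-monoʳ-≤ e J≤Y))
  second : ∀ y c e → y * (13 + c * (e * y) * 12) ≡ 13 * y + 12 * c * (e * (y * y))
  second = solve-∀
  third : ∀ y c e → y * (c * (e * y) * 6 + 5) ≡ 6 * c * (e * (y * y)) + 5 * y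
  third = solve-∀
  fourth : ∀ y c e → c * (e * y) * 6 ≡ 6 * c * (e * y)
  fourth = solve-∀
  collect : ∀ c z → 6 * z + (13 * z + 12 * c * z) + (6 * c * z + 5 * z + (6 * c * z + z)) ≡ (25 + 24 * c) * z
  collect = solve-∀

-- The constants are opaque because Agda compares products with a numeral factor by
-- unfolding them.

opaque

  rate : ℕ
  rate = 25 + 24 * 2312

  rate-bound : ∀ e J r h → 1 ≤ e → h ≤ 2312 * (e * suc J) →
    suc J * 6 + J * (13 + h * 12) + (r * (h * 6 + 5) + (h * 6 + 1)) ≤ rate * (e * ((suc J + r) * (suc J + r)))
  rate-bound = rounds-bound 2312

  steep : ℕ
  steep = 64 * 256

  steep-* : ∀ x → 64 * (256 * x) ≡ steep * x
  steep-* x = sym (*-assoc 64 256 x)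

  1≤steep : 1 ≤ steep
  1≤steep = s≤s z≤n


-- Choice of the parameters on N vertices

module Clique (a e r : ℕ) (3≤a : 3 ≤ a) (1≤e : 1 ≤ e) (2≤r : 2 ≤ r) where

  open Exponents a r 2≤r public

  -- INF exceeds the largest distance 2N in use, and W the largest word, a total of N² costs of at
  -- most 2N each. J is the logarithm of the longest walk to be explored, capped by that of N, and
  -- `2 ^ a′` is of order e J.
  q K′ L N INF W ρ J a′ h : ℕ
  q   = 2 ^ (a + a)
  K′  = 17
  L   = a + a + (a + a)
  N   = q * q
  INF = 4 * N
  W   = N * N * (N * N)
  ρ   = 256 * (e * r)
  J   = up (2 * ρ ^ r) ⊓ L
  a′  = up (576 * (e * suc J))
  h   = 2 ^ a′ * 2 + 8

  instance
    q≢0 : NonZero q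
    q≢0 = m^n≢0 2 (a + a)
    N≢0 : NonZero N
    N≢0 = m*n≢0 q q
    NN≢0 : NonZero (N * N)
    NN≢0 = m*n≢0 N N
    W≢0 : NonZero W
    W≢0 = m*n≢0 (N * N) (N * N)

  N≡2^L : N ≡ 2 ^ L
  N≡2^L = sym (^-distribˡ-+-* 2 (a + a) (a + a))

  ττ≡q : 2 ^ a * 2 ^ a ≡ q
  ττ≡q = sym (^-distribˡ-+-* 2 a a)

  64≤q : 64 ≤ q
  64≤q = ^-monoʳ-≤ 2 (+-mono-≤ 3≤a 3≤a)

  64≤N : 64 ≤ N
  64≤N = ≤-trans 64≤q (m≤m*n q q)

  2N³<W : N * (N * (N + N)) < W
  2N³<W = <-≤-trans (*-monoʳ-< N (*-monoʳ-< N (<-≤-trans (≤-reflexive (cong suc (two N))) (*-monoˡ-< N {2} {N} (≤-trans (m≤m+n 3 61) 64≤N)))))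
    (≤-reflexive (sym (*-assoc N N (N * N))))
    where
    two : ∀ n → n + n ≡ 2 * n
    two = solve-∀

  below : ∀ {x} → x ≤ N * (N * (N + N)) → x < W
  below le = ≤-<-trans le 2N³<W

  slotW : INF * (q * q) < W
  slotW = below (≤-trans (≤-reflexive (four N)) (*-monoʳ-≤ N (*-monoʳ-≤ N (≤-trans (≤-trans (m≤m+n 4 60) 64≤N) (m≤m+n N N)))))
    where
    four : ∀ n → 4 * n * n ≡ n * (n * 4)
    four = solve-∀

  costW : q * q * (q * q * (q * q + q * q)) < W
  costW = 2N³<W

  costW′ : q * q * (q * q * (2 ^ a * 2 ^ a + q * q)) < W
  costW′ = below (*-monoʳ-≤ N (*-monoʳ-≤ N (+-monoˡ-≤ N (≤-trans (≤-reflexive ττ≡q) (m≤m*n q q)))))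

  gatherW : q * q * suc K′ < W
  gatherW = below (*-monoʳ-≤ N (≤-trans (≤-trans (m≤m+n 18 46) 64≤N) (≤-trans (m≤m+n N N) (m≤n*m (N + N) N))))

  pairW : q * q * (q * q) < W
  pairW = below (*-monoʳ-≤ N (≤-trans (m≤m+n N N) (m≤n*m (N + N) N)))

  1<INF : 1 < INF
  1<INF = ≤-trans (≤-trans (m≤m+n 2 62) 64≤N) (m≤n*m N 4)

  2N<INF : 2 * N < INF
  2N<INF = *-monoˡ-< N {2} {4} (s≤s (s≤s (s≤s z≤n)))

  2^J≤N : 2 ^ J ≤ N
  2^J≤N = ≤-trans (^-monoʳ-≤ 2 (m⊓n≤n (up (2 * ρ ^ r)) L)) (≤-reflexive (sym N≡2^L))

  ≤2^J : ∀ {z} → z ≤ N → z ≤ 2 * ρ ^ r → z ≤ 2 ^ J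
  ≤2^J z≤N z≤ = [ (λ e → ≤-trans (≤-trans z≤ (≤2^up (2 * ρ ^ r))) (≤-reflexive (cong (2 ^_) (sym e))))
                , (λ e → ≤-trans z≤N (≤-reflexive (trans N≡2^L (cong (2 ^_) (sym e))))) ]′ (⊓-sel (up (2 * ρ ^ r)) L)

  scale-large : 576 * (e * suc J) ≤ 2 ^ a′
  scale-large = ≤2^up (576 * (e * suc J))

  1≤eJ : 1 ≤ e * suc J
  1≤eJ = *-mono-≤ 1≤e (s≤s z≤n)

  5≤a′ : 5 ≤ a′
  5≤a′ = 2^-cancel (≤-trans (m≤m+n 32 544) (≤-trans (*-monoʳ-≤ 576 1≤eJ) scale-large))

  576eJ≤ : 4 * e * (144 * J) ≤ 2 ^ a′
  576eJ≤ = ≤-trans (≤-reflexive (regroup e J)) (≤-trans (*-monoʳ-≤ 576 (*-monoʳ-≤ e (n≤1+n J))) scale-large)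
    where
    regroup : ∀ e j → 4 * e * (144 * j) ≡ 576 * (e * j)
    regroup = solve-∀

  144J≤ : 144 * J ≤ 2 ^ a′
  144J≤ = ≤-trans (≤-trans (≤-reflexive (sym (*-identityˡ (144 * J)))) (*-monoˡ-≤ (144 * J) (≤-trans 1≤e (m≤n*m e 4)))) 576eJ≤

  tt : ℕ → ℕ
  tt i = 2 + (AA (suc i) ∸ AA i)

  2a≤L : a + a ≤ L
  2a≤L = m≤m+n (a + a) (a + a)

  2tt≤L : ∀ i → tt i + tt i ≤ L
  2tt≤L i = ≤-trans (+-mono-≤ tt≤ tt≤) ≤-refl
    where
    tt≤ : tt i ≤ a + a
    tt≤ = +-mono-≤ (≤-trans (n≤1+n 2) 3≤a) (≤-trans (∸-monoˡ-≤ (AA i) (AA-step i)) (≤-reflexive (m+n∸m≡n (AA i) a)))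

  open Programs N 18 W

  Table : Set
  Table = Fin N → ℕ

  program : Prog Table Table
  program = Network.Assembly.program q K′ INF W L slotW N≡2^L costW gatherW pairW 1<INF ≤-refl a e r J a′ E AA 2a≤L ττ≡q costW′ 2tt≤L

  -- 2312 = 4 * 576 + 8: rounding up to a power of two costs a factor 2, and h contains `2 ^ a′`
  -- twice.
  h≤ : h ≤ 2312 * (e * suc J)
  h≤ = ≤-trans (+-monoˡ-≤ 8 (*-monoˡ-≤ 2 (2^up≤ (576 * (e * suc J)) (≤-trans 1≤eJ (m≤n*m (e * suc J) 576)))))
    (≤-trans (+-monoʳ-≤ (2 * (576 * (e * suc J)) * 2) (*-monoʳ-≤ 8 1≤eJ)) (≤-reflexive (collect (e * suc J))))
    where
    collect : ∀ x → 2 * (576 * x) * 2 + 8 * x ≡ 2312 * x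
    collect = solve-∀

  program-rounds : rounds program ≤ rate * (e * ((suc J + r) * (suc J + r)))
  program-rounds = ≤-trans (≤-reflexive (Network.Assembly.program-rounds q K′ INF W L slotW N≡2^L costW gatherW pairW 1<INF ≤-refl a e r J a′ E AA 2a≤L ττ≡q costW′ 2tt≤L))
    (≤-trans (+-monoˡ-≤ _ (+-monoʳ-≤ (suc J * 6) (*-monoˡ-≤ (13 + h * 12) (m∸n≤m J a′))))
      (rate-bound e J r h 1≤e h≤))

  row : Graph N → Fin N → Table
  row G x u = if Graph.adj G x u then 1 else INF

  module Result (G : Graph N) where

    H : Fin N → Table
    H = exec program (row G)

    correct : (∀ x y → H x y ≡ H y x) × (∀ x y → H x y < INF → Σ[ ℓ ∈ ℕ ] (ℓ ≤ H x y × Walk G x y ℓ)) ×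
      ∑ (λ v → count (λ u → does (H v u <? INF))) ≤ 20 * (r * (N * 2 ^ E)) ×
      (∀ {x y ℓ} → Walk G x y ℓ → Σ[ w ∈ ℕ ] (Chain INF H x y w × e * w ≤ (e + 1) * ℓ + e * (64 * ρ ^ (r ∸ 1))))
    correct = Network.Assembly.Result.correct q K′ INF W L slotW N≡2^L costW gatherW pairW 1<INF ≤-refl a e r J a′ E AA 2a≤L ττ≡q costW′ 2tt≤L
      1≤e (≤-trans (s≤s z≤n) 2≤r) 2^J≤N refl 5≤a′ 144J≤ 576eJ≤ ≤2^J refl refl AA-mono AA-step AA-double AA-end refl G

    symmetric = proj₁ correct
    sound     = proj₁ (proj₂ correct)
    total     = proj₁ (proj₂ (proj₂ correct))
    stretch   = λ {x} {y} {ℓ} → proj₂ (proj₂ (proj₂ correct)) {x} {y} {ℓ}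

-- From integer to rational bounds

⟦⟧-mkℚ : ∀ n → ⟦ n ⟧ ≡ ℚ.mkℚ (ℤ.+ n) 0 (Coprime.sym (Coprime.1-coprimeTo n))
⟦⟧-mkℚ n = ℚ.normalize-coprime (Coprime.sym (Coprime.1-coprimeTo n))

toℚᵘ-⟦⟧ : ∀ n → ℚ.toℚᵘ ⟦ n ⟧ ≡ ℚᵘ.mkℚᵘ (ℤ.+ n) 0
toℚᵘ-⟦⟧ n = cong ℚ.toℚᵘ (⟦⟧-mkℚ n)

⟦⟧-mono : ∀ {m n} → m ≤ n → ⟦ m ⟧ ≤ℚ ⟦ n ⟧
⟦⟧-mono {m} {n} le = ℚ.toℚᵘ-cancel-≤ (subst₂ ℚᵘ._≤_ (sym (toℚᵘ-⟦⟧ m)) (sym (toℚᵘ-⟦⟧ n))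
  (ℚᵘ.*≤* (ℤ.*-monoʳ-≤-nonNeg (ℤ.+ 1) (ℤ.+≤+ le))))

⟦⟧-+ : ∀ m n → ⟦ m + n ⟧ ≡ ⟦ m ⟧ +ℚ ⟦ n ⟧
⟦⟧-+ m n = ℚ.toℚᵘ-injective (ℚᵘ.≃-trans (ℚᵘ.≃-reflexive (toℚᵘ-⟦⟧ (m + n))) (ℚᵘ.≃-trans (ℚᵘ.*≡* same)
  (ℚᵘ.≃-sym (ℚᵘ.≃-trans (ℚ.toℚᵘ-homo-+ ⟦ m ⟧ ⟦ n ⟧) (ℚᵘ.≃-reflexive (cong₂ ℚᵘ._+_ (toℚᵘ-⟦⟧ m) (toℚᵘ-⟦⟧ n)))))))
  where
  same : ℤ.+ (m + n) ℤ.* ℤ.+ 1 ≡ (ℤ.+ m ℤ.* ℤ.+ 1 ℤ.+ ℤ.+ n ℤ.* ℤ.+ 1) ℤ.* ℤ.+ 1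
  same = cong (ℤ._* ℤ.+ 1) (trans (ℤ.pos-+ m n) (sym (cong₂ ℤ._+_ (ℤ.*-identityʳ (ℤ.+ m)) (ℤ.*-identityʳ (ℤ.+ n)))))

⟦⟧-* : ∀ m n → ⟦ m * n ⟧ ≡ ⟦ m ⟧ *ℚ ⟦ n ⟧
⟦⟧-* m n = ℚ.toℚᵘ-injective (ℚᵘ.≃-trans (ℚᵘ.≃-reflexive (toℚᵘ-⟦⟧ (m * n))) (ℚᵘ.≃-trans (ℚᵘ.*≡* same)
  (ℚᵘ.≃-sym (ℚᵘ.≃-trans (ℚ.toℚᵘ-homo-* ⟦ m ⟧ ⟦ n ⟧) (ℚᵘ.≃-reflexive (cong₂ ℚᵘ._*_ (toℚᵘ-⟦⟧ m) (toℚᵘ-⟦⟧ n)))))))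
  where
  same : ℤ.+ (m * n) ℤ.* ℤ.+ 1 ≡ (ℤ.+ m ℤ.* ℤ.+ n) ℤ.* ℤ.+ 1
  same = cong (ℤ._* ℤ.+ 1) (ℤ.pos-* m n)

⟦⟧-nonNeg : ∀ n → ℚ.NonNegative ⟦ n ⟧
⟦⟧-nonNeg n = ℚ.nonNegative (⟦⟧-mono {0} {n} z≤n)

⟦⟧-pos : ∀ n → 1 ≤ n → ℚ.Positive ⟦ n ⟧
⟦⟧-pos n le = ℚ.positive (ℚ.<-≤-trans (ℚ.*<* (ℤ.+<+ (s≤s z≤n))) (⟦⟧-mono le))

*ℚ-mono : ∀ {p q r s} → 0ℚ ≤ℚ p → 0ℚ ≤ℚ s → p ≤ℚ q → r ≤ℚ s → p *ℚ r ≤ℚ q *ℚ s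
*ℚ-mono {p} {q} {r} {s} 0≤p 0≤s p≤q r≤s = ℚ.≤-trans (ℚ.*-monoˡ-≤-nonNeg p {{ℚ.nonNegative 0≤p}} r≤s) (ℚ.*-monoʳ-≤-nonNeg s {{ℚ.nonNegative 0≤s}} p≤q)

-- e is the integer part of 1/ε plus one; the upper bound is 1 + ε with ε < 1.
reciprocal : ∀ ε → 0ℚ <ℚ ε → ε <ℚ 1ℚ → Σ[ e ∈ ℕ ] (1 ≤ e × 1ℚ ≤ℚ ⟦ e ⟧ *ℚ ε × ⟦ e ⟧ *ℚ ε ≤ℚ ⟦ 2 ⟧)
reciprocal (ℚ.mkℚ (ℤ.+ zero)    d c) (ℚ.*<* (ℤ.+<+ ())) _
reciprocal (ℚ.mkℚ ℤ.-[1+ p ]    d c) (ℚ.*<* ()) _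
reciprocal ε@(ℚ.mkℚ (ℤ.+ (suc p)) d c) _ (ℚ.*<* lt) = e , s≤s z≤n , lower , upper
  where
  e : ℕ
  e = suc (suc d / suc p)
  p<d : suc p < suc d
  p<d = subst₂ _<_ (*-identityʳ (suc p)) (+-identityʳ (suc d)) (ℤ.drop‿+<+ (subst₂ ℤ._<_ (sym (ℤ.pos-* (suc p) 1)) (sym (ℤ.pos-* 1 (suc d))) lt))
  quotient≤ : suc d / suc p * suc p ≤ suc d
  quotient≤ = m/n*n≤m (suc d) (suc p)
  d≤ : suc d ≤ e * suc p
  d≤ = ≤-trans (≤-reflexive (m≡m%n+[m/n]*n (suc d) (suc p))) (+-monoˡ-≤ (suc d / suc p * suc p) (<⇒≤ (m%n<n (suc d) (suc p))))
  ≤2d : e * suc p ≤ 2 * suc d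
  ≤2d = ≤-trans (+-mono-≤ (<⇒≤ p<d) quotient≤) (≤-reflexive (cong (suc d +_) (sym (+-identityʳ (suc d)))))
  value : ℚ.toℚᵘ (⟦ e ⟧ *ℚ ε) ℚᵘ.≃ ℚᵘ.mkℚᵘ (ℤ.+ (e * suc p)) d
  value = ℚᵘ.≃-trans (ℚ.toℚᵘ-homo-* ⟦ e ⟧ ε) (ℚᵘ.≃-trans (ℚᵘ.≃-reflexive (cong (ℚᵘ._* ℚ.toℚᵘ ε) (toℚᵘ-⟦⟧ e)))
    (ℚᵘ.*≡* (cong₂ ℤ._*_ (sym (ℤ.pos-* e (suc p))) (cong (λ x → ℤ.+ suc x) (sym (+-identityʳ d))))))
  lower : 1ℚ ≤ℚ ⟦ e ⟧ *ℚ ε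
  lower = ℚ.toℚᵘ-cancel-≤ (ℚᵘ.≤-respʳ-≃ (ℚᵘ.≃-sym value) (ℚᵘ.*≤* (subst₂ ℤ._≤_ (ℤ.pos-* 1 (suc d)) (ℤ.pos-* (e * suc p) 1)
    (ℤ.+≤+ (≤-trans (≤-reflexive (+-identityʳ (suc d))) (≤-trans d≤ (≤-reflexive (sym (*-identityʳ (e * suc p))))))))))
  upper : ⟦ e ⟧ *ℚ ε ≤ℚ ⟦ 2 ⟧
  upper = ℚ.toℚᵘ-cancel-≤ (ℚᵘ.≤-respˡ-≃ (ℚᵘ.≃-sym value) (ℚᵘ.*≤* (subst₂ ℤ._≤_ (ℤ.pos-* (e * suc p) 1) (ℤ.pos-* 2 (suc d))
    (ℤ.+≤+ (≤-trans (≤-reflexive (*-identityʳ (e * suc p))) ≤2d)))))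

module Rational (e : ℕ) (ε : ℚ) (1≤e : 1 ≤ e) (0<ε : 0ℚ <ℚ ε) (1≤eε : 1ℚ ≤ℚ ⟦ e ⟧ *ℚ ε) (eε≤2 : ⟦ e ⟧ *ℚ ε ≤ℚ ⟦ 2 ⟧) where

  open import Data.Rational.Solver using (module +-*-Solver)

  0≤ε : 0ℚ ≤ℚ ε
  0≤ε = ℚ.<⇒≤ 0<ε

  0≤⟦_⟧ : ∀ n → 0ℚ ≤ℚ ⟦ n ⟧
  0≤⟦ n ⟧ = ⟦⟧-mono {0} {n} z≤n

  0≤eε : 0ℚ ≤ℚ ⟦ e ⟧ *ℚ ε
  0≤eε = ℚ.≤-trans (⟦⟧-mono {0} {1} z≤n) 1≤eε

  -- After division by e the slope is 1 + 1/e, and `1 ≤ e ε` means 1/e is at most ε.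
  stretch-ℚ : ∀ w ℓ β → e * w ≤ (e + 1) * ℓ + e * β → ⟦ w ⟧ ≤ℚ (1ℚ +ℚ ε) *ℚ ⟦ ℓ ⟧ +ℚ ⟦ β ⟧
  stretch-ℚ w ℓ β le = ℚ.*-cancelˡ-≤-pos ⟦ e ⟧ {{⟦⟧-pos e 1≤e}} (begin
    ⟦ e ⟧ *ℚ ⟦ w ⟧                                                    ≡⟨ sym (⟦⟧-* e w) ⟩
    ⟦ e * w ⟧                                                         ≤⟨ ⟦⟧-mono le ⟩
    ⟦ (e + 1) * ℓ + e * β ⟧                                           ≡⟨ trans (⟦⟧-+ ((e + 1) * ℓ) (e * β)) (cong₂ _+ℚ_ (trans (⟦⟧-* (e + 1) ℓ) (cong (_*ℚ ⟦ ℓ ⟧) (⟦⟧-+ e 1))) (⟦⟧-* e β)) ⟩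
    (⟦ e ⟧ +ℚ 1ℚ) *ℚ ⟦ ℓ ⟧ +ℚ ⟦ e ⟧ *ℚ ⟦ β ⟧                          ≤⟨ ℚ.+-monoˡ-≤ (⟦ e ⟧ *ℚ ⟦ β ⟧) (ℚ.*-monoʳ-≤-nonNeg ⟦ ℓ ⟧ {{⟦⟧-nonNeg ℓ}} (ℚ.+-monoʳ-≤ ⟦ e ⟧ 1≤eε)) ⟩
    (⟦ e ⟧ +ℚ ⟦ e ⟧ *ℚ ε) *ℚ ⟦ ℓ ⟧ +ℚ ⟦ e ⟧ *ℚ ⟦ β ⟧                  ≡⟨ solve 4 (λ e ε l b → (e :+ e :* ε) :* l :+ e :* b := e :* ((con 1ℚ :+ ε) :* l :+ b)) refl ⟦ e ⟧ ε ⟦ ℓ ⟧ ⟦ β ⟧ ⟩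
    ⟦ e ⟧ *ℚ ((1ℚ +ℚ ε) *ℚ ⟦ ℓ ⟧ +ℚ ⟦ β ⟧)                            ∎)
    where
    open ℚ.≤-Reasoning
    open +-*-Solver using (solve; _:=_; _:+_; _:*_; con)

  rounds-ℚ : ∀ T X Y → T ≤ e * X → ⟦ T ⟧ *ℚ ε ≤ℚ ⟦ 2 * X ⟧ +ℚ ⟦ Y ⟧ *ℚ ε
  rounds-ℚ T X Y le = begin
    ⟦ T ⟧ *ℚ ε                    ≤⟨ ℚ.*-monoʳ-≤-nonNeg ε {{ℚ.nonNegative 0≤ε}} (⟦⟧-mono le) ⟩
    ⟦ e * X ⟧ *ℚ ε                ≡⟨ trans (cong (_*ℚ ε) (⟦⟧-* e X)) (solve 3 (λ e x ε → (e :* x) :* ε := (e :* ε) :* x) refl ⟦ e ⟧ ⟦ X ⟧ ε) ⟩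
    (⟦ e ⟧ *ℚ ε) *ℚ ⟦ X ⟧         ≤⟨ ℚ.*-monoʳ-≤-nonNeg ⟦ X ⟧ {{⟦⟧-nonNeg X}} eε≤2 ⟩
    ⟦ 2 ⟧ *ℚ ⟦ X ⟧                ≡⟨ sym (⟦⟧-* 2 X) ⟩
    ⟦ 2 * X ⟧                     ≡⟨ sym (ℚ.+-identityʳ ⟦ 2 * X ⟧) ⟩
    ⟦ 2 * X ⟧ +ℚ 0ℚ               ≤⟨ ℚ.+-monoʳ-≤ ⟦ 2 * X ⟧ (ℚ.≤-trans (ℚ.≤-reflexive (sym (ℚ.*-zeroʳ ⟦ Y ⟧))) (ℚ.*-monoˡ-≤-nonNeg ⟦ Y ⟧ {{⟦⟧-nonNeg Y}} 0≤ε)) ⟩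
    ⟦ 2 * X ⟧ +ℚ ⟦ Y ⟧ *ℚ ε       ∎
    where
    open ℚ.≤-Reasoning
    open +-*-Solver using (solve; _:=_; _:+_; _:*_; con)

  0≤ε^ : ∀ k → 0ℚ ≤ℚ ε ^ℚ k
  0≤ε^ zero    = ⟦⟧-mono {0} {1} z≤n
  0≤ε^ (suc k) = ℚ.≤-trans (ℚ.≤-reflexive (sym (ℚ.*-zeroʳ ε))) (ℚ.*-monoˡ-≤-nonNeg ε {{ℚ.nonNegative 0≤ε}} (0≤ε^ k))

  power-ℚ : ∀ X k → ⟦ (e * X) ^ k ⟧ *ℚ (ε ^ℚ k) ≤ℚ ⟦ (2 * X) ^ k ⟧
  power-ℚ X zero    = ℚ.≤-reflexive (ℚ.*-identityʳ 1ℚ)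
  power-ℚ X (suc k) = begin
    ⟦ e * X * (e * X) ^ k ⟧ *ℚ (ε *ℚ (ε ^ℚ k))              ≡⟨ cong (_*ℚ (ε *ℚ (ε ^ℚ k))) (trans (⟦⟧-* (e * X) ((e * X) ^ k)) (cong (_*ℚ ⟦ (e * X) ^ k ⟧) (⟦⟧-* e X))) ⟩
    ⟦ e ⟧ *ℚ ⟦ X ⟧ *ℚ ⟦ (e * X) ^ k ⟧ *ℚ (ε *ℚ (ε ^ℚ k))    ≡⟨ solve 5 (λ e x p ε r → ((e :* x) :* p) :* (ε :* r) := ((e :* ε) :* x) :* (p :* r)) refl ⟦ e ⟧ ⟦ X ⟧ ⟦ (e * X) ^ k ⟧ ε (ε ^ℚ k) ⟩
    ⟦ e ⟧ *ℚ ε *ℚ ⟦ X ⟧ *ℚ (⟦ (e * X) ^ k ⟧ *ℚ (ε ^ℚ k))    ≤⟨ *ℚ-mono (ℚ.≤-trans (ℚ.≤-reflexive (sym (ℚ.*-zeroˡ ⟦ X ⟧))) (ℚ.*-monoʳ-≤-nonNeg ⟦ X ⟧ {{⟦⟧-nonNeg X}} 0≤eε)) 0≤⟦ (2 * X) ^ k ⟧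
                                                                 (ℚ.*-monoʳ-≤-nonNeg ⟦ X ⟧ {{⟦⟧-nonNeg X}} eε≤2) (power-ℚ X k) ⟩
    ⟦ 2 ⟧ *ℚ ⟦ X ⟧ *ℚ ⟦ (2 * X) ^ k ⟧                       ≡⟨ sym (trans (⟦⟧-* (2 * X) ((2 * X) ^ k)) (cong (_*ℚ ⟦ (2 * X) ^ k ⟧) (⟦⟧-* 2 X))) ⟩
    ⟦ (2 * X) ^ suc k ⟧                                     ∎
    where
    open ℚ.≤-Reasoning
    open +-*-Solver using (solve; _:=_; _:+_; _:*_; con)

-- The logarithm of the statement and the size of an output

⌈n/2⌉-double : ∀ n → n ≤ 2 * ℕ.⌈ n /2⌉
⌈n/2⌉-double n = ≤-trans (≤-reflexive (sym (⌊n/2⌋+⌈n/2⌉≡n n))) (+-mono-≤ (⌊n/2⌋≤⌈n/2⌉ n) (≤-reflexive (sym (+-identityʳ _))))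

≤2^log : ∀ n → n ≤ 2 ^ ⌈log₂ n ⌉
≤2^log = Data.Nat.Induction.<-rec (λ n → n ≤ 2 ^ ⌈log₂ n ⌉) go
  where
  go : ∀ n → (∀ {m} → m < n → m ≤ 2 ^ ⌈log₂ m ⌉) → n ≤ 2 ^ ⌈log₂ n ⌉
  go zero          rec = z≤n
  go (suc zero)    rec = m^n>0 2 ⌈log₂ 1 ⌉
  go n@(suc (suc n′)) rec = begin
    n                                    ≤⟨ ⌈n/2⌉-double n ⟩
    2 * ℕ.⌈ n /2⌉                        ≤⟨ *-monoʳ-≤ 2 (rec (⌈n/2⌉<n n′)) ⟩
    2 * 2 ^ ⌈log₂ ℕ.⌈ n /2⌉ ⌉            ≡⟨ cong (λ x → 2 ^ suc x) (Log.⌈log₂⌈n/2⌉⌉≡⌈log₂n⌉∸1 n) ⟩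
    2 ^ suc (⌈log₂ n ⌉ ∸ 1)              ≡⟨ cong (2 ^_) (m+[n∸m]≡n 1≤log) ⟩
    2 ^ ⌈log₂ n ⌉                        ∎
    where
    open ≤-Reasoning
    1≤log : 1 ≤ ⌈log₂ n ⌉
    1≤log = ⌈log₂⌉-mono-≤ {2} {n} (s≤s (s≤s z≤n))

≤2^lg : ∀ n → n ≤ 2 ^ lg n
≤2^lg n = ≤-trans (≤2^log n) (^-monoʳ-≤ 2 (m≤n⊔m 1 ⌈log₂ n ⌉))

opaque
  unfolding ∑

  foldr-∑ : ∀ {A : Set} {n} (f : Fin n → List A) → Data.Vec.Functional.foldr (λ l acc → length l + acc) 0 f ≡ ∑ (λ u → length (f u))
  foldr-∑ {n = zero}  f = refl
  foldr-∑ {n = suc n} f = cong (length (f zero) +_) (foldr-∑ (f ∘ suc))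

entries-∑ : ∀ {n} (H : WGraph n) → entries H ≡ ∑ (λ u → length (H u))
entries-∑ = foldr-∑

-- Padding to N vertices

-- The graph on N ≥ n vertices obtained by adding isolated vertices, and the transfer of
-- an emulator matrix on it to the local output lists of the original vertices.

module Padding (n c N : ℕ) (n≤N : n ≤ N) (mw W b : ℕ) .{{_ : NonZero W}} (N≤cn : N ≤ suc c * n)
  (fits : W ^ (suc c * suc c * mw) ≤ 2 ^ b) where

  open Hosting n c N mw W b n≤N N≤cn fits public
  open Programs N mw W

  real : Fin N → Bool
  real x = does (toℕ x <? n)

  -- Added vertices share their hosts with original ones, so both ends are tested before the row of
  -- the host is consulted.
  adjacent : Fin N → (Fin n → Bool) → Fin N → Bool
  adjacent x r y = real x ∧ (real y ∧ r (hostOf y))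

  padded : Graph n → Graph N
  padded G = record
    { adj    = λ x → adjacent x (Graph.adj G (hostOf x))
    ; sym    = λ x y → symm (real x) (real y) (Graph.sym G (hostOf x) (hostOf y))
    ; irrefl = λ x → loop (real x) (Graph.irrefl G (hostOf x))
    }
    where
    symm : ∀ a b {p q} → p ≡ q → a ∧ (b ∧ p) ≡ b ∧ (a ∧ q)
    symm true  true  e = e
    symm true  false e = refl
    symm false true  e = refl
    symm false false e = refl
    loop : ∀ a {p} → p ≡ false → a ∧ (a ∧ p) ≡ false
    loop true  e = e
    loop false e = refl

  real-emb : ∀ u → real (emb u) ≡ true
  real-emb u = dec-true (toℕ (emb u) <? n) (≤-trans (s≤s (≤-reflexive (Fin.toℕ-inject≤ u n≤N))) (Fin.toℕ<n u))

  emb-host : ∀ x → real x ≡ true → emb (hostOf x) ≡ x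
  emb-host x e = subst (λ z → emb (hostOf z) ≡ z) same (cong emb (hostOf-emb (fromℕ< (holds (toℕ x <? n) e))))
    where
    same : emb (fromℕ< (holds (toℕ x <? n) e)) ≡ x
    same = Fin.toℕ-injective (trans (Fin.toℕ-inject≤ _ n≤N) (Fin.toℕ-fromℕ< (holds (toℕ x <? n) e)))

  module Transfer (G : Graph n) where

    walk-down : ∀ {x y ℓ} → Walk (padded G) x y ℓ → real x ≡ true → Walk G (hostOf x) (hostOf y) ℓ × real y ≡ true
    walk-down here rx = here , rx
    walk-down (step {x} {z} e w) rx =
      let _ , e′  = ∧-true {real x} e
          rz , e″ = ∧-true {real z} e′
          v , ry  = walk-down w rz
      in  step e″ v , ry

    walk-up : ∀ {u v ℓ} → Walk G u v ℓ → Walk (padded G) (emb u) (emb v) ℓ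
    walk-up here = here
    walk-up (step {u} {v} e w) = step (true∧ (real-emb u) (true∧ (real-emb v)
      (trans (cong₂ (Graph.adj G) (hostOf-emb u) (hostOf-emb v)) e))) (walk-up w)

    module Output (INF : ℕ) (H : Fin N → Fin N → ℕ) (symmetric : ∀ x y → H x y ≡ H y x)
      (sound : ∀ x y → H x y < INF → Σ[ ℓ ∈ ℕ ] (ℓ ≤ H x y × Walk (padded G) x y ℓ)) where

      listing : Fin n → (Fin N → ℕ) → List (Fin n × ℕ)
      listing u f = map (λ v → v , f (emb v)) (filter (λ v → f (emb v) <? INF) (allFin n))

      local : WGraph n
      local u = listing u (H (emb u))

      local-∈ : ∀ u v w → (v , w) ∈ local u → H (emb u) (emb v) < INF × w ≡ H (emb u) (emb v)
      local-∈ u v w p with Mem.∈-map⁻ (λ v → v , H (emb u) (emb v)) p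
      ... | v′ , v′∈ , refl = proj₂ (Mem.∈-filter⁻ (λ v → H (emb u) (emb v) <? INF) {xs = allFin n} v′∈) , refl

      ∈-local : ∀ u v → H (emb u) (emb v) < INF → (v , H (emb u) (emb v)) ∈ local u
      ∈-local u v lt = Mem.∈-map⁺ (λ v → v , H (emb u) (emb v)) (Mem.∈-filter⁺ (λ v → H (emb u) (emb v) <? INF) (Mem.∈-allFin v) lt)

      local-symmetric : Symmetric local
      local-symmetric u v w p = let lt , e = local-∈ u v w p in
        subst (λ w → (u , w) ∈ local v) (trans (symmetric (emb v) (emb u)) (sym e)) (∈-local v u (subst (_< INF) (symmetric (emb u) (emb v)) lt))

      local-sound : ∀ {u v c} → WWalk local u v c → Σ[ ℓ ∈ ℕ ] (Walk G u v ℓ × ℓ ≤ c)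
      local-sound here = 0 , here , z≤n
      local-sound (step {u} {v} {w = w} p ws) =
        let lt , e      = local-∈ u v w p
            i , i≤ , w₁ = sound (emb u) (emb v) lt
            j , w₂ , j≤ = local-sound ws
        in  i + j , (subst₂ (λ a b → Walk G a b i) (hostOf-emb u) (hostOf-emb v) (proj₁ (walk-down w₁ (real-emb u))) ◅◅ w₂) ,
            +-mono-≤ (≤-trans i≤ (≤-reflexive (sym e))) j≤
        where open Walks G

      -- A chain from an original vertex never enters an added one: each link is backed by a walk of
      -- the padded graph, and added vertices are isolated there.
      chain-local : ∀ {x y c} → Chain INF H x y c → real x ≡ true → WWalk local (hostOf x) (hostOf y) c
      chain-local end rx = here
      chain-local (link {x} z lt p) rx =
        let _ , _ , w = sound x z lt
            rz        = proj₂ (walk-down w rx)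
        in  step (subst (λ d → (hostOf z , d) ∈ local (hostOf x)) (cong₂ H (emb-host x rx) (emb-host z rz))
              (∈-local (hostOf x) (hostOf z) (subst (_< INF) (sym (cong₂ H (emb-host x rx) (emb-host z rz))) lt))) (chain-local p rz)

      local-entries : entries local ≤ ∑ (λ x → count (λ y → does (H x y <? INF)))
      local-entries = ≤-trans (≤-reflexive (entries-∑ local)) (≤-trans (∑-mono each) (∑-inject n≤N (λ x → count (λ y → does (H x y <? INF)))))
        where
        each : ∀ u → length (local u) ≤ count (λ y → does (H (emb u) y <? INF))
        each u = ≤-trans (≤-reflexive (trans (Data.List.Properties.length-map (λ v → v , H (emb u) (emb v)) (filter (λ v → H (emb u) (emb v) <? INF) (allFin n)))
          (length-filter (λ v → H (emb u) (emb v) <? INF) id))) (∑-inject n≤N (λ y → 𝟙 (does (H (emb u) y <? INF))))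

      emulates : (ε : ℚ) (β : ℕ) →
        (∀ {x y ℓ} → Walk (padded G) x y ℓ → Σ[ w ∈ ℕ ] (Chain INF H x y w × ⟦ w ⟧ ≤ℚ (1ℚ +ℚ ε) *ℚ ⟦ ℓ ⟧ +ℚ ⟦ β ⟧)) →
        IsEmulator G local ε β
      emulates ε β stretch = local-symmetric , (λ u v c → local-sound) , λ u v ℓ w →
        let d , p , bound = stretch (walk-up w)
        in  d , subst₂ (λ a b → WWalk local a b d) (hostOf-emb u) (hostOf-emb v) (chain-local p (real-emb u)) , bound

-- Constants and the number of virtual vertices

opaque

  -- 2^17 - 1, because N is at most 2^16 * 2^(up n) and 2^(up n) is at most 2n.
  slack : ℕ
  slack = 131071

  slack-bound : ∀ x n → 2 ^ x ≤ 2 * n → 2 ^ (16 + x) ≤ suc slack * n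
  slack-bound x n le = ≤-trans (shift 16) (*-monoˡ-≤ n {2 ^ 17} {suc slack} ≤-refl)
    where
    shift : ∀ k → 2 ^ (k + x) ≤ 2 ^ suc k * n
    shift zero    = le
    shift (suc k) = ≤-trans (*-monoʳ-≤ 2 (shift k)) (≤-reflexive (sym (*-assoc 2 (2 ^ suc k) n)))

-- A message bundles 18 words for each pair of hosted nodes, at most `suc slack` per host, and a
-- word below N⁴ takes at most `96 * lg n` bits.
Bits Edges Time Error : ℕ
Bits  = 96 * (suc slack * suc slack * 18)
Edges = 80 * (suc slack * suc slack)
Time  = 2 * (rate * 36)
Error = 2 * steep

opaque

  -- The summand 4 compensates the rounding in the division, so that 16 to this power is at least n,
  -- and it guarantees exponent at least 3.
  exponent : ℕ → ℕ
  exponent n = 4 + up n / 4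

  3≤exponent : ∀ n → 3 ≤ exponent n
  3≤exponent n = ≤-trans (n≤1+n 3) (m≤m+n 4 (up n / 4))

  log-size : ∀ n → exponent n + exponent n + (exponent n + exponent n) ≡ 16 + up n / 4 * 4
  log-size n = arith (up n / 4)
    where
    arith : ∀ x → 4 + x + (4 + x) + (4 + x + (4 + x)) ≡ 16 + x * 4
    arith = solve-∀

log-size≤ : ∀ n → 1 ≤ n → (exponent n + exponent n + (exponent n + exponent n)) * 4 ≤ 96 * lg n
log-size≤ n 1≤n = begin
  (exponent n + exponent n + (exponent n + exponent n)) * 4   ≡⟨ trans (cong (_* 4) (log-size n)) (arith (up n / 4)) ⟩
  64 + 16 * (up n / 4)                                        ≤⟨ +-mono-≤ (*-monoʳ-≤ 64 1≤lg) (*-monoʳ-≤ 16 (≤-trans (m/n≤m (up n) 4) up≤)) ⟩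
  64 * lg n + 16 * (2 * lg n)                                 ≡⟨ collect (lg n) ⟩
  96 * lg n                                                   ∎
  where
  open ≤-Reasoning
  1≤lg : 1 ≤ lg n
  1≤lg = m≤m⊔n 1 ⌈log₂ n ⌉
  arith : ∀ x → (16 + x * 4) * 4 ≡ 64 + 16 * x
  arith = solve-∀
  collect : ∀ x → 64 * x + 16 * (2 * x) ≡ 96 * x
  collect = solve-∀
  up≤ : up n ≤ 2 * lg n
  up≤ = ≤-trans (2^-cancel {up n} {1 + lg n} (≤-trans (2^up≤ n 1≤n) (*-monoʳ-≤ 2 (≤2^lg n)))) (≤-trans (+-monoˡ-≤ (lg n) 1≤lg) (≤-reflexive (cong (lg n +_) (sym (+-identityʳ _)))))

size≡ : ∀ a → 2 ^ (a + a) * 2 ^ (a + a) ≡ 2 ^ (a + a + (a + a))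
size≡ a = sym (^-distribˡ-+-* 2 (a + a) (a + a))

n≤size : ∀ n → n ≤ 2 ^ (exponent n + exponent n) * 2 ^ (exponent n + exponent n)
n≤size n = ≤-trans (≤2^up n) (≤-trans (^-monoʳ-≤ 2 (≤-trans (≤-reflexive (m≡m%n+[m/n]*n (up n) 4))
  (≤-trans (+-monoˡ-≤ (up n / 4 * 4) (≤-trans (<⇒≤ (m%n<n (up n) 4)) (m≤m+n 4 12))) (≤-reflexive (sym (log-size n)))))) (≤-reflexive (sym (size≡ (exponent n)))))

size≤ : ∀ n → 1 ≤ n → 2 ^ (exponent n + exponent n) * 2 ^ (exponent n + exponent n) ≤ suc slack * n
size≤ n 1≤n = ≤-trans (≤-reflexive (size≡ (exponent n))) (≤-trans (^-monoʳ-≤ 2 (≤-trans (≤-reflexive (log-size n)) (+-monoʳ-≤ 16 (m/n*n≤m (up n) 4))))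
  (slack-bound (up n) n (2^up≤ n 1≤n)))

words-fit : ∀ a w l → (a + a + (a + a)) * 4 ≤ 96 * l → let N = 2 ^ (a + a) * 2 ^ (a + a) in (N * N * (N * N)) ^ w ≤ 2 ^ (96 * w * l)
words-fit a w l le = begin
  (N * N * (N * N)) ^ w         ≡⟨ cong (_^ w) W≡ ⟩
  (2 ^ (L * 4)) ^ w             ≡⟨ ^-*-assoc 2 (L * 4) w ⟩
  2 ^ (L * 4 * w)               ≤⟨ ^-monoʳ-≤ 2 (≤-trans (*-monoˡ-≤ w le) (≤-reflexive (regroup l w))) ⟩
  2 ^ (96 * w * l)              ∎
  where
  open ≤-Reasoning
  N L : ℕ
  N = 2 ^ (a + a) * 2 ^ (a + a)
  L = a + a + (a + a)
  NN : N * N ≡ 2 ^ (L + L)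
  NN = trans (cong₂ _*_ (size≡ a) (size≡ a)) (sym (^-distribˡ-+-* 2 L L))
  four : ∀ l → l + l + (l + l) ≡ l * 4
  four = solve-∀
  W≡ : N * N * (N * N) ≡ 2 ^ (L * 4)
  W≡ = trans (cong₂ _*_ NN NN) (trans (sym (^-distribˡ-+-* 2 (L + L) (L + L))) (cong (2 ^_) (four L)))
  regroup : ∀ l w → 96 * l * w ≡ 96 * w * l
  regroup = solve-∀

module Main (n e r a c b : ℕ) (1≤e : 1 ≤ e) (2≤r : 2 ≤ r) (3≤a : 3 ≤ a)
  (n≤N : n ≤ Clique.N a e r 3≤a 1≤e 2≤r) (N≤cn : Clique.N a e r 3≤a 1≤e 2≤r ≤ suc c * n)
  (fits : Clique.W a e r 3≤a 1≤e 2≤r ^ (suc c * suc c * 18) ≤ 2 ^ b) where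

  open Clique a e r 3≤a 1≤e 2≤r

  open Padding n c N n≤N 18 W b N≤cn fits
  open Programs N 18 W

  out : Fin n → Table → List (Fin n × ℕ)
  out u f = map (λ v → v , f (emb v)) (filter (λ v → f (emb v) <? INF) (allFin n))

  module Al = Algorithm (flatten program) (λ _ → 0) (λ x r y → if adjacent x r y then 1 else INF) out

  T β m : ℕ
  T = rounds♭ (flatten program)
  β = 64 * ρ ^ (r ∸ 1)
  m = 20 * (r * (N * 2 ^ E))

  module _ (G : Graph n) where

    open Transfer G
    open Result (padded G)
    open Output INF H symmetric sound

    result≡ : ∀ u → result Al.alg G T u ≡ local u
    result≡ u = trans (Al.result-alg G u) (cong (out u) (run♭-flatten program (row (padded G)) (emb u)))

    IsEmulator-cong : ∀ {H₁ H₂ : WGraph n} {ε β} → (∀ u → H₁ u ≡ H₂ u) → IsEmulator G H₂ ε β → IsEmulator G H₁ ε β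
    IsEmulator-cong {H₁} {H₂} e (s , d , t) =
      (λ u v w p → subst (λ l → (u , w) ∈ l) (sym (e v)) (s u v w (subst (λ l → (v , w) ∈ l) (e u) p))) ,
      (λ u v c w → d u v c (transfer e w)) ,
      (λ u v ℓ w → let c , p , b = t u v ℓ w in c , transfer (λ u → sym (e u)) p , b)
      where
      transfer : ∀ {H₁ H₂ : WGraph n} → (∀ u → H₁ u ≡ H₂ u) → ∀ {u v c} → WWalk H₁ u v c → WWalk H₂ u v c
      transfer e here = here
      transfer e (step {u} {v} {w = w} p ws) = step (subst (λ l → (v , w) ∈ l) (e u) p) (transfer e ws)

    built : (ε : ℚ) → (∀ w ℓ β → e * w ≤ (e + 1) * ℓ + e * β → ⟦ w ⟧ ≤ℚ (1ℚ +ℚ ε) *ℚ ⟦ ℓ ⟧ +ℚ ⟦ β ⟧) →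
      IsEmulator G (result Al.alg G T) ε β × entries (result Al.alg G T) ≤ m
    built ε rational =
      IsEmulator-cong {ε = ε} {β = β} result≡ (emulates ε β λ {_} {_} {ℓ} w → let d , p , b = stretch w in d , p , rational d ℓ β b) ,
      ≤-trans (≤-reflexive (trans (entries-∑ (result Al.alg G T)) (trans (∑-cong λ u → cong length (result≡ u)) (sym (entries-∑ local)))))
        (≤-trans local-entries total)

*-^ : ∀ k m n → (m * n) ^ k ≡ m ^ k * n ^ k
*-^ zero    m n = refl
*-^ (suc k) m n = trans (cong (m * n *_) (*-^ k m n)) (interchange m n (m ^ k) (n ^ k))
  where
  interchange : ∀ a b c d → a * b * (c * d) ≡ a * c * (b * d)
  interchange = solve-∀

-- Edges, rounds and additive error in terms of n and β

module Bounds (n e r a s : ℕ) (1≤e : 1 ≤ e) (2≤r : 2 ≤ r) (3≤a : 3 ≤ a)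
  (N≤cn : Clique.N a e r 3≤a 1≤e 2≤r ≤ s * n) (1≤s : 1 ≤ s) where

  open Clique a e r 3≤a 1≤e 2≤r using (N; ρ; L; N≡2^L; J; E; E-upper; program; program-rounds)

  β m k : ℕ
  β = 64 * ρ ^ (r ∸ 1)
  m = 20 * (r * (N * 2 ^ E))
  k = r ∸ 1

  r≡ : suc k ≡ r
  r≡ = m+[n∸m]≡n (≤-trans (s≤s z≤n) 2≤r)

  1≤k : 1 ≤ k
  1≤k = ∸-monoˡ-≤ 1 2≤r

  1≤er : 1 ≤ e * r
  1≤er = *-mono-≤ 1≤e (≤-trans (s≤s z≤n) 2≤r)

  256≤ρ : 256 ≤ ρ
  256≤ρ = *-monoʳ-≤ 256 1≤er

  ρ≢0 : NonZero ρ
  ρ≢0 = ℕ.>-nonZero (≤-trans (s≤s z≤n) 256≤ρ)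

  -- Raised to the power `2 ^ r`, the density factor `2 ^ E` is at most `2 ^ (2 ^ r) * N`: the
  -- fractional power of n becomes a single factor n.
  edges : m ^ (2 ^ r) ≤ (40 * (s * s) * r * n) ^ (2 ^ r) * n
  edges = begin
    (20 * (r * (N * 2 ^ E))) ^ R               ≡⟨ cong (_^ R) (regroup r N (2 ^ E)) ⟩
    (20 * r * N * 2 ^ E) ^ R                   ≡⟨ *-^ R (20 * r * N) (2 ^ E) ⟩
    (20 * r * N) ^ R * (2 ^ E) ^ R             ≤⟨ *-monoʳ-≤ ((20 * r * N) ^ R) density ⟩
    (20 * r * N) ^ R * (2 ^ R * N)             ≡⟨ sym (*-assoc ((20 * r * N) ^ R) (2 ^ R) N) ⟩
    (20 * r * N) ^ R * 2 ^ R * N               ≡⟨ cong (_* N) (sym (*-^ R (20 * r * N) 2)) ⟩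
    (20 * r * N * 2) ^ R * N                   ≤⟨ *-mono-≤ (^-monoˡ-≤ R (*-monoˡ-≤ 2 (*-monoʳ-≤ (20 * r) N≤cn))) N≤cn ⟩
    (20 * r * (s * n) * 2) ^ R * (s * n)       ≤⟨ *-monoʳ-≤ ((20 * r * (s * n) * 2) ^ R) (*-monoˡ-≤ n s≤) ⟩
    (20 * r * (s * n) * 2) ^ R * (s ^ R * n)   ≡⟨ sym (*-assoc ((20 * r * (s * n) * 2) ^ R) (s ^ R) n) ⟩
    (20 * r * (s * n) * 2) ^ R * s ^ R * n     ≡⟨ cong (_* n) (trans (sym (*-^ R (20 * r * (s * n) * 2) s)) (cong (_^ R) (collect r s n))) ⟩
    (40 * (s * s) * r * n) ^ R * n             ∎
    where
    open ≤-Reasoning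
    R = 2 ^ r
    regroup : ∀ r x y → 20 * (r * (x * y)) ≡ 20 * r * x * y
    regroup = solve-∀
    collect : ∀ r s n → 20 * r * (s * n) * 2 * s ≡ 40 * (s * s) * r * n
    collect = solve-∀
    s≤ : s ≤ s ^ R
    s≤ = ≤-trans (≤-reflexive (sym (*-identityʳ s))) (^-monoʳ-≤ s {{ℕ.>-nonZero 1≤s}} (m^n>0 2 r))
    density : (2 ^ E) ^ R ≤ 2 ^ R * N
    density = begin
      (2 ^ E) ^ R             ≡⟨ ^-*-assoc 2 E R ⟩
      2 ^ (E * R)             ≤⟨ ^-monoʳ-≤ 2 E-upper ⟩
      2 ^ (4 * a + R)         ≡⟨ ^-distribˡ-+-* 2 (4 * a) R ⟩
      2 ^ (4 * a) * 2 ^ R     ≡⟨ *-comm (2 ^ (4 * a)) (2 ^ R) ⟩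
      2 ^ R * 2 ^ (4 * a)     ≡⟨ cong (2 ^ R *_) (trans (cong (2 ^_) (four a)) (sym N≡2^L)) ⟩
      2 ^ R * N               ∎
      where
      four : ∀ a → 4 * a ≡ a + a + (a + a)
      four = solve-∀

  edges₁ : m ^ (2 ^ r) ≤ (80 * (s * s) * r * n) ^ (2 ^ r) * n
  edges₁ = ≤-trans edges (*-monoˡ-≤ n (^-monoˡ-≤ (2 ^ r) (*-monoˡ-≤ n (*-monoˡ-≤ r (*-monoˡ-≤ (s * s) (m≤m+n 40 40))))))

  -- Here n^(1/2^r) is at most 2, which is the passage from 40 to 80.
  edges₂ : n ≤ 2 ^ (2 ^ r) → m ≤ 80 * (s * s) * n * r
  edges₂ n≤ = ≮⇒≥ λ lt → <-irrefl refl (<-≤-trans (^-monoˡ-< (2 ^ r) {{m^n≢0 2 r}} lt) (begin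
    m ^ (2 ^ r)                                            ≤⟨ edges ⟩
    (40 * (s * s) * r * n) ^ (2 ^ r) * n                   ≤⟨ *-monoʳ-≤ ((40 * (s * s) * r * n) ^ (2 ^ r)) n≤ ⟩
    (40 * (s * s) * r * n) ^ (2 ^ r) * 2 ^ (2 ^ r)         ≡⟨ sym (*-^ (2 ^ r) (40 * (s * s) * r * n) 2) ⟩
    (40 * (s * s) * r * n * 2) ^ (2 ^ r)                   ≡⟨ cong (_^ (2 ^ r)) (collect r (s * s) n) ⟩
    (80 * (s * s) * n * r) ^ (2 ^ r)                       ∎))
    where
    open ≤-Reasoning
    collect : ∀ r s n → 40 * s * r * n * 2 ≡ 80 * s * n * r
    collect = solve-∀

  β≤ : β ≤ 2 ^ lg β
  β≤ = ≤2^lg β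

  ρ^k≤β : ρ ^ k ≤ β
  ρ^k≤β = m≤n*m (ρ ^ k) 64

  -- r is at most 2 (r - 1), so `4 * ρ ^ r` is at most β³.
  J≤ : J ≤ lg β * 3
  J≤ = 2^-cancel (begin
    2 ^ J                        ≤⟨ ^-monoʳ-≤ 2 (m⊓n≤m (up (2 * ρ ^ r)) L) ⟩
    2 ^ up (2 * ρ ^ r)           ≤⟨ 2^up≤ (2 * ρ ^ r) (≤-trans (m^n>0 ρ {{ρ≢0}} r) (m≤n*m (ρ ^ r) 2)) ⟩
    2 * (2 * ρ ^ r)              ≡⟨ sym (*-assoc 2 2 (ρ ^ r)) ⟩
    4 * ρ ^ r                    ≤⟨ *-mono-≤ (≤-trans (m≤m+n 4 60) (m≤m*n 64 (ρ ^ k) {{m^n≢0 ρ k {{ρ≢0}}}})) ρ^r≤ ⟩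
    β * (β * β)                  ≤⟨ *-mono-≤ β≤ (*-mono-≤ β≤ β≤) ⟩
    2 ^ lg β * (2 ^ lg β * 2 ^ lg β) ≡⟨ trans (cube (2 ^ lg β)) (^-*-assoc 2 (lg β) 3) ⟩
    2 ^ (lg β * 3)               ∎)
    where
    open ≤-Reasoning
    cube : ∀ x → x * (x * x) ≡ x * (x * (x * 1))
    cube = solve-∀
    ρ^r≤ : ρ ^ r ≤ β * β
    ρ^r≤ = ≤-trans (^-monoʳ-≤ ρ {{ρ≢0}} (≤-trans (≤-reflexive (sym r≡)) (+-monoˡ-≤ k 1≤k))) (≤-trans (≤-reflexive (^-distribˡ-+-* ρ k k)) (*-mono-≤ ρ^k≤β ρ^k≤β))

  k≤ : k ≤ lg β
  k≤ = 2^-cancel (≤-trans (^-monoˡ-≤ k (≤-trans (m≤m+n 2 254) 256≤ρ)) (≤-trans ρ^k≤β β≤))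

  -- Both J and r are of order log β, which turns the round count e (J + r)² into log² β / ε.
  Y≤ : suc J + r ≤ lg β * 6
  Y≤ = begin
    suc J + r                      ≡⟨ cong (suc J +_) (sym r≡) ⟩
    suc J + suc k                  ≤⟨ +-mono-≤ (+-mono-≤ 1≤lgβ J≤) (+-mono-≤ 1≤lgβ k≤) ⟩
    lg β + lg β * 3 + (lg β + lg β) ≡⟨ collect (lg β) ⟩
    lg β * 6                       ∎
    where
    open ≤-Reasoning
    1≤lgβ : 1 ≤ lg β
    1≤lgβ = m≤m⊔n 1 ⌈log₂ β ⌉
    collect : ∀ x → x + x * 3 + (x + x) ≡ x * 6
    collect = solve-∀

  open Programs N 18 (Clique.W a e r 3≤a 1≤e 2≤r) {{Clique.W≢0 a e r 3≤a 1≤e 2≤r}} using (rounds♭; flatten; rounds♭-flatten)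

  time : rounds♭ (flatten program) ≤ e * (rate * 36 * lg β ^ 2)
  time = ≤-trans (≤-reflexive (rounds♭-flatten program)) (≤-trans program-rounds
    (≤-trans (*-monoʳ-≤ rate (*-monoʳ-≤ e (*-mono-≤ Y≤ Y≤))) (≤-reflexive (regroup rate e (lg β)))))
    where
    regroup : ∀ c e l → c * (e * (l * 6 * (l * 6))) ≡ e * (c * 36 * (l * (l * 1)))
    regroup = solve-∀

  -- `1 ≤ k` allows the constant 64 to move under the power.
  error : β ≤ (e * (steep * r)) ^ k
  error = ≤-trans (*-monoˡ-≤ (ρ ^ k) (≤-trans (≤-reflexive (sym (*-identityʳ 64))) (^-monoʳ-≤ 64 1≤k)))
    (≤-reflexive (trans (sym (*-^ k 64 ρ)) (cong (_^ k) (trans (steep-* (e * r)) (regroup steep e r)))))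
    where
    regroup : ∀ c e r → c * (e * r) ≡ e * (c * r)
    regroup = solve-∀

-- The two statements of the theorem

idle : ∀ n b → CCAlgorithm n b
idle n b = record
  { State  = ℕ
  ; init   = λ _ _ → 0
  ; send   = λ _ _ → replicate b false
  ; recv   = λ st _ → st
  ; output = λ _ → []
  }

-- Without vertices there is no host for virtual nodes, so the empty graph is served by silence.
idle-builds : ∀ b ε → Builds (idle 0 b) 0 ε 0 0
idle-builds b ε G = ((λ ()) , (λ ()) , (λ ())) , z≤n

Quality : (D n : ℕ) → ℚ → ℕ → ℕ → ℕ → Set
Quality D n ε r β T = (∀ Y → ⟦ T ⟧ *ℚ ε ≤ℚ ⟦ D * lg β ^ 2 ⟧ +ℚ ⟦ Y ⟧ *ℚ ε) × ⟦ β ⟧ *ℚ (ε ^ℚ (r ∸ 1)) ≤ℚ ⟦ (Error * r) ^ (r ∸ 1) ⟧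

emulator : ∀ n ε r → 0ℚ <ℚ ε → ε <ℚ 1ℚ → 2 ≤ r →
  Σ[ β ∈ ℕ ] Σ[ T ∈ ℕ ] Σ[ m ∈ ℕ ] Σ[ A ∈ CCAlgorithm n (Bits * lg n) ]
    (Builds A T ε β m
    × (m ^ (2 ^ r) ≤ (Edges * r * n) ^ (2 ^ r) * n × (n ≤ 2 ^ (2 ^ r) → m ≤ Edges * n * r))
    × Quality Time n ε r β T)
emulator zero ε r 0<ε ε<1 2≤r = 0 , 0 , 0 , idle 0 (Bits * lg 0) , idle-builds (Bits * lg 0) ε ,
  (≤-trans (≤-reflexive (0^ (2 ^ r) (m^n>0 2 r))) z≤n , (λ _ → z≤n)) ,
  (λ Y → ≤ℚ-of-0 ε (ℚ.≤-trans (⟦⟧-mono {0} {Time * lg 0 ^ 2} z≤n) (ℚ.≤-trans (ℚ.≤-reflexive (sym (ℚ.+-identityʳ _)))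
    (ℚ.+-monoʳ-≤ ⟦ Time * lg 0 ^ 2 ⟧ (ℚ.≤-trans (ℚ.≤-reflexive (sym (ℚ.*-zeroʳ ⟦ Y ⟧))) (ℚ.*-monoˡ-≤-nonNeg ⟦ Y ⟧ {{⟦⟧-nonNeg Y}} (ℚ.<⇒≤ 0<ε))))))) ,
  ≤ℚ-of-0 (ε ^ℚ (r ∸ 1)) (⟦⟧-mono {0} {(Error * r) ^ (r ∸ 1)} z≤n)
  where
  0^ : ∀ k → 1 ≤ k → 0 ^ k ≡ 0
  0^ (suc k) _ = refl
  ≤ℚ-of-0 : ∀ p {q} → 0ℚ ≤ℚ q → ⟦ 0 ⟧ *ℚ p ≤ℚ q
  ≤ℚ-of-0 p le = ℚ.≤-trans (ℚ.≤-reflexive (ℚ.*-zeroˡ p)) le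
emulator n@(suc _) ε r 0<ε ε<1 2≤r =
  let e , 1≤e , 1≤eε , eε≤2 = reciprocal ε 0<ε ε<1
      open Rational e ε 1≤e 0<ε 1≤eε eε≤2
      a   = exponent n
      3≤a = 3≤exponent n
      N≤  = size≤ n (s≤s z≤n)
      open Main n e r a slack (Bits * lg n) 1≤e 2≤r 3≤a (n≤size n) N≤ (words-fit a (suc slack * suc slack * 18) (lg n) (log-size≤ n (s≤s z≤n)))
        using (β; T; m; built; module Al)
      open Bounds n e r a (suc slack) 1≤e 2≤r 3≤a N≤ (s≤s z≤n) using (edges₁; edges₂; time; error)
      D₀ = rate * 36
  in  β , T , m , Al.alg , (λ G → built G ε stretch-ℚ) , (edges₁ , edges₂) ,
      (λ Y → subst (λ x → ⟦ T ⟧ *ℚ ε ≤ℚ ⟦ x ⟧ +ℚ ⟦ Y ⟧ *ℚ ε) (sym (*-assoc 2 D₀ (lg β ^ 2))) (rounds-ℚ T (D₀ * lg β ^ 2) Y time)) ,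
      ℚ.≤-trans (ℚ.*-monoʳ-≤-nonNeg (ε ^ℚ (r ∸ 1)) {{ℚ.nonNegative (0≤ε^ (r ∸ 1))}} (⟦⟧-mono error))
        (ℚ.≤-trans (power-ℚ (steep * r) (r ∸ 1)) (ℚ.≤-reflexive (cong (λ x → ⟦ x ^ (r ∸ 1) ⟧) (sym (*-assoc 2 steep r)))))

-- `ε < 1 ≤ X` permits one more factor on each side; it leads from the exponent r - 1 of the general
-- bound to the exponent r of the special case.
error-next : ∀ β ε k X → 0ℚ <ℚ ε → ε <ℚ 1ℚ → 1 ≤ X → ⟦ β ⟧ *ℚ (ε ^ℚ k) ≤ℚ ⟦ X ^ k ⟧ → ⟦ β ⟧ *ℚ (ε ^ℚ suc k) ≤ℚ ⟦ X ^ suc k ⟧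
error-next β ε k X 0<ε ε<1 1≤X le = begin
  ⟦ β ⟧ *ℚ (ε *ℚ (ε ^ℚ k))    ≡⟨ solve 3 (λ b ε p → b :* (ε :* p) := ε :* (b :* p)) refl ⟦ β ⟧ ε (ε ^ℚ k) ⟩
  ε *ℚ (⟦ β ⟧ *ℚ (ε ^ℚ k))    ≤⟨ ℚ.*-monoˡ-≤-nonNeg ε {{ℚ.nonNegative (ℚ.<⇒≤ 0<ε)}} le ⟩
  ε *ℚ ⟦ X ^ k ⟧              ≤⟨ ℚ.*-monoʳ-≤-nonNeg ⟦ X ^ k ⟧ {{⟦⟧-nonNeg (X ^ k)}} (ℚ.<⇒≤ ε<1) ⟩
  1ℚ *ℚ ⟦ X ^ k ⟧             ≡⟨ ℚ.*-identityˡ ⟦ X ^ k ⟧ ⟩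
  ⟦ X ^ k ⟧                   ≤⟨ ⟦⟧-mono (≤-trans (≤-reflexive (sym (*-identityˡ (X ^ k)))) (*-monoˡ-≤ (X ^ k) 1≤X)) ⟩
  ⟦ X ^ suc k ⟧               ∎
  where
  open ℚ.≤-Reasoning
  open import Data.Rational.Solver using (module +-*-Solver)
  open +-*-Solver using (solve; _:=_; _:*_)

theorem3p9 : Σ[ B ∈ ℕ ] Σ[ C ∈ ℕ ] Σ[ D ∈ ℕ ] Σ[ K ∈ ℕ ]
    ((∀ (n : ℕ) (ε : ℚ) (r : ℕ) → 0ℚ <ℚ ε → ε <ℚ 1ℚ → 2 ≤ r →
    Σ[ β ∈ ℕ ] Σ[ T ∈ ℕ ] Σ[ m ∈ ℕ ] Σ[ A ∈ CCAlgorithm n (B * lg n) ]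
    (Builds A T ε β m
    × m ^ (2 ^ r) ≤ (C * r * n) ^ (2 ^ r) * n
    × ⟦ T ⟧ *ℚ ε ≤ℚ ⟦ D * lg β ^ 2 ⟧ +ℚ ⟦ D * r * lg (lg n) ^ 3 ⟧ *ℚ ε
    × ⟦ β ⟧ *ℚ (ε ^ℚ (r ∸ 1)) ≤ℚ ⟦ (K * r) ^ (r ∸ 1) ⟧))
    × (∀ (n : ℕ) (ε : ℚ) → 0ℚ <ℚ ε → ε <ℚ 1ℚ → 2 ≤ lg (lg n) →
    Σ[ β ∈ ℕ ] Σ[ T ∈ ℕ ] Σ[ m ∈ ℕ ] Σ[ A ∈ CCAlgorithm n (B * lg n) ]
    (Builds A T ε β m
    × m ≤ C * n * lg (lg n)
    × ⟦ T ⟧ *ℚ ε ≤ℚ ⟦ D * lg β ^ 2 ⟧ +ℚ ⟦ D * lg (lg n) ^ 4 ⟧ *ℚ ε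
    × ⟦ β ⟧ *ℚ (ε ^ℚ lg (lg n)) ≤ℚ ⟦ (K * lg (lg n)) ^ lg (lg n) ⟧)))
theorem3p9 = Bits , Edges , Time , Error , general , special
  where
  general : ∀ n ε r → 0ℚ <ℚ ε → ε <ℚ 1ℚ → 2 ≤ r → _
  general n ε r 0<ε ε<1 2≤r =
    let β , T , m , A , builds , (edges , _) , (time , error) = emulator n ε r 0<ε ε<1 2≤r
    in  β , T , m , A , builds , edges , time (Time * r * lg (lg n) ^ 3) , error
  special : ∀ n ε → 0ℚ <ℚ ε → ε <ℚ 1ℚ → 2 ≤ lg (lg n) → _
  special n ε 0<ε ε<1 2≤r =
    let r = lg (lg n)
        β , T , m , A , builds , (_ , edges) , (time , error) = emulator n ε r 0<ε ε<1 2≤r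
        r≡ : suc (r ∸ 1) ≡ r
        r≡ = m+[n∸m]≡n (≤-trans (s≤s z≤n) 2≤r)
    -- For `r = lg (lg n)`, rounding up twice gives n at most `2 ^ (2 ^ r)`, the hypothesis of the
    -- linear edge bound.
    in  β , T , m , A , builds , edges (≤-trans (≤2^lg n) (^-monoʳ-≤ 2 (≤2^lg (lg n)))) , time (Time * lg (lg n) ^ 4) ,
        subst (λ i → ⟦ β ⟧ *ℚ (ε ^ℚ i) ≤ℚ ⟦ (Error * r) ^ i ⟧) r≡
          (error-next β ε (r ∸ 1) (Error * r) 0<ε ε<1 (*-mono-≤ {1} {Error} (≤-trans 1≤steep (m≤n*m steep 2)) (≤-trans (s≤s z≤n) 2≤r)) error)
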